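{- Consider the following relations on $\mathbb Z$, all first-order definable in $\langle \mathbb Z,<\rangle$: \begin{itemize} \item $x<y$ (order); \item $+1$: the binary successor relation $y=x+1$; \item ${A_1}_1(x,y,z,t)\iff (x-y=z-t)\wedge |x-y|=1$ (1-codirection); \item $B(a,b,c)\iff (a<b<c)\vee(a>b>c)$ (between); \item $C(a,b,c)\iff (a<b<c)\vee(b<c<a)\vee(c<a<b)$ (cycle); \item $S(a,b,c,d)\iff \big(B(a,b,c)\vee B(a,d,c)\big)\wedge\big(B(b,a,d)\vee B(b,c,d)\big)$ (separation). \end{itemize} For a relation $R$ on $\mathbb Z$ let $\langle R\rangle$ denote the definability space generated by $R$. Then: \begin{enumerate} \item The definability spaces $V$ on $\mathbb Z$ with $\langle {A_1}_1\rangle\subseteq V\subseteq\langle <\rangle$ are exactly the six spaces $\langle {A_1}_1\rangle,\ \langle +1\rangle,\ \langle S\rangle,\ \langle B\rangle,\ \langle C\rangle,\ \langle <\rangle$, and these six spaces are pairwise distinct. \item The following inclusions hold and are all strict: \[\langle {A_1}_1\rangle\subsetneq\langle +1\rangle,\quad \langle {A_1}_1\rangle\subsetneq\langle S\rangle,\quad \langle S\rangle\subsetneq\langle B\rangle,\quad \langle S\rangle\subsetneq\langle C\rangle,\quad \langle +1\rangle\subsetneq\langle C\rangle,\quad \langle B\rangle\subsetneq\langle <\rangle,\quad \langle C\rangle\subsetneq\langle <\rangle.\] \item Every inclusion between two of these six spaces follows from the inclusions listed in (2) by transitivity. In particular, $\langle +1\rangle$ and $\langle S\rangle$ are incomparable,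 $\langle +1\rangle$ and $\langle B\rangle$ are incomparable, and $\langle B\rangle$ and $\langle C\rangle$ are incomparable. \end{enumerate}
   Context: A definability space on a set $U$ is a set of relations on $U$ (of all finite arities) that is closed under first-order definability: every relation that is first-order definable without parameters (with equality allowed) from relations in the set belongs to the set. For a relation $R$ on $U$, $\langle R\rangle$ is the set of all relations on $U$ first-order definable (with equality, without parameters) from $R$. All relations above are definable in $\langle\mathbb Z,<\rangle$, so all these spaces lie inside $\langle <\rangle$. -}

module Defs where

open import Data.Fin.Base using (Fin)
open import Data.Integer.Base using (ℤ; _+_; _-_; _<_; _>_; 1ℤ; ∣_∣)
open import Data.Nat.Base using (ℕ; suc)
open import Data.Product.Base using (Σ-syntax; ∃; _×_; _,_; proj₁; proj₂)
open import Data.Sum.Base using (_⊎_)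
open import Data.Unit.Base using (⊤)
open import Data.Vec.Base using (Vec; []; _∷_; lookup; map)
open import Function.Base using (_∘_)
open import Level using (Level; 0ℓ) renaming (suc to lsuc; _⊔_ to _⊔ˡ_)
open import Relation.Binary.PropositionalEquality.Core using (_≡_)
open import Relation.Nullary.Negation.Core using (¬_)
open import Relation.Unary using (Pred; _∈_; _⊆_; _≐_)

Relation : Set → ℕ → Set₁
Relation U n = Pred (Vec U n) 0ℓ

RelationSet : Set → (ℓ : Level) → Set (lsuc 0ℓ ⊔ˡ lsuc ℓ)
RelationSet U ℓ = Pred (∃ (Relation U)) ℓ

-- A formula in Formula arity n has its free variables among n variables,
-- given by de Bruijn indices: a quantifier binds variable zero.
data Formula {I : Set} (arity : I → ℕ) : ℕ → Set where
  _≈ᶠ_ : ∀ {n} → Fin n → Fin n → Formula arity n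
  atom : ∀ {n} (i : I) → Vec (Fin n) (arity i) → Formula arity n
  ¬ᶠ_  : ∀ {n} → Formula arity n → Formula arity n
  _∧ᶠ_ : ∀ {n} → Formula arity n → Formula arity n → Formula arity n
  _∨ᶠ_ : ∀ {n} → Formula arity n → Formula arity n → Formula arity n
  ∃ᶠ_  : ∀ {n} → Formula arity (suc n) → Formula arity n
  ∀ᶠ_  : ∀ {n} → Formula arity (suc n) → Formula arity n

_⟦_⟧_ : ∀ {U I : Set} (F : I → ∃ (Relation U)) {n} →
        Formula (proj₁ ∘ F) n → Vec U n → Set
F ⟦ x ≈ᶠ y ⟧ v       = lookup v x ≡ lookup v y
F ⟦ atom i xs ⟧ v    = proj₂ (F i) (map (lookup v) xs)
F ⟦ ¬ᶠ φ ⟧ v         = ¬ (F ⟦ φ ⟧ v)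
F ⟦ φ ∧ᶠ ψ ⟧ v       = (F ⟦ φ ⟧ v) × (F ⟦ ψ ⟧ v)
F ⟦ φ ∨ᶠ ψ ⟧ v       = (F ⟦ φ ⟧ v) ⊎ (F ⟦ ψ ⟧ v)
_⟦_⟧_ {U} F (∃ᶠ φ) v = Σ[ u ∈ U ] (F ⟦ φ ⟧ (u ∷ v))
_⟦_⟧_ {U} F (∀ᶠ φ) v = (u : U) → F ⟦ φ ⟧ (u ∷ v)

-- Relations are compared extensionally, by _≐_.
DefinableFrom : ∀ {U I : Set} → (I → ∃ (Relation U)) → RelationSet U 0ℓ
DefinableFrom F (n , R) = Σ[ φ ∈ Formula (proj₁ ∘ F) n ] R ≐ (F ⟦ φ ⟧_)

-- Finite families suffice, as a formula mentions finitely many relations.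
-- The case k = 1 makes every definability space closed under _≐_.
IsDefinabilitySpace : ∀ {U ℓ} → RelationSet U ℓ → Set (lsuc 0ℓ ⊔ˡ ℓ)
IsDefinabilitySpace {U} V =
  ∀ {k} (F : Fin k → ∃ (Relation U)) → (∀ i → F i ∈ V) → DefinableFrom F ⊆ V

⟨_⟩ : ∀ {U} → ∃ (Relation U) → RelationSet U 0ℓ
⟨ R ⟩ = DefinableFrom {I = ⊤} (λ _ → R)

Between : ℤ → ℤ → ℤ → Set
Between a b c = (a < b × b < c) ⊎ (a > b × b > c)

less : Relation ℤ 2
less (x ∷ y ∷ []) = x < y

successor : Relation ℤ 2
successor (x ∷ y ∷ []) = y ≡ x + 1ℤ

codirection₁ : Relation ℤ 4
codirection₁ (x ∷ y ∷ z ∷ t ∷ []) = (x - y ≡ z - t) × (∣ x - y ∣ ≡ 1)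

between : Relation ℤ 3
between (a ∷ b ∷ c ∷ []) = Between a b c

cycle : Relation ℤ 3
cycle (a ∷ b ∷ c ∷ []) =
  (a < b × b < c) ⊎ (b < c × c < a) ⊎ (c < a × a < b)

separation : Relation ℤ 4
separation (a ∷ b ∷ c ∷ d ∷ []) =
  (Between a b c ⊎ Between a d c) × (Between b a d ⊎ Between b c d)

data Name : Set where
  A₁₁ +1 S B C Ord : Name

relation : Name → ∃ (Relation ℤ)
relation A₁₁ = 4 , codirection₁
relation +1  = 2 , successor
relation S   = 4 , separation
relation B   = 3 , between
relation C   = 3 , cycle
relation Ord = 2 , less

space : Name → RelationSet ℤ 0ℓ
space s = ⟨ relation s ⟩

-- The theorem asserts that s ⟶ t gives a strict inclusion of spaces, and that
-- all inclusions between the six spaces arise by composing these.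
data _⟶_ : Name → Name → Set where
  A₁₁⟶+1 : A₁₁ ⟶ +1
  A₁₁⟶S  : A₁₁ ⟶ S
  S⟶B    : S   ⟶ B
  S⟶C    : S   ⟶ C
  +1⟶C   : +1  ⟶ C
  B⟶Ord  : B   ⟶ Ord
  C⟶Ord  : C   ⟶ Ord

Incomparable : Name → Name → Set₁
Incomparable s t = ¬ (space s ⊆ space t) × ¬ (space t ⊆ space s)

-- A back-and-forth argument shows that membership in a relation R definable from
-- < depends only on the differences of the points truncated at some N, that is,
-- on the shape of the clusters of points at distance at most N and on their order.
--
-- Let the successor be in V. If R ∈ V is not preserved by some rotation, which
-- moves the upper clusters of a tuple below the others, then moving the two parts
-- independently gives a relation of l and u that is true for l ≤ u and false for u
-- far below l, and < is in V. If R is preserved by rotations but depends on the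
-- order of the clusters, then exchanging two adjacent blocks of some tuple changes
-- it, and moving these two blocks and the rest independently gives the cyclic
-- order. Otherwise R is a Boolean combination of conditions x = y + k. So V is
-- ⟨+1⟩, ⟨C⟩ or ⟨<⟩.
--
-- If R ∈ V is not invariant under x ↦ - x, then laying out a tuple along the two
-- directions given by A₁₁ defines the successor. So if the successor is not in V,
-- then V consists of the flip-invariant relations definable from V and the
-- successor, and V is the flip-invariant part of ⟨+1⟩, ⟨C⟩ or ⟨<⟩, which is
-- ⟨A₁₁⟩, ⟨S⟩ or ⟨B⟩. The non-inclusions come from the same invariants.

module Submission where

open import Defs
open import Axiom.ExcludedMiddle using (ExcludedMiddle)
open import Data.Bool.Base using (Bool; true; false; not; if_then_else_; T; _∧_; _∨_)
open import Data.Bool.Properties using (T-∧; T-∨)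
open import Data.Empty using (⊥; ⊥-elim)
import Data.Fin.Base as Fin
open import Data.Fin.Base using (Fin; zero; suc; _↑ˡ_; _↑ʳ_; combine; remQuot)
open import Data.Fin.Patterns using (0F; 1F; 2F; 3F)
import Data.Fin.Properties as Fin
open import Data.Fin.Properties using (any?; all?)
open import Data.Fin.Subset as Subset using (Subset)
open import Data.Fin.Subset.Induction using (⊂-wellFounded)
open import Data.Integer.Base using (ℤ; +_; -[1+_]; _+_; _-_; _*_; -_; _≤_; _<_; 0ℤ; 1ℤ; -1ℤ; +≤+; ∣_∣)
import Data.Integer.Properties as ℤ
open import Data.Integer.Solver using (module +-*-Solver)
import Data.List.Base as List
open import Data.List.Base using (List; []; _∷_)
import Data.List.Membership.Propositional as List
import Data.List.Membership.Propositional.Properties as List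
open import Data.List.Relation.Unary.All as ListAll using ([]; _∷_)
import Data.List.Relation.Unary.All.Properties as ListAll
open import Data.Nat.Base as ℕ using (ℕ; zero; suc; z≤n)
import Data.Nat.Properties as ℕ
open import Data.Product.Base using (∃; _×_; _,_; proj₁; proj₂; Σ-syntax) renaming (map to map-×)
open import Data.Sum.Base using (_⊎_; inj₁; inj₂; [_,_]; [_,_]′) renaming (map to map-⊎)
open import Data.Unit.Base using (⊤; tt)
open import Data.Vec.Base using (Vec; []; _∷_; _++_; allFin; lookup; map; replicate; tabulate; zipWith)
open import Data.Vec.Properties using ([]=⇒lookup; lookup⇒[]=; lookup-map; lookup-replicate; lookup-++ˡ; lookup-++ʳ;
  lookup∘tabulate; map-cong; map-id; map-∘; map-++; map-lookup-allFin; tabulate-cong; tabulate-∘; tabulate∘lookup)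
open import Data.Vec.Relation.Unary.All as VecAll using ([]; _∷_)
import Data.Vec.Relation.Unary.All.Properties as VecAll
open import Function.Base using (_∘_; case_of_; id)
open import Function.Bundles using (_⇔_; mk⇔; Equivalence)
open import Function.Construct.Composition using (_⇔-∘_)
open import Function.Construct.Identity using (⇔-id)
open import Function.Construct.Symmetry using (⇔-sym)
open import Induction.WellFounded using (Acc; acc)
open import Level using (0ℓ; Lift; _⊔_)
open import Relation.Binary.Construct.Closure.ReflexiveTransitive using (Star; ε; _◅_)
open import Relation.Binary.PropositionalEquality using (_≡_; _≢_; refl; sym; trans; cong; cong₂; subst; subst₂)
open import Relation.Nullary using (¬_; Dec; yes; no; does)
open import Relation.Nullary.Decidable using (_×-dec_; _⊎-dec_; _→-dec_; True; dec-true; decidable-stable; map′;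
  toWitness)
open import Relation.Unary using (Decidable; _∈_; _⊆_; _⊂_; _∩_; _∪_; ∁; _≐_)
open Equivalence using (to; from)

-- The relation built from R to define the order or the cyclic order is controlled only while the
-- moved parts are far from each other; parts that come close may interleave. This does no harm: for
-- a fixed K the successor defines closeness up to K together with its direction, so close points
-- are treated directly. The hard step is to find two blocks whose exchange changes R. If R is not
-- `Local`-invariant, this only yields two tuples with the same clusters in orders that may differ
-- widely. One tuple is sorted towards the other by exchanges that only remove inversions, and some
-- exchange on the way must change R. If the successor is not in V, it is added to one relation of V
-- at a time, since a single R already produces the order or the cyclic order whenever either
-- arises. Claims about positions involve a few points at a time and are linear over the integers.
-- They are left to a verified refutation procedure that runs during type checking. Excluded middle
-- decides membership in V and the truth of R.

private variable
  A A′ B′ B″ U I J : Set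
  k m n M N : ℕ

-- Linear integer arithmetic

module LinearArithmetic where

  private module Identities where
    open +-*-Solver

    +-interchange-* : ∀ a b x p q → (a + b) * x + (p + q) ≡ a * x + p + (b * x + q)
    +-interchange-* = solve 5 (λ a b x p q → (a :+ b) :* x :+ (p :+ q) := a :* x :+ p :+ (b :* x :+ q)) refl

    *-factor : ∀ k a x p → k * a * x + k * p ≡ k * (a * x + p)
    *-factor = solve 4 (λ k a x p → k :* a :* x :+ k :* p := k :* (a :* x :+ p)) refl

    +-interchange : ∀ c d p q → c + d + (p + q) ≡ c + p + (d + q)
    +-interchange = solve 4 (λ c d p q → c :+ d :+ (p :+ q) := c :+ p :+ (d :+ q)) refl

    x∙yz≈y∙xz : ∀ c p q → c + (p + q) ≡ p + (c + q)
    x∙yz≈y∙xz = solve 3 (λ c p q → c :+ (p :+ q) := p :+ (c :+ q)) refl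

    cancel-var : ∀ a b x r s → b * (a * x + r) + a * (- b * x + s) ≡ b * r + a * s
    cancel-var = solve 5 (λ a b x r s → b :* (a :* x :+ r) :+ a :* (:- b :* x :+ s) := b :* r :+ a :* s) refl

    shift-suc : ∀ a b → b - (1ℤ + a) ≡ b - a - 1ℤ
    shift-suc = solve 2 (λ a b → b :- (con 1ℤ :+ a) := b :- a :- con 1ℤ) refl

  open Identities

  Affine : ℕ → Set
  Affine n = ℤ × Vec ℤ n

  dot : ∀ {n} → Vec ℤ n → Vec ℤ n → ℤ
  dot []       []      = 0ℤ
  dot (a ∷ as) (x ∷ ρ) = a * x + dot as ρ

  value : ∀ {n} → Affine n → Vec ℤ n → ℤ
  value (c , as) ρ = c + dot as ρ

  addᴬ : ∀ {n} → Affine n → Affine n → Affine n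
  addᴬ (c , as) (d , bs) = c + d , zipWith _+_ as bs

  scaleᴬ : ∀ {n} → ℤ → Affine n → Affine n
  scaleᴬ k (c , as) = k * c , map (k *_) as

  dot-zipWith : ∀ {n} (as bs ρ : Vec ℤ n) → dot (zipWith _+_ as bs) ρ ≡ dot as ρ + dot bs ρ
  dot-zipWith []       []       []      = refl
  dot-zipWith (a ∷ as) (b ∷ bs) (x ∷ ρ) rewrite dot-zipWith as bs ρ = +-interchange-* a b x (dot as ρ) (dot bs ρ)

  dot-map : ∀ {n} k (as ρ : Vec ℤ n) → dot (map (k *_) as) ρ ≡ k * dot as ρ
  dot-map k []       []      = sym (ℤ.*-zeroʳ k)
  dot-map k (a ∷ as) (x ∷ ρ) rewrite dot-map k as ρ = *-factor k a x (dot as ρ)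

  dot-replicate : ∀ {n} (ρ : Vec ℤ n) → dot (replicate n 0ℤ) ρ ≡ 0ℤ
  dot-replicate []      = refl
  dot-replicate (x ∷ ρ) rewrite dot-replicate ρ = refl

  value-addᴬ : ∀ {n} (l m : Affine n) ρ → value (addᴬ l m) ρ ≡ value l ρ + value m ρ
  value-addᴬ (c , as) (d , bs) ρ rewrite dot-zipWith as bs ρ = +-interchange c d (dot as ρ) (dot bs ρ)

  value-scaleᴬ : ∀ {n} k (l : Affine n) ρ → value (scaleᴬ k l) ρ ≡ k * value l ρ
  value-scaleᴬ k (c , as) ρ rewrite dot-map k as ρ = sym (ℤ.*-distribˡ-+ k c (dot as ρ))

  Satisfies : ∀ {n} → Vec ℤ n → List (Affine n) → Set
  Satisfies ρ = ListAll.All (λ l → 0ℤ ≤ value l ρ)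

  -- Fourier–Motzkin elimination of the first variable. A bound (k , l) has the
  -- coefficient ± (k + 1), with the sign of a lower or an upper bound.
  Bounds : ℕ → Set
  Bounds n = List (ℕ × Affine n)

  module _ {n : ℕ} where

    lower upper : List (Affine (suc n)) → Bounds n
    lower []                            = []
    lower ((c , + suc k ∷ as) ∷ cs)     = (k , c , as) ∷ lower cs
    lower (_ ∷ cs)                      = lower cs
    upper []                            = []
    upper ((c , -[1+ k ] ∷ as) ∷ cs)    = (k , c , as) ∷ upper cs
    upper (_ ∷ cs)                      = upper cs

    free : List (Affine (suc n)) → List (Affine n)
    free []                      = []
    free ((c , + zero ∷ as) ∷ cs) = (c , as) ∷ free cs
    free (_ ∷ cs)                = free cs

    resolve : ℕ × Affine n → ℕ × Affine n → Affine n
    -- Both coefficients are ±1, the common case; skipping the multiplications keeps the evaluation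
    -- cheap.
    resolve (0 , l) (0 , m) = addᴬ l m
    resolve (j , l) (k , m) = addᴬ (scaleᴬ (+ suc k) l) (scaleᴬ (+ suc j) m)

    resolveAll : Bounds n → Bounds n → List (Affine n)
    resolveAll []       ms = []
    resolveAll (l ∷ ls) ms = List.map (resolve l) ms List.++ resolveAll ls ms

    eliminate : List (Affine (suc n)) → List (Affine n)
    eliminate cs = free cs List.++ resolveAll (lower cs) (upper cs)

    Lower Upper : ℤ → Vec ℤ n → Bounds n → Set
    Lower x ρ = ListAll.All (λ (k , l) → 0ℤ ≤ + suc k * x + value l ρ)
    Upper x ρ = ListAll.All (λ (k , l) → 0ℤ ≤ -[1+ k ] * x + value l ρ)

    lower-sound : ∀ x ρ cs → Satisfies (x ∷ ρ) cs → Lower x ρ (lower cs)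
    lower-sound x ρ []                          []       = []
    lower-sound x ρ ((c , + suc k ∷ as) ∷ cs)  (p ∷ ps) = subst (0ℤ ≤_) (x∙yz≈y∙xz c (+ suc k * x) (dot as ρ))
        p ∷ lower-sound x ρ cs ps
    lower-sound x ρ ((c , + zero ∷ as) ∷ cs)   (p ∷ ps) = lower-sound x ρ cs ps
    lower-sound x ρ ((c , -[1+ k ] ∷ as) ∷ cs) (p ∷ ps) = lower-sound x ρ cs ps

    upper-sound : ∀ x ρ cs → Satisfies (x ∷ ρ) cs → Upper x ρ (upper cs)
    upper-sound x ρ []                          []       = []
    upper-sound x ρ ((c , -[1+ k ] ∷ as) ∷ cs) (p ∷ ps) = subst (0ℤ ≤_) (x∙yz≈y∙xz c (-[1+ k ] * x) (dot as ρ))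
        p ∷ upper-sound x ρ cs ps
    upper-sound x ρ ((c , + zero ∷ as) ∷ cs)   (p ∷ ps) = upper-sound x ρ cs ps
    upper-sound x ρ ((c , + suc k ∷ as) ∷ cs)  (p ∷ ps) = upper-sound x ρ cs ps

    free-sound : ∀ x ρ cs → Satisfies (x ∷ ρ) cs → Satisfies ρ (free cs)
    free-sound x ρ []                          []       = []
    free-sound x ρ ((c , + zero ∷ as) ∷ cs)   (p ∷ ps) = subst (0ℤ ≤_)
        (cong (λ z → c + z) (ℤ.+-identityˡ (dot as ρ))) p ∷ free-sound x ρ cs ps
    free-sound x ρ ((c , + suc k ∷ as) ∷ cs)  (p ∷ ps) = free-sound x ρ cs ps
    free-sound x ρ ((c , -[1+ k ] ∷ as) ∷ cs) (p ∷ ps) = free-sound x ρ cs ps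

    nonneg-combination : ∀ j k {p q} → 0ℤ ≤ p → 0ℤ ≤ q → 0ℤ ≤ + suc k * p + + suc j * q
    nonneg-combination j k {p} {q} 0≤p 0≤q = ℤ.+-mono-≤ (scale k 0≤p) (scale j 0≤q)
      where
      scale : ∀ k {p} → 0ℤ ≤ p → 0ℤ ≤ + suc k * p
      scale k {p} 0≤p = subst (_≤ + suc k * p) (ℤ.*-zeroʳ (+ suc k)) (ℤ.*-monoˡ-≤-nonNeg (+ suc k) 0≤p)

    resolve-sound : ∀ x ρ l m → 0ℤ ≤ + suc (proj₁ l) * x + value (proj₂ l) ρ →
      0ℤ ≤ -[1+ proj₁ m ] * x + value (proj₂ m) ρ → 0ℤ ≤ value (resolve l m) ρ
    resolve-sound x ρ (j , l) (k , m) p q = go j k p q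
      where
      combined : ∀ j k → 0ℤ ≤ + suc j * x + value l ρ → 0ℤ ≤ -[1+ k ] * x + value m ρ →
        0ℤ ≤ + suc k * value l ρ + + suc j * value m ρ
      combined j k p q = subst (0ℤ ≤_) (cancel-var (+ suc j) (+ suc k) x (value l ρ) (value m ρ))
          (nonneg-combination j k p q)

      scaled : ∀ j k → 0ℤ ≤ + suc k * value l ρ + + suc j * value m ρ → 0ℤ ≤ value
          (addᴬ (scaleᴬ (+ suc k) l) (scaleᴬ (+ suc j) m)) ρ
      scaled j k r rewrite value-addᴬ (scaleᴬ (+ suc k) l) (scaleᴬ (+ suc j) m) ρ
                         | value-scaleᴬ (+ suc k) l ρ | value-scaleᴬ (+ suc j) m ρ = r

      go : ∀ j k → 0ℤ ≤ + suc j * x + value l ρ → 0ℤ ≤ -[1+ k ] * x + value m ρ → 0ℤ ≤ value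
          (resolve (j , l) (k , m)) ρ
      go zero zero p q rewrite value-addᴬ l m ρ =
        subst (0ℤ ≤_) (cong₂ _+_ (ℤ.*-identityˡ (value l ρ)) (ℤ.*-identityˡ (value m ρ))) (combined 0 0 p q)
      go zero    (suc k) p q = scaled 0 (suc k) (combined 0 (suc k) p q)
      go (suc j) k       p q = scaled (suc j) k (combined (suc j) k p q)

    resolveAll-sound : ∀ x ρ ls ms → Lower x ρ ls → Upper x ρ ms → Satisfies ρ (resolveAll ls ms)
    resolveAll-sound x ρ []       ms []       qs = []
    resolveAll-sound x ρ (l ∷ ls) ms (p ∷ ps) qs = ListAll.++⁺ (row ms qs) (resolveAll-sound x ρ ls ms ps qs)
      where
      row : ∀ ms → Upper x ρ ms → Satisfies ρ (List.map (resolve l) ms)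
      row []       []       = []
      row (m ∷ ms) (q ∷ qs) = resolve-sound x ρ l m p q ∷ row ms qs

    eliminate-sound : ∀ x ρ cs → Satisfies (x ∷ ρ) cs → Satisfies ρ (eliminate cs)
    eliminate-sound x ρ cs ps = ListAll.++⁺ (free-sound x ρ cs ps)
        (resolveAll-sound x ρ (lower cs) (upper cs) (lower-sound x ρ cs ps) (upper-sound x ρ cs ps))

  isNegative : ℤ → Bool
  isNegative (+ _)    = false
  isNegative -[1+ _ ] = true

  -- This tests infeasibility over the rationals, so it is incomplete over the integers. Integrality
  -- enters only through `⊏`, which reads s < t as s + 1 ≤ t.
  infeasible : ∀ {n} → List (Affine n) → Bool
  infeasible {zero}  []              = false
  infeasible {zero}  ((c , []) ∷ cs) = isNegative c ∨ infeasible cs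
  infeasible {suc n} cs              = infeasible (eliminate cs)

  infeasible-sound : ∀ {n} (ρ : Vec ℤ n) cs → T (infeasible cs) → ¬ Satisfies ρ cs
  infeasible-sound []      ((-[1+ k ] , []) ∷ cs) t (() ∷ _)
  infeasible-sound []      ((+ c , []) ∷ cs)      t (_ ∷ ps) = infeasible-sound [] cs t ps
  infeasible-sound (x ∷ ρ) cs t ps = infeasible-sound ρ (eliminate cs) t (eliminate-sound x ρ cs ps)

  infixl 8 _:+_ _:-_
  infix  7 _:≤_ _:<_ _:≡_
  infix  6 :¬_
  infixr 5 _:∧_
  infixr 4 _:∨_
  infixr 3 _:→_

  data Term (n : ℕ) : Set where
    var       : Fin n → Term n
    con       : ℤ → Term n
    :-_       : Term n → Term n
    _:+_ _:-_ : Term n → Term n → Term n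

  data Arith (n : ℕ) : Set where
    _:≤_ _:<_ _:≡_   : Term n → Term n → Arith n
    _:∧_ _:∨_ _:→_   : Arith n → Arith n → Arith n
    :⊥               : Arith n

  :¬_ : ∀ {n} → Arith n → Arith n
  :¬ f = f :→ :⊥

  module _ {n} (ρ : Vec ℤ n) where

    ⟦_⟧ᵗ : Term n → ℤ
    ⟦ var i ⟧ᵗ  = lookup ρ i
    ⟦ con c ⟧ᵗ  = c
    ⟦ :- s ⟧ᵗ   = - ⟦ s ⟧ᵗ
    ⟦ s :+ t ⟧ᵗ = ⟦ s ⟧ᵗ + ⟦ t ⟧ᵗ
    ⟦ s :- t ⟧ᵗ = ⟦ s ⟧ᵗ - ⟦ t ⟧ᵗ

    ⟦_⟧ᵃ : Arith n → Set
    ⟦ s :≤ t ⟧ᵃ = ⟦ s ⟧ᵗ ≤ ⟦ t ⟧ᵗ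
    ⟦ s :< t ⟧ᵃ = ⟦ s ⟧ᵗ < ⟦ t ⟧ᵗ
    ⟦ s :≡ t ⟧ᵃ = ⟦ s ⟧ᵗ ≡ ⟦ t ⟧ᵗ
    ⟦ f :∧ g ⟧ᵃ = ⟦ f ⟧ᵃ × ⟦ g ⟧ᵃ
    ⟦ f :∨ g ⟧ᵃ = ⟦ f ⟧ᵃ ⊎ ⟦ g ⟧ᵃ
    ⟦ f :→ g ⟧ᵃ = ⟦ f ⟧ᵃ → ⟦ g ⟧ᵃ
    ⟦ :⊥ ⟧ᵃ     = ⊥

    ⟦_⟧ᵃ? : ∀ f → Dec ⟦ f ⟧ᵃ
    ⟦ s :≤ t ⟧ᵃ? = ⟦ s ⟧ᵗ ℤ.≤? ⟦ t ⟧ᵗ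
    ⟦ s :< t ⟧ᵃ? = ⟦ s ⟧ᵗ ℤ.<? ⟦ t ⟧ᵗ
    ⟦ s :≡ t ⟧ᵃ? = ⟦ s ⟧ᵗ ℤ.≟ ⟦ t ⟧ᵗ
    ⟦ f :∧ g ⟧ᵃ? = ⟦ f ⟧ᵃ? ×-dec ⟦ g ⟧ᵃ?
    ⟦ f :∨ g ⟧ᵃ? = ⟦ f ⟧ᵃ? ⊎-dec ⟦ g ⟧ᵃ?
    ⟦ f :→ g ⟧ᵃ? = ⟦ f ⟧ᵃ? →-dec ⟦ g ⟧ᵃ?
    ⟦ :⊥ ⟧ᵃ?     = no id

  unit : ∀ {n} → Fin n → Vec ℤ n
  unit {suc n} zero    = 1ℤ ∷ replicate n 0ℤ
  unit {suc n} (suc i) = 0ℤ ∷ unit i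

  affine : ∀ {n} → Term n → Affine n
  affine (var i)  = 0ℤ , unit i
  affine (con c)  = c , replicate _ 0ℤ
  affine (:- s)   = scaleᴬ -1ℤ (affine s)
  affine (s :+ t) = addᴬ (affine s) (affine t)
  affine (s :- t) = addᴬ (affine s) (scaleᴬ -1ℤ (affine t))

  dot-unit : ∀ {n} (i : Fin n) ρ → dot (unit i) ρ ≡ lookup ρ i
  dot-unit zero    (x ∷ ρ) rewrite dot-replicate ρ = trans (ℤ.+-identityʳ (1ℤ * x)) (ℤ.*-identityˡ x)
  dot-unit (suc i) (x ∷ ρ) rewrite dot-unit i ρ = ℤ.+-identityˡ (lookup ρ i)

  affine-correct : ∀ {n} (ρ : Vec ℤ n) s → value (affine s) ρ ≡ ⟦ ρ ⟧ᵗ s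
  affine-correct ρ (var i)  = trans (ℤ.+-identityˡ _) (dot-unit i ρ)
  affine-correct ρ (con c)  = trans (cong (λ z → c + z) (dot-replicate ρ)) (ℤ.+-identityʳ c)
  affine-correct ρ (:- s)   = trans (value-scaleᴬ -1ℤ (affine s) ρ)
      (trans (ℤ.-1*i≡-i _) (cong -_ (affine-correct ρ s)))
  affine-correct ρ (s :+ t) = trans (value-addᴬ (affine s) (affine t) ρ)
      (cong₂ _+_ (affine-correct ρ s) (affine-correct ρ t))
  affine-correct ρ (s :- t) = trans (value-addᴬ (affine s) (scaleᴬ -1ℤ (affine t)) ρ)
    (cong₂ _+_ (affine-correct ρ s) (trans (value-scaleᴬ -1ℤ (affine t) ρ)
        (trans (ℤ.-1*i≡-i _) (cong -_ (affine-correct ρ t)))))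

  -- The tableau is in continuation-passing style: a Branch tells whether the
  -- part of the tableau below the given constraints closes.
  Branch : ℕ → Set
  Branch n = List (Affine n) → Bool

  _⊑_ _⊏_ : ∀ {n} → Term n → Term n → Affine n
  s ⊑ t = affine (t :- s)
  s ⊏ t = affine (t :- s :- con 1ℤ)

  -- Without the test before splitting the tableau is too large to evaluate.
  split : ∀ {n} → Branch n → Branch n → Branch n
  split k l cs = infeasible cs ∨ (k cs ∧ l cs)

  assume refute : ∀ {n} → Arith n → Branch n → Branch n
  assume (s :≤ t) k cs = k (s ⊑ t ∷ cs)
  assume (s :< t) k cs = k (s ⊏ t ∷ cs)
  assume (s :≡ t) k cs = k (s ⊑ t ∷ t ⊑ s ∷ cs)
  assume (f :∧ g) k cs = assume f (assume g k) cs
  assume (f :∨ g) k cs = split (assume f k) (assume g k) cs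
  assume (f :→ g) k cs = split (refute f k) (assume g k) cs
  assume :⊥       k cs = true
  refute (s :≤ t) k cs = k (t ⊏ s ∷ cs)
  refute (s :< t) k cs = k (t ⊑ s ∷ cs)
  refute (s :≡ t) k cs = split (k ∘ (s ⊏ t ∷_)) (k ∘ (t ⊏ s ∷_)) cs
  refute (f :∧ g) k cs = split (refute f k) (refute g k) cs
  refute (f :∨ g) k cs = refute f (refute g k) cs
  refute (f :→ g) k cs = assume f (refute g k) cs
  refute :⊥       k cs = k cs

  module _ {n} (ρ : Vec ℤ n) where

    Closes : Branch n → Set → Set
    Closes k A = ∀ cs → T (k cs) → A → ¬ Satisfies ρ cs

    ⊑-sound : ∀ s t → ⟦ ρ ⟧ᵗ s ≤ ⟦ ρ ⟧ᵗ t → 0ℤ ≤ value (s ⊑ t) ρ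
    ⊑-sound s t p = subst (0ℤ ≤_) (sym (affine-correct ρ (t :- s))) (ℤ.i≤j⇒0≤j-i p)

    ⊏-sound : ∀ s t → ⟦ ρ ⟧ᵗ s < ⟦ ρ ⟧ᵗ t → 0ℤ ≤ value (s ⊏ t) ρ
    ⊏-sound s t p = subst (0ℤ ≤_) (trans (shift-suc (⟦ ρ ⟧ᵗ s) (⟦ ρ ⟧ᵗ t))
        (sym (affine-correct ρ (t :- s :- con 1ℤ))))
      (ℤ.i≤j⇒0≤j-i (ℤ.i<j⇒suc[i]≤j p))

    split-sound : ∀ {k l : Branch n} cs → T (split k l cs) → Satisfies ρ cs → T (k cs) × T (l cs)
    split-sound cs c ps with Equivalence.to T-∨ c
    ... | inj₁ i  = ⊥-elim (infeasible-sound ρ cs i ps)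
    ... | inj₂ kl = Equivalence.to T-∧ kl

    mutual

      assume-sound : ∀ f k → (∀ cs → T (k cs) → ¬ Satisfies ρ cs) → Closes (assume f k) (⟦ ρ ⟧ᵃ f)
      assume-sound (s :≤ t) k h cs c p        ps = h _ c (⊑-sound s t p ∷ ps)
      assume-sound (s :< t) k h cs c p        ps = h _ c (⊏-sound s t p ∷ ps)
      assume-sound (s :≡ t) k h cs c p        ps = h _ c (⊑-sound s t (ℤ.≤-reflexive p) ∷ ⊑-sound t s
          (ℤ.≤-reflexive (sym p)) ∷ ps)
      assume-sound (f :∧ g) k h cs c (p , q)  ps = assume-sound f (assume g k) (λ cs c → assume-sound g k h cs c q)
          cs c p ps
      assume-sound (f :∨ g) k h cs c (inj₁ p) ps = assume-sound f k h cs
          (proj₁ (split-sound {assume f k} {assume g k} cs c ps)) p ps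
      assume-sound (f :∨ g) k h cs c (inj₂ q) ps = assume-sound g k h cs
          (proj₂ (split-sound {assume f k} {assume g k} cs c ps)) q ps
      assume-sound (f :→ g) k h cs c p        ps =
        refute-sound f k h cs (proj₁ (split-sound {refute f k} {assume g k} cs c ps))
            (λ q → assume-sound g k h cs (proj₂ (split-sound {refute f k} {assume g k} cs c ps)) (p q) ps) ps

      refute-sound : ∀ f k → (∀ cs → T (k cs) → ¬ Satisfies ρ cs) → Closes (refute f k) (¬ ⟦ ρ ⟧ᵃ f)
      refute-sound (s :≤ t) k h cs c p ps = h _ c (⊏-sound t s (ℤ.≰⇒> p) ∷ ps)
      refute-sound (s :< t) k h cs c p ps = h _ c (⊑-sound t s (ℤ.≮⇒≥ p) ∷ ps)
      refute-sound (s :≡ t) k h cs c p ps with ⟦ ρ ⟧ᵗ s ℤ.<? ⟦ ρ ⟧ᵗ t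
      ... | yes s<t = h _ (proj₁ (split-sound {k ∘ (s ⊏ t ∷_)} {k ∘ (t ⊏ s ∷_)} cs c ps)) (⊏-sound s t s<t ∷ ps)
      ... | no  s≮t = h _ (proj₂ (split-sound {k ∘ (s ⊏ t ∷_)} {k ∘ (t ⊏ s ∷_)} cs c ps))
          (⊏-sound t s (ℤ.≤∧≢⇒< (ℤ.≮⇒≥ s≮t) (p ∘ sym)) ∷ ps)
      refute-sound (f :∧ g) k h cs c p ps =
        refute-sound f k h cs (proj₁ (split-sound {refute f k} {refute g k} cs c ps))
          (λ q → refute-sound g k h cs (proj₂ (split-sound {refute f k} {refute g k} cs c ps)) (λ r → p (q , r)) ps)
              ps
      refute-sound (f :∨ g) k h cs c p ps =
        refute-sound f (refute g k) (λ cs c → refute-sound g k h cs c (p ∘ inj₂)) cs c (p ∘ inj₁) ps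
      -- A proof of f cannot be extracted from ¬ (f → g), but to reach a contradiction it is enough
      -- to prove f → g, and there f is a hypothesis.
      refute-sound (f :→ g) k h cs c p ps = p (λ q → ⊥-elim
        (assume-sound f (refute g k) (λ cs c → refute-sound g k h cs c (λ r → p (λ _ → r))) cs c q ps))
      refute-sound :⊥ k h cs c p ps = h cs c ps

  -- Formulas are given as functions of their variables, so that the calls of `linear` can use named
  -- variables.
  N-ary : ℕ → ℕ → Set
  N-ary zero    m = Arith m
  N-ary (suc n) m = Term m → N-ary n m

  applyTo : ∀ {n m} → N-ary n m → (Fin n → Term m) → Arith m
  applyTo {zero}  f ts = f
  applyTo {suc n} f ts = applyTo (f (ts zero)) (ts ∘ suc)

  -- The implicit argument is solved by evaluating the tableau during type checking.
  linear : ∀ {n} (ρ : Vec ℤ n) (f : N-ary n n) {_ : T (refute (applyTo {n} f var) infeasible [])} → ⟦ ρ ⟧ᵃ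
      (applyTo {n} f var)
  linear {n} ρ f {t} = decidable-stable (⟦ ρ ⟧ᵃ? g) (λ p → refute-sound ρ g infeasible (infeasible-sound ρ) [] t p [])
    where g = applyTo {n} f var

open LinearArithmetic using
  (Term; con; :-_; _:+_; _:-_; Arith; _:≤_; _:<_; _:≡_; _:∧_; _:∨_; _:→_; :⊥; :¬_; N-ary; linear)

-- Definability

¬-⇔ : A ⇔ A′ → (¬ A) ⇔ (¬ A′)
¬-⇔ e = mk⇔ (_∘ from e) (_∘ to e)

×-⇔ : A ⇔ A′ → B′ ⇔ B″ → (A × B′) ⇔ (A′ × B″)
×-⇔ d e = mk⇔ (map-× (to d) (to e)) (map-× (from d) (from e))

⊎-⇔ : A ⇔ A′ → B′ ⇔ B″ → (A ⊎ B′) ⇔ (A′ ⊎ B″)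
⊎-⇔ d e = mk⇔ (map-⊎ (to d) (to e)) (map-⊎ (from d) (from e))

∃-⇔ : {P Q : A → Set} → (∀ a → P a ⇔ Q a) → (Σ[ a ∈ A ] P a) ⇔ (Σ[ a ∈ A ] Q a)
∃-⇔ e = mk⇔ (λ (a , p) → a , to (e a) p) (λ (a , q) → a , from (e a) q)

∀-⇔ : {P Q : A → Set} → (∀ a → P a ⇔ Q a) → (∀ a → P a) ⇔ (∀ a → Q a)
∀-⇔ e = mk⇔ (λ p a → to (e a) (p a)) (λ q a → from (e a) (q a))

≡-⇔ : A ≡ A′ → A ⇔ A′
≡-⇔ refl = ⇔-id _

rename : {ar : I → ℕ} → (Fin m → Fin n) → Formula ar m → Formula ar n
rename ρ (x ≈ᶠ y)    = ρ x ≈ᶠ ρ y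
rename ρ (atom i xs) = atom i (map ρ xs)
rename ρ (¬ᶠ φ)      = ¬ᶠ rename ρ φ
rename ρ (φ ∧ᶠ ψ)    = rename ρ φ ∧ᶠ rename ρ ψ
rename ρ (φ ∨ᶠ ψ)    = rename ρ φ ∨ᶠ rename ρ ψ
rename ρ (∃ᶠ φ)      = ∃ᶠ rename (Fin.lift 1 ρ) φ
rename ρ (∀ᶠ φ)      = ∀ᶠ rename (Fin.lift 1 ρ) φ

-- Replaces atom i by τ i, whose first k variables are instantiated by the
-- parameters ps; the variables of the formula are renamed by ρ.
interpret : {ar : I → ℕ} {ar′ : J → ℕ} → (∀ i → Formula ar′ (k ℕ.+ ar i)) → Vec (Fin n) k →
            (Fin m → Fin n) → Formula ar m → Formula ar′ n
interpret τ ps ρ (x ≈ᶠ y)    = ρ x ≈ᶠ ρ y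
interpret τ ps ρ (atom i xs) = rename (lookup (ps ++ map ρ xs)) (τ i)
interpret τ ps ρ (¬ᶠ φ)      = ¬ᶠ interpret τ ps ρ φ
interpret τ ps ρ (φ ∧ᶠ ψ)    = interpret τ ps ρ φ ∧ᶠ interpret τ ps ρ ψ
interpret τ ps ρ (φ ∨ᶠ ψ)    = interpret τ ps ρ φ ∨ᶠ interpret τ ps ρ ψ
interpret τ ps ρ (∃ᶠ φ)      = ∃ᶠ interpret τ (map suc ps) (Fin.lift 1 ρ) φ
interpret τ ps ρ (∀ᶠ φ)      = ∀ᶠ interpret τ (map suc ps) (Fin.lift 1 ρ) φ

Agree : Vec U m → (Fin m → Fin n) → Vec U n → Set
Agree w ρ v = ∀ i → lookup w i ≡ lookup v (ρ i)

agree-∷ : {w : Vec U m} {ρ : Fin m → Fin n} {v : Vec U n} (u : U) →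
          Agree w ρ v → Agree (u ∷ w) (Fin.lift 1 ρ) (u ∷ v)
agree-∷ u e zero    = refl
agree-∷ u e (suc i) = e i

≈-⇔ : {a b c d : U} → a ≡ c → b ≡ d → (a ≡ b) ⇔ (c ≡ d)
≈-⇔ refl refl = ⇔-id _

module _ (F : I → ∃ (Relation U)) where

  rename-⇔ : (φ : Formula (proj₁ ∘ F) m) {ρ : Fin m → Fin n} {w : Vec U m} {v : Vec U n} →
             Agree w ρ v → (F ⟦ φ ⟧ w) ⇔ (F ⟦ rename ρ φ ⟧ v)
  rename-⇔ (x ≈ᶠ y) e = ≈-⇔ (e x) (e y)
  rename-⇔ (atom i xs) {ρ} {w} {v} e =
    ≡-⇔ (cong (proj₂ (F i)) (trans (map-cong e xs) (map-∘ (lookup v) ρ xs)))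
  rename-⇔ (¬ᶠ φ)   e = ¬-⇔ (rename-⇔ φ e)
  rename-⇔ (φ ∧ᶠ ψ) e = ×-⇔ (rename-⇔ φ e) (rename-⇔ ψ e)
  rename-⇔ (φ ∨ᶠ ψ) e = ⊎-⇔ (rename-⇔ φ e) (rename-⇔ ψ e)
  rename-⇔ (∃ᶠ φ) {ρ} e = ∃-⇔ λ u → rename-⇔ φ (agree-∷ {ρ = ρ} u e)
  rename-⇔ (∀ᶠ φ) {ρ} e = ∀-⇔ λ u → rename-⇔ φ (agree-∷ {ρ = ρ} u e)

module _ (F : I → ∃ (Relation U)) (G : J → ∃ (Relation U))
         (τ : ∀ i → Formula (proj₁ ∘ G) (k ℕ.+ proj₁ (F i))) (a : Vec U k)
         (τ-⇔ : ∀ i us → proj₂ (F i) us ⇔ (G ⟦ τ i ⟧ (a ++ us))) where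

  interpret-⇔ : (φ : Formula (proj₁ ∘ F) m) {ps : Vec (Fin n) k} {ρ : Fin m → Fin n}
    {w : Vec U m} {v : Vec U n} → map (lookup v) ps ≡ a → Agree w ρ v →
    (F ⟦ φ ⟧ w) ⇔ (G ⟦ interpret τ ps ρ φ ⟧ v)
  interpret-⇔ (x ≈ᶠ y) p e = ≈-⇔ (e x) (e y)
  interpret-⇔ (atom i xs) {ps} {ρ} {w} {v} p e =
    rename-⇔ G (τ i) agree ⇔-∘ τ-⇔ i (map (lookup w) xs)
    where
    agree : Agree (a ++ map (lookup w) xs) (lookup (ps ++ map ρ xs)) v
    agree j = trans
      (cong (λ us → lookup us j) (trans
        (cong₂ _++_ (sym p) (trans (map-cong e xs) (map-∘ (lookup v) ρ xs)))
        (sym (map-++ (lookup v) ps (map ρ xs)))))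
      (lookup-map j (lookup v) (ps ++ map ρ xs))
  interpret-⇔ (¬ᶠ φ)   p e = ¬-⇔ (interpret-⇔ φ p e)
  interpret-⇔ (φ ∧ᶠ ψ) p e = ×-⇔ (interpret-⇔ φ p e) (interpret-⇔ ψ p e)
  interpret-⇔ (φ ∨ᶠ ψ) p e = ⊎-⇔ (interpret-⇔ φ p e) (interpret-⇔ ψ p e)
  interpret-⇔ (∃ᶠ φ) {ps} {ρ} {v = v} p e =
    ∃-⇔ λ u → interpret-⇔ φ (trans (sym (map-∘ (lookup (u ∷ v)) suc ps)) p) (agree-∷ {ρ = ρ} u e)
  interpret-⇔ (∀ᶠ φ) {ps} {ρ} {v = v} p e =
    ∀-⇔ λ u → interpret-⇔ φ (trans (sym (map-∘ (lookup (u ∷ v)) suc ps)) p) (agree-∷ {ρ = ρ} u e)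

module _ {ar : I → ℕ} (P Q : ∀ i → Relation U (ar i)) (σ : U → U) (σ-involutive : ∀ u → σ (σ u) ≡ u)
         (P-⇔ : ∀ i us → P i us ⇔ Q i (map σ us)) where

  private
    F G : I → ∃ (Relation U)
    F i = ar i , P i
    G i = ar i , Q i

  -- σ is an isomorphism between the structures with the relations P and Q. Being its own inverse
  -- makes it injective, for equality, and surjective, for the quantifiers.
  involution-⇔ : (φ : Formula ar n) (v : Vec U n) → (F ⟦ φ ⟧ v) ⇔ (G ⟦ φ ⟧ map σ v)
  involution-⇔ (x ≈ᶠ y) v = mk⇔
    (λ e → trans (lookup-map x σ v) (trans (cong σ e) (sym (lookup-map y σ v))))
    (λ e → trans (sym (σ-involutive _)) (trans
      (cong σ (trans (sym (lookup-map x σ v)) (trans e (lookup-map y σ v)))) (σ-involutive _)))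
  involution-⇔ (atom i xs) v =
    ≡-⇔ (cong (Q i) (trans (sym (map-∘ σ (lookup v) xs)) (map-cong (λ j → sym (lookup-map j σ v)) xs)))
    ⇔-∘ P-⇔ i (map (lookup v) xs)
  involution-⇔ (¬ᶠ φ)   v = ¬-⇔ (involution-⇔ φ v)
  involution-⇔ (φ ∧ᶠ ψ) v = ×-⇔ (involution-⇔ φ v) (involution-⇔ ψ v)
  involution-⇔ (φ ∨ᶠ ψ) v = ⊎-⇔ (involution-⇔ φ v) (involution-⇔ ψ v)
  involution-⇔ (∃ᶠ φ) v = mk⇔
    (λ (u , p) → σ u , to (involution-⇔ φ (u ∷ v)) p)
    (λ (u , p) → σ u , from (involution-⇔ φ (σ u ∷ v))
      (subst (λ z → G ⟦ φ ⟧ (z ∷ map σ v)) (sym (σ-involutive u)) p))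
  involution-⇔ (∀ᶠ φ) v = mk⇔
    (λ p u → subst (λ z → G ⟦ φ ⟧ (z ∷ map σ v)) (σ-involutive u) (to (involution-⇔ φ (σ u ∷ v)) (p (σ u))))
    (λ p u → from (involution-⇔ φ (u ∷ v)) (p (σ u)))

DefinableFrom-⊆ : {F : I → ∃ (Relation U)} {G : J → ∃ (Relation U)} →
  (∀ i → F i ∈ DefinableFrom G) → DefinableFrom F ⊆ DefinableFrom G
DefinableFrom-⊆ {F = F} {G} d (φ , R⊆ , ⊆R) = interpret τ [] id φ , to e ∘ R⊆ , ⊆R ∘ from e
  where
  τ : ∀ i → Formula (proj₁ ∘ G) (proj₁ (F i))
  τ i = proj₁ (d i)
  e : ∀ {v} → (F ⟦ φ ⟧ v) ⇔ (G ⟦ interpret τ [] id φ ⟧ v)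
  e = interpret-⇔ F G τ [] (λ i us → mk⇔ (proj₁ (proj₂ (d i))) (proj₂ (proj₂ (d i)))) φ refl (λ _ → refl)

all-variables : {R : Relation U n} {v : Vec U n} → R (map (lookup v) (allFin n)) ⇔ R v
all-variables {R = R} {v} = ≡-⇔ (cong R (map-lookup-allFin v))

DefinableFrom-generator : (F : I → ∃ (Relation U)) → ∀ i → F i ∈ DefinableFrom F
DefinableFrom-generator F i = atom i (allFin _) , from (all-variables {R = proj₂ (F i)}) , to
    (all-variables {R = proj₂ (F i)})

DefinableFrom-isDefinabilitySpace : (F : I → ∃ (Relation U)) → IsDefinabilitySpace (DefinableFrom F)
DefinableFrom-isDefinabilitySpace F G = DefinableFrom-⊆

module Closure {ℓ} {V : RelationSet U ℓ} (V-space : IsDefinabilitySpace V) where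

  private variable
    P Q R : Relation U n

  closed : (Fs : Vec (∃ (Relation U)) k) → VecAll.All V Fs → DefinableFrom (lookup Fs) ⊆ V
  closed Fs ps = V-space (lookup Fs) (VecAll.lookup⁺ ps)

  resp-≐ : P ≐ Q → (n , P) ∈ V → (n , Q) ∈ V
  resp-≐ {P = P} (P⊆Q , Q⊆P) p = closed ((_ , P) ∷ []) (p ∷ [])
    (atom zero (allFin _) , from (all-variables {R = P}) ∘ Q⊆P , P⊆Q ∘ to (all-variables {R = P}))

  ∩-closed : (n , P) ∈ V → (n , Q) ∈ V → (n , P ∩ Q) ∈ V
  ∩-closed {P = P} {Q} p q = closed ((_ , P) ∷ (_ , Q) ∷ []) (p ∷ q ∷ [])
    (atom zero (allFin _) ∧ᶠ atom (suc zero) (allFin _) , from e , to e)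
    where
    e : ∀ {v} → (P (map (lookup v) (allFin _)) × Q (map (lookup v) (allFin _))) ⇔ (P ∩ Q) v
    e = ×-⇔ (all-variables {R = P}) (all-variables {R = Q})

  ∪-closed : (n , P) ∈ V → (n , Q) ∈ V → (n , P ∪ Q) ∈ V
  ∪-closed {P = P} {Q} p q = closed ((_ , P) ∷ (_ , Q) ∷ []) (p ∷ q ∷ [])
    (atom zero (allFin _) ∨ᶠ atom (suc zero) (allFin _) , from e , to e)
    where
    e : ∀ {v} → (P (map (lookup v) (allFin _)) ⊎ Q (map (lookup v) (allFin _))) ⇔ (P ∪ Q) v
    e = ⊎-⇔ (all-variables {R = P}) (all-variables {R = Q})

  ∁-closed : (n , P) ∈ V → (n , ∁ P) ∈ V
  ∁-closed {P = P} p = closed ((_ , P) ∷ []) (p ∷ [])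
    (¬ᶠ atom zero (allFin _) , from (¬-⇔ (all-variables {R = P})) , to (¬-⇔ (all-variables {R = P})))

  ∃-closed : {P : Relation U (suc n)} → (suc n , P) ∈ V → (n , λ v → Σ[ u ∈ U ] P (u ∷ v)) ∈ V
  ∃-closed {P = P} p = closed ((_ , P) ∷ []) (p ∷ [])
    (∃ᶠ atom zero (allFin _) , from e , to e)
    where
    e : ∀ {v} → (Σ[ u ∈ U ] P (map (lookup (u ∷ v)) (allFin _))) ⇔ (Σ[ u ∈ U ] P (u ∷ v))
    e = ∃-⇔ λ u → all-variables {R = P}

  substitute : (xs : Vec (Fin n) m) → (m , P) ∈ V → (n , λ v → P (map (lookup v) xs)) ∈ V
  substitute xs p = closed (_ ∷ []) (p ∷ []) (atom zero xs , id , id)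

  everything : (n , λ _ → ⊤) ∈ V
  everything = closed [] [] (∀ᶠ (zero ≈ᶠ zero) , (λ _ _ → refl) , λ _ → tt)

-- Equivalences of tuples and back-and-forth arguments

Similarity : Set₁
Similarity = ℕ → ∀ {n} → Vec ℤ n → Vec ℤ n → Set

Invariant : (∀ {n} → Vec ℤ n → Vec ℤ n → Set) → Relation ℤ n → Set
Invariant E R = ∀ x y → E x y → R x → R y

-- In `forth` a quantifier costs the step from 2N + 1 to N: a gap longer than 2N + 1 has room for a
-- point at distance more than N from both of its ends.
record BackAndForth (F : I → ∃ (Relation ℤ)) (E : Similarity) : Set where
  field
    symmetric : ∀ {x y : Vec ℤ n} → E N x y → E N y x
    antitone  : ∀ {x y : Vec ℤ n} → M ℕ.≤ N → E N x y → E M x y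
    equality  : ∀ {x y : Vec ℤ n} i j → E N x y → lookup x i ≡ lookup x j → lookup y i ≡ lookup y j
    atomic    : ∀ {x y : Vec ℤ n} i js → E N x y → proj₂ (F i) (map (lookup x) js) → proj₂ (F i) (map (lookup y) js)
    forth     : ∀ {x y : Vec ℤ n} → E (suc (N ℕ.+ N)) x y → ∀ u → ∃ λ v → E N (u ∷ x) (v ∷ y)

  formula-invariant : (φ : Formula (proj₁ ∘ F) n) → ∃ λ N → Invariant (E N) (F ⟦ φ ⟧_)
  formula-invariant (i ≈ᶠ j)    = 0 , λ x y → equality i j
  formula-invariant (atom i js) = 0 , λ x y → atomic i js
  formula-invariant (¬ᶠ φ) =
    let N , h = formula-invariant φ in N , λ x y e ¬p p → ¬p (h y x (symmetric e) p)
  formula-invariant (φ ∧ᶠ ψ) =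
    let M , h = formula-invariant φ ; N , k = formula-invariant ψ in
    M ℕ.⊔ N , λ x y e (p , q) → h x y (antitone (ℕ.m≤m⊔n M N) e) p , k x y (antitone (ℕ.m≤n⊔m M N) e) q
  formula-invariant (φ ∨ᶠ ψ) =
    let M , h = formula-invariant φ ; N , k = formula-invariant ψ in
    M ℕ.⊔ N , λ x y e →
      [ inj₁ ∘ h x y (antitone (ℕ.m≤m⊔n M N) e) , inj₂ ∘ k x y (antitone (ℕ.m≤n⊔m M N) e) ]′
  formula-invariant (∃ᶠ φ) =
    let N , h = formula-invariant φ in
    suc (N ℕ.+ N) , λ x y e (u , p) → let v , e′ = forth e u in v , h (u ∷ x) (v ∷ y) e′ p
  formula-invariant (∀ᶠ φ) =
    let N , h = formula-invariant φ in
    suc (N ℕ.+ N) , λ x y e p v → let u , e′ = forth (symmetric e) v in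
      h (u ∷ x) (v ∷ y) (symmetric e′) (p u)

  definable-invariant : {R : Relation ℤ n} → DefinableFrom F (n , R) → ∃ λ N → Invariant (E N) R
  definable-invariant (φ , R⊆ , ⊆R) =
    let N , h = formula-invariant φ in N , λ x y e r → ⊆R (h x y e (R⊆ r))

greatest : {P : Fin n → Set} → Decidable P → (f : Fin n → ℤ) →
           (∀ i → ¬ P i) ⊎ (∃ λ i → P i × ∀ j → P j → f j ≤ f i)
greatest {zero}  P? f = inj₁ λ ()
greatest {suc n} P? f with P? zero | greatest (P? ∘ suc) (f ∘ suc)
... | no ¬p | inj₁ none = inj₁ λ { zero → ¬p ; (suc i) → none i }
... | yes p | inj₁ none = inj₂ (zero , p , λ { zero _ → ℤ.≤-refl ; (suc j) q → ⊥-elim (none j q) })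
... | no ¬p | inj₂ (i , q , max) = inj₂ (suc i , q , λ { zero p → ⊥-elim (¬p p) ; (suc j) → max j })
... | yes p | inj₂ (i , q , max) with f zero ℤ.≤? f (suc i)
...   | yes ≤ = inj₂ (suc i , q , λ { zero _ → ≤ ; (suc j) → max j })
...   | no  ≰ = inj₂ (zero , p , λ { zero _ → ℤ.≤-refl ; (suc j) r → ℤ.≤-trans (max j r) (ℤ.<⇒≤ (ℤ.≰⇒> ≰)) })

least : {P : Fin n → Set} → Decidable P → (f : Fin n → ℤ) →
        (∀ i → ¬ P i) ⊎ (∃ λ i → P i × ∀ j → P j → f i ≤ f j)
least P? f with greatest P? (-_ ∘ f)
... | inj₁ none = inj₁ none
... | inj₂ (i , p , max) = inj₂ (i , p , λ j q → ℤ.neg-cancel-≤ (max j q))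

0≤+ : ∀ n → 0ℤ ≤ + n
0≤+ n = +≤+ z≤n

Bound : ℕ → Vec ℤ n → Set
Bound M x = ∀ i → - + M ≤ lookup x i × lookup x i ≤ + M

bounded : (x : Vec ℤ n) → ∃ λ M → Bound M x
bounded []           = 0 , λ ()
bounded (u ∷ x) with bounded x
bounded (+ k ∷ x)    | M , b = M ℕ.+ k , λ
  { zero    → linear (+ M ∷ + k ∷ []) (λ M k → con 0ℤ :≤ M :→ con 0ℤ :≤ k :→ :- (M :+ k) :≤ k :∧ k :≤ M :+ k) (0≤+ M)
      (0≤+ k)
  ; (suc i) → linear (+ M ∷ + k ∷ lookup x i ∷ []) (λ M k z → con 0ℤ :≤ k :→ :- M :≤ z :∧ z :≤ M :→ :- (M :+ k)
      :≤ z :∧ z :≤ M :+ k) (0≤+ k) (b i) }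
bounded (-[1+ k ] ∷ x) | M , b = M ℕ.+ suc k , λ
  { zero    → linear (+ M ∷ + suc k ∷ []) (λ M k → con 0ℤ :≤ M :→ con 0ℤ :≤ k :→ :- (M :+ k)
      :≤ :- k :∧ :- k :≤ M :+ k) (0≤+ M) (0≤+ (suc k))
  ; (suc i) → linear (+ M ∷ + suc k ∷ lookup x i ∷ []) (λ M k z → con 0ℤ :≤ k :→ :- M :≤ z :∧ z :≤ M :→ :- (M :+ k)
      :≤ z :∧ z :≤ M :+ k) (0≤+ (suc k)) (b i) }

-- Equality after truncation to the interval from -(N + 1) to N + 1.
Same : ℕ → ℤ → ℤ → Set
Same N a b = (a ≡ b) ⊎ (+ N < a × + N < b) ⊎ (a < - + N × b < - + N)

-- The points of colour true are far above the others in x, and far below them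
-- in y: a rotation of the line takes x to y.
Align : ℕ → Bool → Bool → (x x′ y y′ : ℤ) → Set
Align N false false x x′ y y′ = Same N (x - x′) (y - y′)
Align N true  true  x x′ y y′ = Same N (x - x′) (y - y′)
Align N false true  x x′ y y′ = + N < x′ - x × + N < y - y′
Align N true  false x x′ y y′ = + N < x - x′ × + N < y′ - y

Aligned : ℕ → Vec Bool n → Vec ℤ n → Vec ℤ n → Set
Aligned N c x y = ∀ i j → Align N (lookup c i) (lookup c j) (lookup x i) (lookup x j) (lookup y i) (lookup y j)

Cyclic : Similarity
Cyclic N {n} x y = ∃ λ (c : Vec Bool n) → Aligned N c x y

Ordered : Similarity
Ordered N x y = ∀ i j → Same N (lookup x i - lookup x j) (lookup y i - lookup y j)

Far : ℕ → ℤ → Set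
Far N a = + N < a ⊎ a < - + N

Near : ℕ → ℤ → Set
Near N a = - + N ≤ a × a ≤ + N

-- The side on which a distant point lies is forgotten, as the successor cannot see it.
Local : Similarity
Local N x y = ∀ i j →
  (lookup x i - lookup x j ≡ lookup y i - lookup y j) ⊎
  (Far N (lookup x i - lookup x j) × Far N (lookup y i - lookup y j))

near? : ∀ N a → Dec (Near N a)
near? N a = - + N ℤ.≤? a ×-dec a ℤ.≤? + N

-- Names with a leading colon are syntax for the relations of the same name. Their meaning unfolds
-- to these relations, so that `linear` proves statements about the latter.
:Same : Term n → Term n → Term n → Arith n
:Same N a b = a :≡ b :∨ (N :< a :∧ N :< b) :∨ (a :< :- N :∧ b :< :- N)

:Far :Near : Term n → Term n → Arith n
:Far  N a = N :< a :∨ a :< :- N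
:Near N a = :- N :≤ a :∧ a :≤ N

:Align : Bool → Bool → (N x x′ y y′ : Term n) → Arith n
:Align false false N x x′ y y′ = :Same N (x :- x′) (y :- y′)
:Align true  true  N x x′ y y′ = :Same N (x :- x′) (y :- y′)
:Align false true  N x x′ y y′ = N :< x′ :- x :∧ N :< y :- y′
:Align true  false N x x′ y y′ = N :< x :- x′ :∧ N :< y′ :- y

align-refl : ∀ N b x y → Align N b b x x y y
align-refl N false x y = inj₁ (trans (ℤ.+-inverseʳ x) (sym (ℤ.+-inverseʳ y)))
align-refl N true  x y = inj₁ (trans (ℤ.+-inverseʳ x) (sym (ℤ.+-inverseʳ y)))

align-swap : ∀ N b b′ x x′ y y′ → Align N b b′ x x′ y y′ → Align N b′ b x′ x y′ y
align-swap N false false x x′ y y′ = linear (+ N ∷ x ∷ x′ ∷ y ∷ y′ ∷ []) λ N x x′ y y′ → :Same N (x :- x′) (y :- y′)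
    :→ :Same N (x′ :- x) (y′ :- y)
align-swap N true  true  x x′ y y′ = linear (+ N ∷ x ∷ x′ ∷ y ∷ y′ ∷ []) λ N x x′ y y′ → :Same N (x :- x′) (y :- y′)
    :→ :Same N (x′ :- x) (y′ :- y)
align-swap N false true  x x′ y y′ p = p
align-swap N true  false x x′ y y′ p = p


-- The three ways of placing a new point u: within N of some xᵢ, just above the
-- greatest xᵢ < u, or just below the least xᵢ > u.
module Extension (N : ℕ) (u xᵢ xⱼ yᵢ yⱼ : ℤ) where

  private
    ρ : Vec ℤ 6
    ρ = + N ∷ u ∷ xᵢ ∷ xⱼ ∷ yᵢ ∷ yⱼ ∷ []

    :2N+1 : Term 6 → Term 6
    :2N+1 N = con 1ℤ :+ (N :+ N)

  near above below : Bool → Bool → N-ary 6 6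
  near b b′ N u xᵢ xⱼ yᵢ yⱼ =
    con 0ℤ :≤ N :→ :Align b b′ (:2N+1 N) xᵢ xⱼ yᵢ yⱼ :→ :Near N (u :- xᵢ) :→
    :Align b b′ N u xⱼ (yᵢ :+ (u :- xᵢ)) yⱼ
  above b b′ N u xᵢ xⱼ yᵢ yⱼ =
    con 0ℤ :≤ N :→ :Align b b′ (:2N+1 N) xᵢ xⱼ yᵢ yⱼ :→ :¬ :Near N (u :- xᵢ) :→ :¬ :Near N (u :- xⱼ) :→
    xᵢ :< u :→ (xⱼ :< u :→ xⱼ :≤ xᵢ) :→ :Align b b′ N u xⱼ (yᵢ :+ (con 1ℤ :+ N)) yⱼ
  below b b′ N u xᵢ xⱼ yᵢ yⱼ =
    con 0ℤ :≤ N :→ :Align b b′ (:2N+1 N) xᵢ xⱼ yᵢ yⱼ :→ :¬ :Near N (u :- xᵢ) :→ :¬ :Near N (u :- xⱼ) :→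
    :¬ (xⱼ :< u) :→ xᵢ :≤ xⱼ :→ :Align b b′ N u xⱼ (yᵢ :- (con 1ℤ :+ N)) yⱼ

  align-near : ∀ b b′ → Align (suc (N ℕ.+ N)) b b′ xᵢ xⱼ yᵢ yⱼ → Near N (u - xᵢ) → Align N b b′ u xⱼ (yᵢ + (u - xᵢ))
      yⱼ
  align-near false false = linear ρ (near false false) (0≤+ N)
  align-near false true  = linear ρ (near false true) (0≤+ N)
  align-near true  false = linear ρ (near true false) (0≤+ N)
  align-near true  true  = linear ρ (near true true) (0≤+ N)

  align-above : ∀ b b′ → Align (suc (N ℕ.+ N)) b b′ xᵢ xⱼ yᵢ yⱼ → ¬ Near N (u - xᵢ) → ¬ Near N (u - xⱼ) →
    xᵢ < u → (xⱼ < u → xⱼ ≤ xᵢ) → Align N b b′ u xⱼ (yᵢ + (1ℤ + + N)) yⱼ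
  align-above false false = linear ρ (above false false) (0≤+ N)
  align-above false true  = linear ρ (above false true) (0≤+ N)
  align-above true  false = linear ρ (above true false) (0≤+ N)
  align-above true  true  = linear ρ (above true true) (0≤+ N)

  align-below : ∀ b b′ → Align (suc (N ℕ.+ N)) b b′ xᵢ xⱼ yᵢ yⱼ → ¬ Near N (u - xᵢ) → ¬ Near N (u - xⱼ) →
    ¬ (xⱼ < u) → xᵢ ≤ xⱼ → Align N b b′ u xⱼ (yᵢ - (1ℤ + + N)) yⱼ
  align-below false false = linear ρ (below false false) (0≤+ N)
  align-below false true  = linear ρ (below false true) (0≤+ N)
  align-below true  false = linear ρ (below true false) (0≤+ N)
  align-below true  true  = linear ρ (below true true) (0≤+ N)

align-antitone : ∀ {M N} b b′ x x′ y y′ → M ℕ.≤ N → Align N b b′ x x′ y y′ → Align M b b′ x x′ y y′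
align-antitone {M} {N} b b′ x x′ y y′ M≤N = go b b′ (+≤+ M≤N)
  where
  ρ : Vec ℤ 6
  ρ = + M ∷ + N ∷ x ∷ x′ ∷ y ∷ y′ ∷ []

  f : Bool → Bool → N-ary 6 6
  f b b′ M N x x′ y y′ = M :≤ N :→ :Align b b′ N x x′ y y′ :→ :Align b b′ M x x′ y y′

  go : ∀ b b′ → + M ≤ + N → Align N b b′ x x′ y y′ → Align M b b′ x x′ y y′
  go false false = linear ρ (f false false)
  go false true  = linear ρ (f false true)
  go true  false = linear ρ (f true false)
  go true  true  = linear ρ (f true true)

aligned-∷ : ∀ (c : Vec Bool n) x y b u v → Aligned (suc (N ℕ.+ N)) c x y →
  (∀ j → Align N b (lookup c j) u (lookup x j) v (lookup y j)) → Aligned N (b ∷ c) (u ∷ x) (v ∷ y)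
aligned-∷ c x y b u v e h zero zero = align-refl _ b u v
aligned-∷ c x y b u v e h zero    (suc j) = h j
aligned-∷ {N = N} c x y b u v e h (suc i) zero =
  align-swap N b (lookup c i) u (lookup x i) v (lookup y i) (h i)
aligned-∷ {N = N} c x y b u v e h (suc i) (suc j) =
  align-antitone (lookup c i) (lookup c j) _ _ _ _ (ℕ.m≤n⇒m≤1+n (ℕ.m≤m+n N N)) (e i j)

-- The new point takes the colour of the point next to which it is placed. The last component lets
-- this construction serve `Ordered` too, which is the case of the colouring that is constantly
-- false.
aligned-forth : ∀ (c : Vec Bool n) x y → Aligned (suc (N ℕ.+ N)) c x y → ∀ u →
  ∃ λ v → ∃ λ b → Aligned N (b ∷ c) (u ∷ x) (v ∷ y) × ((∀ i → lookup c i ≡ false) → b ≡ false)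
aligned-forth {N = N} c x y e u with any? (λ i → near? N (u - lookup x i))
... | yes (i , u≈xᵢ) = _ , lookup c i , aligned-∷ c x y _ u _ e
  (λ j → Extension.align-near N u (lookup x i) (lookup x j) (lookup y i) (lookup y j) (lookup c i) (lookup c j)
      (e i j) u≈xᵢ) ,
  (λ h → h i)
... | no u≉x with greatest (λ i → lookup x i ℤ.<? u) (lookup x)
...   | inj₂ (i , xᵢ<u , max) = _ , lookup c i , aligned-∷ c x y _ u _ e
  (λ j → Extension.align-above N u (lookup x i) (lookup x j) (lookup y i) (lookup y j) (lookup c i) (lookup c j)
    (e i j) (λ p → u≉x (i , p)) (λ p → u≉x (j , p)) xᵢ<u (max j)) ,
  (λ h → h i)
...   | inj₁ none with least (λ i → yes tt) (lookup x)
...     | inj₂ (i , _ , min) = _ , lookup c i , aligned-∷ c x y _ u _ e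
  (λ j → Extension.align-below N u (lookup x i) (lookup x j) (lookup y i) (lookup y j) (lookup c i) (lookup c j)
    (e i j) (λ p → u≉x (i , p)) (λ p → u≉x (j , p)) (none j) (min j tt)) ,
  (λ h → h i)
...     | inj₁ empty = u , false , aligned-∷ c x y _ u _ e (λ j → ⊥-elim (empty j tt)) , λ _ → refl

ordered⇒aligned : ∀ (x y : Vec ℤ n) → Ordered N x y → Aligned N (replicate n false) x y
ordered⇒aligned x y e i j rewrite lookup-replicate i false | lookup-replicate j false = e i j

aligned⇒ordered : ∀ (c : Vec Bool n) x y → (∀ i → lookup c i ≡ false) → Aligned N c x y → Ordered N x y
aligned⇒ordered c x y c≡false e i j with lookup c i | lookup c j | c≡false i | c≡false j | e i j
... | _ | _ | refl | refl | eᵢⱼ = eᵢⱼ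

:cycle : Term n → Term n → Term n → Arith n
:cycle a b c = (a :< b :∧ b :< c) :∨ (b :< c :∧ c :< a) :∨ (c :< a :∧ a :< b)

align-equality : ∀ N b b′ x x′ y y′ → Align N b b′ x x′ y y′ → x ≡ x′ → y ≡ y′
align-equality N b b′ x x′ y y′ = go b b′
  where
  ρ : Vec ℤ 5
  ρ = + N ∷ x ∷ x′ ∷ y ∷ y′ ∷ []

  f : Bool → Bool → N-ary 5 5
  f b b′ N x x′ y y′ = con 0ℤ :≤ N :→ :Align b b′ N x x′ y y′ :→ x :≡ x′ :→ y :≡ y′

  go : ∀ b b′ → Align N b b′ x x′ y y′ → x ≡ x′ → y ≡ y′
  go false false = linear ρ (f false false) (0≤+ N)
  go false true  = linear ρ (f false true) (0≤+ N)
  go true  false = linear ρ (f true false) (0≤+ N)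
  go true  true  = linear ρ (f true true) (0≤+ N)

align-cycle : ∀ N b₁ b₂ b₃ x₁ x₂ x₃ y₁ y₂ y₃ →
  Align N b₁ b₂ x₁ x₂ y₁ y₂ → Align N b₂ b₃ x₂ x₃ y₂ y₃ → Align N b₃ b₁ x₃ x₁ y₃ y₁ →
  cycle (x₁ ∷ x₂ ∷ x₃ ∷ []) → cycle (y₁ ∷ y₂ ∷ y₃ ∷ [])
align-cycle N b₁ b₂ b₃ x₁ x₂ x₃ y₁ y₂ y₃ = go b₁ b₂ b₃
  where
  ρ : Vec ℤ 7
  ρ = + N ∷ x₁ ∷ x₂ ∷ x₃ ∷ y₁ ∷ y₂ ∷ y₃ ∷ []

  f : Bool → Bool → Bool → N-ary 7 7
  f b₁ b₂ b₃ N x₁ x₂ x₃ y₁ y₂ y₃ = con 0ℤ :≤ N :→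
    :Align b₁ b₂ N x₁ x₂ y₁ y₂ :→ :Align b₂ b₃ N x₂ x₃ y₂ y₃ :→ :Align b₃ b₁ N x₃ x₁ y₃ y₁ :→
    :cycle x₁ x₂ x₃ :→ :cycle y₁ y₂ y₃

  go : ∀ b₁ b₂ b₃ →
    Align N b₁ b₂ x₁ x₂ y₁ y₂ → Align N b₂ b₃ x₂ x₃ y₂ y₃ → Align N b₃ b₁ x₃ x₁ y₃ y₁ →
    cycle (x₁ ∷ x₂ ∷ x₃ ∷ []) → cycle (y₁ ∷ y₂ ∷ y₃ ∷ [])
  go false false false = linear ρ (f false false false) (0≤+ N)
  go false false true  = linear ρ (f false false true) (0≤+ N)
  go false true  false = linear ρ (f false true false) (0≤+ N)
  go false true  true  = linear ρ (f false true true) (0≤+ N)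
  go true  false false = linear ρ (f true false false) (0≤+ N)
  go true  false true  = linear ρ (f true false true) (0≤+ N)
  go true  true  false = linear ρ (f true true false) (0≤+ N)
  go true  true  true  = linear ρ (f true true true) (0≤+ N)

-- The inverse rotation moves the other part of the line from above to below, hence the negated
-- colours.
align-sym : ∀ N b b′ x x′ y y′ → Align N b b′ x x′ y y′ → Align N (not b) (not b′) y y′ x x′
align-sym N false true  x x′ y y′ (p , q) = q , p
align-sym N true  false x x′ y y′ (p , q) = q , p
align-sym N false false x x′ y y′ = linear (+ N ∷ x ∷ x′ ∷ y ∷ y′ ∷ []) λ N x x′ y y′ → :Same N (x :- x′) (y :- y′)
    :→ :Same N (y :- y′) (x :- x′)
align-sym N true  true  x x′ y y′ = linear (+ N ∷ x ∷ x′ ∷ y ∷ y′ ∷ []) λ N x x′ y y′ → :Same N (x :- x′) (y :- y′)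
    :→ :Same N (y :- y′) (x :- x′)

aligned-sym : ∀ (c : Vec Bool n) x y → Aligned N c x y → Aligned N (map not c) y x
aligned-sym {N = N} c x y e i j rewrite lookup-map i not c | lookup-map j not c =
  align-sym N (lookup c i) (lookup c j) (lookup x i) (lookup x j) (lookup y i) (lookup y j) (e i j)

order-game : BackAndForth (λ (_ : ⊤) → relation Ord) Ordered
order-game = record
  -- For two points of the same colour `Align` unfolds to `Same`, so the lemmas on rotations apply
  -- to `Ordered`.
  { symmetric = λ {N = N} {x} {y} e i j →
      align-sym N true true (lookup x i) (lookup x j) (lookup y i) (lookup y j) (e i j)
  ; antitone = λ {x = x} {y} M≤N e i j →
      align-antitone true true (lookup x i) (lookup x j) (lookup y i) (lookup y j) M≤N (e i j)
  ; equality = λ {N = N} {x} {y} i j e →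
      align-equality N true true (lookup x i) (lookup x j) (lookup y i) (lookup y j) (e i j)
  ; atomic = λ { {N = N} {x} {y} _ (i ∷ j ∷ []) e →
      linear (+ N ∷ lookup x i ∷ lookup x j ∷ lookup y i ∷ lookup y j ∷ [])
        (λ N x x′ y y′ → con 0ℤ :≤ N :→ :Same N (x :- x′) (y :- y′) :→ x :< x′ :→ y :< y′) (0≤+ N) (e i j) }
  ; forth = ordered-forth
  }
  where
  ordered-forth : ∀ {x y : Vec ℤ n} → Ordered (suc (N ℕ.+ N)) x y → ∀ u → ∃ λ v → Ordered N (u ∷ x) (v ∷ y)
  ordered-forth {n} {x = x} {y} e u with aligned-forth (replicate n false) x y (ordered⇒aligned x y e) u
  ... | v , b , e′ , h = v , aligned⇒ordered (b ∷ replicate n false) (u ∷ x) (v ∷ y) uncoloured e′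
    where
    uncoloured : ∀ i → lookup (b ∷ replicate n false) i ≡ false
    uncoloured zero    = h λ i → lookup-replicate i false
    uncoloured (suc i) = lookup-replicate i false

cycle-game : BackAndForth (λ (_ : ⊤) → relation C) Cyclic
cycle-game = record
  { symmetric = λ {x = x} {y} (c , e) → map not c , aligned-sym c x y e
  ; antitone = λ {x = x} {y} M≤N (c , e) → c , λ i j →
      align-antitone (lookup c i) (lookup c j) (lookup x i) (lookup x j) (lookup y i) (lookup y j) M≤N (e i j)
  ; equality = λ {N = N} {x} {y} i j (c , e) →
      align-equality N (lookup c i) (lookup c j) (lookup x i) (lookup x j) (lookup y i) (lookup y j) (e i j)
  ; atomic = λ { {N = N} {x} {y} _ (i ∷ j ∷ k ∷ []) (c , e) →
      align-cycle N (lookup c i) (lookup c j) (lookup c k) (lookup x i) (lookup x j) (lookup x k)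
        (lookup y i) (lookup y j) (lookup y k) (e i j) (e j k) (e k i) }
  ; forth = λ {x = x} {y} (c , e) u → let v , b , e′ , _ = aligned-forth c x y e u in v , b ∷ c , e′
  }

LocalPair : ℕ → (x x′ y y′ : ℤ) → Set
LocalPair N x x′ y y′ = (x - x′ ≡ y - y′) ⊎ (Far N (x - x′) × Far N (y - y′))

:Local : (N x x′ y y′ : Term n) → Arith n
:Local N x x′ y y′ = x :- x′ :≡ y :- y′ :∨ (:Far N (x :- x′) :∧ :Far N (y :- y′))

local-antitone : ∀ {M N} x x′ y y′ → M ℕ.≤ N → LocalPair N x x′ y y′ → LocalPair M x x′ y y′
local-antitone {M} {N} x x′ y y′ M≤N = linear (+ M ∷ + N ∷ x ∷ x′ ∷ y ∷ y′ ∷ [])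
  (λ M N x x′ y y′ → M :≤ N :→ :Local N x x′ y y′ :→ :Local M x x′ y y′) (+≤+ M≤N)

local-∷ : ∀ (x y : Vec ℤ n) u v → Local (N ℕ.+ N) x y →
  (∀ j → LocalPair N u (lookup x j) v (lookup y j)) → Local N (u ∷ x) (v ∷ y)
local-∷ x y u v e h zero    zero    = inj₁ (trans (ℤ.+-inverseʳ u) (sym (ℤ.+-inverseʳ v)))
local-∷ x y u v e h zero    (suc j) = h j
local-∷ {N = N} x y u v e h (suc i) zero = linear (+ N ∷ u ∷ lookup x i ∷ v ∷ lookup y i ∷ [])
  (λ N u x v y → :Local N u x v y :→ :Local N x u y v) (h i)
local-∷ {N = N} x y u v e h (suc i) (suc j) =
  local-antitone (lookup x i) (lookup x j) (lookup y i) (lookup y j) (ℕ.m≤m+n N N) (e i j)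

-- As `Local` ignores sides, a point that is near no other can be sent beyond all of y. No gap has
-- to be filled, and 2N is enough instead of 2N + 1.
local-forth : ∀ N (x y : Vec ℤ n) → Local (N ℕ.+ N) x y → ∀ u → ∃ λ v → Local N (u ∷ x) (v ∷ y)
local-forth N x y e u with any? (λ i → near? N (u - lookup x i))
... | yes (i , u≈xᵢ) = lookup y i + (u - lookup x i) , local-∷ x y u _ e λ j →
  linear (+ N ∷ u ∷ lookup x i ∷ lookup x j ∷ lookup y i ∷ lookup y j ∷ [])
    (λ N u xᵢ xⱼ yᵢ yⱼ → con 0ℤ :≤ N :→ :Local (N :+ N) xᵢ xⱼ yᵢ yⱼ :→ :Near N (u :- xᵢ) :→
      :Local N u xⱼ (yᵢ :+ (u :- xᵢ)) yⱼ) (0≤+ N) (e i j) u≈xᵢ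
... | no u≉x = let M , b = bounded y in + M + (1ℤ + + N) , local-∷ x y u _ e λ j →
  linear (+ N ∷ + M ∷ u ∷ lookup x j ∷ lookup y j ∷ [])
    (λ N M u xⱼ yⱼ → :- M :≤ yⱼ :∧ yⱼ :≤ M :→ :¬ :Near N (u :- xⱼ) :→
      :Local N u xⱼ (M :+ (con 1ℤ :+ N)) yⱼ) (b j) (λ p → u≉x (j , p))

-- The bound suc N ≥ 1 makes the relation preserve the successor even at N = 0.
successor-game : BackAndForth (λ (_ : ⊤) → relation +1) (λ N {n} → Local (suc N) {n})
successor-game = record
  { symmetric = λ {N = N} {x} {y} e i j → linear (+ suc N ∷ lookup x i ∷ lookup x j ∷ lookup y i ∷ lookup y j ∷ [])
      (λ N x x′ y y′ → :Local N x x′ y y′ :→ :Local N y y′ x x′) (e i j)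
  ; antitone = λ {x = x} {y} M≤N e i j →
      local-antitone (lookup x i) (lookup x j) (lookup y i) (lookup y j) (ℕ.s≤s M≤N) (e i j)
  ; equality = λ {N = N} {x} {y} i j e → linear (+ N ∷ lookup x i ∷ lookup x j ∷ lookup y i ∷ lookup y j ∷ [])
      (λ N x x′ y y′ → con 0ℤ :≤ N :→ :Local (con 1ℤ :+ N) x x′ y y′ :→ x :≡ x′ :→ y :≡ y′) (0≤+ N) (e i j)
  ; atomic = λ { {N = N} {x} {y} _ (i ∷ j ∷ []) e → linear (+ N ∷ lookup x i ∷ lookup x j ∷ lookup y i ∷ lookup y j ∷ [])
      (λ N x x′ y y′ → con 0ℤ :≤ N :→ :Local (con 1ℤ :+ N) x x′ y y′ :→ x′ :≡ x :+ con 1ℤ :→ y′ :≡ y :+ con 1ℤ)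
          (0≤+ N) (e i j) }
  ; forth = λ {N = N} {x} {y} e u →
      -- Level N has the bound N + 1, and level 2N + 1 has the bound 2 (N + 1), just what
      -- `local-forth` asks for.
      local-forth (suc N) x y (subst (λ k → Local (suc k) x y) (sym (ℕ.+-suc N N)) e) u
  }

-- Definitions of the six relations from one another

:between : Term n → Term n → Term n → Arith n
:between a b c = (a :< b :∧ b :< c) :∨ (b :< a :∧ c :< b)

:separation : Term n → Term n → Term n → Term n → Arith n
:separation a b c d = (:between a b c :∨ :between a d c) :∧ (:between b a d :∨ :between b c d)

:successor : Term n → Term n → Arith n
:successor x y = y :≡ x :+ con 1ℤ

:codirected : Term n → Term n → Term n → Term n → Arith n
:codirected x y z t = (:successor x y :∧ :successor z t) :∨ (:successor y x :∧ :successor t z)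

-- A form of `codirection₁` without the absolute value, within reach of `linear`.
Codirected : (x y z t : ℤ) → Set
Codirected x y z t = (y ≡ x + 1ℤ × t ≡ z + 1ℤ) ⊎ (x ≡ y + 1ℤ × z ≡ t + 1ℤ)

∣a∣≡1⇒a≡±1 : ∀ a → ∣ a ∣ ≡ 1 → a ≡ 1ℤ ⊎ a ≡ -1ℤ
∣a∣≡1⇒a≡±1 (+ 1)      refl = inj₁ refl
∣a∣≡1⇒a≡±1 (-[1+ 0 ]) refl = inj₂ refl

codirection₁-⇔ : ∀ x y z t → codirection₁ (x ∷ y ∷ z ∷ t ∷ []) ⇔ Codirected x y z t
codirection₁-⇔ x y z t = mk⇔
  (λ (e , a) → linear ρ (λ x y z t → x :- y :≡ z :- t :→ x :- y :≡ con 1ℤ :∨ x :- y :≡ con -1ℤ :→ :codirected x y z t)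
    e (∣a∣≡1⇒a≡±1 (x - y) a))
  (λ p → linear ρ (λ x y z t → :codirected x y z t :→ x :- y :≡ z :- t) p ,
    [ cong ∣_∣ , cong ∣_∣ ]′ (linear ρ (λ x y z t → :codirected x y z t :→ x :- y :≡ con 1ℤ :∨ x :- y :≡ con -1ℤ) p))
  where
  ρ : Vec ℤ 4
  ρ = x ∷ y ∷ z ∷ t ∷ []

codirection₁∈⟨+1⟩ : relation A₁₁ ∈ space +1
codirection₁∈⟨+1⟩ =
  (atom tt (0F ∷ 1F ∷ []) ∧ᶠ atom tt (2F ∷ 3F ∷ [])) ∨ᶠ (atom tt (1F ∷ 0F ∷ []) ∧ᶠ atom tt (3F ∷ 2F ∷ [])) ,
  (λ { {x ∷ y ∷ z ∷ t ∷ []} → to (codirection₁-⇔ x y z t) }) ,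
  (λ { {x ∷ y ∷ z ∷ t ∷ []} → from (codirection₁-⇔ x y z t) })

between∈⟨<⟩ : relation B ∈ space Ord
between∈⟨<⟩ =
  (atom tt (0F ∷ 1F ∷ []) ∧ᶠ atom tt (1F ∷ 2F ∷ [])) ∨ᶠ (atom tt (1F ∷ 0F ∷ []) ∧ᶠ atom tt (2F ∷ 1F ∷ [])) ,
  (λ { {_ ∷ _ ∷ _ ∷ []} → id }) , (λ { {_ ∷ _ ∷ _ ∷ []} → id })

cycle∈⟨<⟩ : relation C ∈ space Ord
cycle∈⟨<⟩ =
  (atom tt (0F ∷ 1F ∷ []) ∧ᶠ atom tt (1F ∷ 2F ∷ [])) ∨ᶠ
    ((atom tt (1F ∷ 2F ∷ []) ∧ᶠ atom tt (2F ∷ 0F ∷ [])) ∨ᶠ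
     (atom tt (2F ∷ 0F ∷ []) ∧ᶠ atom tt (0F ∷ 1F ∷ []))) ,
  (λ { {_ ∷ _ ∷ _ ∷ []} → id }) , (λ { {_ ∷ _ ∷ _ ∷ []} → id })

separation∈⟨between⟩ : relation S ∈ space B
separation∈⟨between⟩ =
  (atom tt (0F ∷ 1F ∷ 2F ∷ []) ∨ᶠ atom tt (0F ∷ 3F ∷ 2F ∷ [])) ∧ᶠ
    (atom tt (1F ∷ 0F ∷ 3F ∷ []) ∨ᶠ atom tt (1F ∷ 2F ∷ 3F ∷ [])) ,
  (λ { {_ ∷ _ ∷ _ ∷ _ ∷ []} → id }) , (λ { {_ ∷ _ ∷ _ ∷ _ ∷ []} → id })

-- On the line closed up at infinity, a and c bound two arcs, and b and d must lie on different
-- ones.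
separation∈⟨cycle⟩ : relation S ∈ space C
separation∈⟨cycle⟩ =
  (atom tt (0F ∷ 1F ∷ 2F ∷ []) ∧ᶠ atom tt (2F ∷ 3F ∷ 0F ∷ [])) ∨ᶠ
    (atom tt (0F ∷ 3F ∷ 2F ∷ []) ∧ᶠ atom tt (2F ∷ 1F ∷ 0F ∷ [])) ,
  (λ { {a ∷ b ∷ c ∷ d ∷ []} → linear (a ∷ b ∷ c ∷ d ∷ []) λ a b c d → :separation a b c d :→ :arcs a b c d }) ,
  (λ { {a ∷ b ∷ c ∷ d ∷ []} → linear (a ∷ b ∷ c ∷ d ∷ []) λ a b c d → :arcs a b c d :→ :separation a b c d })
  where
  :arcs : (a b c d : Term n) → Arith n
  :arcs a b c d = (:cycle a b c :∧ :cycle c d a) :∨ (:cycle a d c :∧ :cycle c b a)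

-- The arc that goes up from x, through infinity if y < x, and ends at y contains x + 1 unless y = x
-- + 1.
successor∈⟨cycle⟩ : relation +1 ∈ space C
successor∈⟨cycle⟩ =
  (¬ᶠ (0F ≈ᶠ 1F)) ∧ᶠ (¬ᶠ (∃ᶠ atom tt (1F ∷ 0F ∷ 2F ∷ []))) ,
  (λ { {x ∷ y ∷ []} e →
    linear (x ∷ y ∷ []) (λ x y → :successor x y :→ :¬ x :≡ y) e ,
    λ (z , c) → linear (x ∷ y ∷ z ∷ []) (λ x y z → :successor x y :→ :cycle x z y :→ :⊥) e c }) ,
  (λ { {x ∷ y ∷ []} (x≢y , h) → linear (x ∷ y ∷ []) (λ x y → :¬ x :≡ y :→
    :¬ :cycle x (x :+ con 1ℤ) y :→ :successor x y) x≢y (λ c → h (x + 1ℤ , c)) })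

-- Distinct points are adjacent when no two points separate them, that is, one of the two arcs is
-- empty. Disjoint adjacent pairs x, y and z, t have the same direction when x, y, z, t follow each
-- other around the circle in this order or its reverse, that is, when x and z separate y and t.
-- Overlapping pairs need their own clauses, as S only holds of four distinct points.
codirection₁∈⟨separation⟩ : relation A₁₁ ∈ space S
codirection₁∈⟨separation⟩ =
  :adjacent 0F 1F ∧ᶠ (:adjacent 2F 3F ∧ᶠ
    (((0F ≈ᶠ 2F) ∧ᶠ (1F ≈ᶠ 3F)) ∨ᶠ (((1F ≈ᶠ 2F) ∧ᶠ (¬ᶠ (0F ≈ᶠ 3F))) ∨ᶠ
    (((0F ≈ᶠ 3F) ∧ᶠ (¬ᶠ (1F ≈ᶠ 2F))) ∨ᶠ atom tt (0F ∷ 1F ∷ 2F ∷ 3F ∷ []))))) ,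
  (λ { {x ∷ y ∷ z ∷ t ∷ []} p → let q = to (codirection₁-⇔ x y z t) p in
    adjacent x y (linear (x ∷ y ∷ z ∷ t ∷ []) (λ x y z t → :codirected x y z t :→ :neighbours x y) q) ,
    adjacent z t (linear (x ∷ y ∷ z ∷ t ∷ []) (λ x y z t → :codirected x y z t :→ :neighbours z t) q) ,
    linear (x ∷ y ∷ z ∷ t ∷ []) (λ x y z t → :codirected x y z t :→ :matrix x y z t) q }) ,
  (λ { {x ∷ y ∷ z ∷ t ∷ []} (p , q , r) → from (codirection₁-⇔ x y z t)
    (linear (x ∷ y ∷ z ∷ t ∷ []) (λ x y z t → :neighbours x y :→ :neighbours z t :→ :matrix x y z t :→
        :codirected x y z t)
      (neighbours x y p) (neighbours z t q) r) })
  where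
  :adjacent : Fin m → Fin m → Formula (λ (_ : ⊤) → 4) m
  :adjacent x y = (¬ᶠ (x ≈ᶠ y)) ∧ᶠ (¬ᶠ (∃ᶠ (∃ᶠ atom tt (suc (suc x) ∷ 1F ∷ suc (suc y) ∷ 0F ∷ []))))

  :neighbours : Term n → Term n → Arith n
  :neighbours x y = :successor x y :∨ :successor y x

  :matrix : (x y z t : Term n) → Arith n
  :matrix x y z t = (x :≡ z :∧ y :≡ t) :∨ (y :≡ z :∧ :¬ x :≡ t) :∨ (x :≡ t :∧ :¬ y :≡ z) :∨ :separation x y z t

  Adjacent : ℤ → ℤ → Set
  Adjacent x y = x ≢ y × ¬ (Σ[ z ∈ ℤ ] Σ[ w ∈ ℤ ] separation (x ∷ z ∷ y ∷ w ∷ []))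

  adjacent : ∀ x y → (y ≡ x + 1ℤ) ⊎ (x ≡ y + 1ℤ) → Adjacent x y
  adjacent x y h = linear (x ∷ y ∷ []) (λ x y → :neighbours x y :→ :¬ x :≡ y) h ,
    λ (z , w , s) → linear (x ∷ y ∷ z ∷ w ∷ []) (λ x y z w → :neighbours x y :→ :separation x z y w :→ :⊥) h s

  neighbours : ∀ x y → Adjacent x y → (y ≡ x + 1ℤ) ⊎ (x ≡ y + 1ℤ)
  neighbours x y (x≢y , h) = linear (x ∷ y ∷ [])
    -- The first instance excludes x + 1 < y and the second y + 1 < x.
    (λ x y → :¬ x :≡ y :→ :¬ :separation x (x :+ con 1ℤ) y (y :+ con 1ℤ) :→
      :¬ :separation x (y :+ con 1ℤ) y (x :+ con 1ℤ) :→ :neighbours x y)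
    x≢y (λ s → h (_ , _ , s)) (λ s → h (_ , _ , s))

-- Going up from x one meets x + 1 first, so that S(x, x + 1, y, z) means that y
-- comes before z.
cycle∈⟨separation,+1⟩ : relation C ∈ DefinableFrom (lookup (relation S ∷ relation +1 ∷ []))
cycle∈⟨separation,+1⟩ =
  (atom 1F (0F ∷ 1F ∷ []) ∧ᶠ ((¬ᶠ (0F ≈ᶠ 2F)) ∧ᶠ (¬ᶠ (1F ≈ᶠ 2F)))) ∨ᶠ
    (∃ᶠ (atom 1F (1F ∷ 0F ∷ []) ∧ᶠ atom 0F (1F ∷ 0F ∷ 2F ∷ 3F ∷ []))) ,
  (λ { {x ∷ y ∷ z ∷ []} c → [ inj₁ , (λ s → inj₂ (x + 1ℤ , refl , s)) ]′
    (linear (x ∷ y ∷ z ∷ []) (λ x y z → :cycle x y z :→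
      (:successor x y :∧ :¬ x :≡ z :∧ :¬ y :≡ z) :∨ :separation x (x :+ con 1ℤ) y z) c) }) ,
  (λ { {x ∷ y ∷ z ∷ []} (inj₁ p) → linear (x ∷ y ∷ z ∷ [])
         (λ x y z → :successor x y :∧ :¬ x :≡ z :∧ :¬ y :≡ z :→ :cycle x y z) p
     ; {x ∷ y ∷ z ∷ []} (inj₂ (u , e , s)) → linear (x ∷ y ∷ z ∷ u ∷ [])
         (λ x y z u → :successor x u :→ :separation x u y z :→ :cycle x y z) e s })

less∈⟨between,+1⟩ : relation Ord ∈ DefinableFrom (lookup (relation B ∷ relation +1 ∷ []))
less∈⟨between,+1⟩ =
  atom 1F (0F ∷ 1F ∷ []) ∨ᶠ (∃ᶠ (atom 1F (1F ∷ 0F ∷ []) ∧ᶠ atom 0F (1F ∷ 0F ∷ 2F ∷ []))) ,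
  (λ { {x ∷ y ∷ []} x<y → [ inj₁ , (λ b → inj₂ (x + 1ℤ , refl , b)) ]′
    (linear (x ∷ y ∷ []) (λ x y → x :< y :→ :successor x y :∨ :between x (x :+ con 1ℤ) y) x<y) }) ,
  (λ { {x ∷ y ∷ []} (inj₁ e) → linear (x ∷ y ∷ []) (λ x y → :successor x y :→ x :< y) e
     ; {x ∷ y ∷ []} (inj₂ (u , e , b)) → linear (x ∷ y ∷ u ∷ [])
         (λ x y u → :successor x u :→ :between x u y :→ x :< y) e b })

-- Reflection x ↦ - x

FlipInvariant : Relation ℤ n → Set
FlipInvariant R = ∀ x → R x → R (map -_ x)

flip-flip : (x : Vec ℤ n) → map -_ (map -_ x) ≡ x
flip-flip x = trans (sym (map-∘ -_ -_ x)) (trans (map-cong ℤ.neg-involutive x) (map-id x))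

flipInvariant-⇔ : {R : Relation ℤ n} → FlipInvariant R → ∀ x → R x ⇔ R (map -_ x)
flipInvariant-⇔ {R = R} h x = mk⇔ (h x) (subst R (flip-flip x) ∘ h (map -_ x))

generated-flipInvariant : (G : ∃ (Relation ℤ)) → FlipInvariant (proj₂ G) →
  {R : Relation ℤ n} → (n , R) ∈ ⟨ G ⟩ → FlipInvariant R
generated-flipInvariant (_ , P) h (φ , R⊆ , ⊆R) x r =
  ⊆R (to (involution-⇔ (λ _ → P) (λ _ → P) -_ ℤ.neg-involutive (λ _ → flipInvariant-⇔ h) φ x) (R⊆ r))

-- A flip-invariant relation cannot tell the successor from the predecessor, so
-- its definition may use either, and one of them is picked by an adjacent pair.
unflip : (G : ∃ (Relation ℤ)) → FlipInvariant (proj₂ G) → {R : Relation ℤ n} → FlipInvariant R →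
  (n , R) ∈ DefinableFrom (lookup (G ∷ relation +1 ∷ [])) →
  (n , R) ∈ DefinableFrom (lookup (G ∷ relation A₁₁ ∷ []))
unflip {n} G@(m , P) P-flip {R} R-flip (φ , R⊆ , ⊆R) =
  (∃ᶠ (∃ᶠ (atom 1F (0F ∷ 1F ∷ 0F ∷ 1F ∷ []) ∧ᶠ ψ))) ,
  (λ {x} r → 0ℤ , 1ℤ , (refl , refl) , to (forward 0ℤ 1ℤ refl x) (R⊆ r)) ,
  (λ { {x} (p , q , a , r) → case to (codirection₁-⇔ q p q p) a of λ
    { (inj₂ (q≡p+1 , _)) → ⊆R (from (forward p q q≡p+1 x) r)
    -- With the pair pointing down, ψ evaluates φ in `F⁻`, where the predecessor replaces the
    -- successor. Reflection is an isomorphism onto `F`, so what follows is R at - x.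
    ; (inj₁ (p≡q+1 , _)) → from (flipInvariant-⇔ R-flip x)
        (⊆R (to (involution-⇔ (proj₂ ∘ F⁻) (proj₂ ∘ F) -_ ℤ.neg-involutive (λ _ _ → ⇔-id _) φ x)
          (from (backward p q p≡q+1 x) r))) } })
  where
  F F⁻ H : Fin 2 → ∃ (Relation ℤ)
  F = lookup (G ∷ relation +1 ∷ [])
  F⁻ i = proj₁ (F i) , λ us → proj₂ (F i) (map -_ us)
  H = lookup (G ∷ relation A₁₁ ∷ [])

  τ : ∀ i → Formula (proj₁ ∘ H) (2 ℕ.+ proj₁ (F i))
  τ zero       = atom zero (map (2 ↑ʳ_) (allFin m))
  -- The parameters p and q are the variables 0 and 1, so this says y - x = q - p: the successor if
  -- q = p + 1, the predecessor if q = p - 1.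
  τ (suc zero) = atom 1F (3F ∷ 2F ∷ 1F ∷ 0F ∷ [])

  ψ : Formula (proj₁ ∘ H) (2 ℕ.+ n)
  ψ = interpret τ (1F ∷ 0F ∷ []) (2 ↑ʳ_) φ

  weaken-⇔ : ∀ p q us → P us ⇔ P (map (lookup (p ∷ q ∷ us)) (map (2 ↑ʳ_) (allFin m)))
  weaken-⇔ p q us = ≡-⇔ (cong P (sym (trans (sym (map-∘ _ (2 ↑ʳ_) (allFin m))) (map-lookup-allFin us))))

  forward : ∀ p q → q ≡ p + 1ℤ → ∀ x → (F ⟦ φ ⟧ x) ⇔ (H ⟦ ψ ⟧ (q ∷ p ∷ x))
  forward p q q≡p+1 x = interpret-⇔ F H τ (p ∷ q ∷ []) τ-⇔ φ refl (λ _ → refl)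
    where
    τ-⇔ : ∀ i us → proj₂ (F i) us ⇔ (H ⟦ τ i ⟧ (p ∷ q ∷ us))
    τ-⇔ zero       us           = weaken-⇔ p q us
    τ-⇔ (suc zero) (x ∷ y ∷ []) = ⇔-sym (codirection₁-⇔ y x q p) ⇔-∘ mk⇔
      (linear (p ∷ q ∷ x ∷ y ∷ []) (λ p q x y → :successor p q :→ :successor x y :→ :codirected y x q p) q≡p+1)
      (linear (p ∷ q ∷ x ∷ y ∷ []) (λ p q x y → :successor p q :→ :codirected y x q p :→ :successor x y) q≡p+1)

  backward : ∀ p q → p ≡ q + 1ℤ → ∀ x → (F⁻ ⟦ φ ⟧ x) ⇔ (H ⟦ ψ ⟧ (q ∷ p ∷ x))
  backward p q p≡q+1 x = interpret-⇔ F⁻ H τ (p ∷ q ∷ []) τ-⇔ φ refl (λ _ → refl)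
    where
    τ-⇔ : ∀ i us → proj₂ (F⁻ i) us ⇔ (H ⟦ τ i ⟧ (p ∷ q ∷ us))
    τ-⇔ zero       us           = weaken-⇔ p q us ⇔-∘ ⇔-sym (flipInvariant-⇔ P-flip us)
    τ-⇔ (suc zero) (x ∷ y ∷ []) = ⇔-sym (codirection₁-⇔ y x q p) ⇔-∘ mk⇔
      (linear (p ∷ q ∷ x ∷ y ∷ []) (λ p q x y → :successor q p :→ :successor (:- x) (:- y) :→ :codirected y x q p)
          p≡q+1)
      (linear (p ∷ q ∷ x ∷ y ∷ []) (λ p q x y → :successor q p :→ :codirected y x q p :→ :successor (:- x) (:- y))
          p≡q+1)

between-flipInvariant : FlipInvariant between
between-flipInvariant (a ∷ b ∷ c ∷ []) = linear (a ∷ b ∷ c ∷ []) λ a b c → :between a b c :→ :between (:- a) (:- b)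
    (:- c)

⟨between⟩-flipInvariant : {R : Relation ℤ n} → (n , R) ∈ space B → FlipInvariant R
⟨between⟩-flipInvariant = generated-flipInvariant (relation B) between-flipInvariant

-- Non-definability from reflections, exchanges and rotations

successor∉⟨between⟩ : ¬ (relation +1 ∈ space B)
successor∉⟨between⟩ d with () ← ⟨between⟩-flipInvariant d (0ℤ ∷ 1ℤ ∷ []) refl

-- With g = N + 2, just beyond the bound N + 1 of the game, the triples 0, g, 2g and g, 0, 2g have
-- only far pairs, yet opposite orientations.
cycle∉⟨+1⟩ : ¬ (relation C ∈ space +1)
cycle∉⟨+1⟩ d with BackAndForth.definable-invariant successor-game d
... | N , h = linear (+ N ∷ []) (λ N → con 0ℤ :≤ N :→ :cycle (:g N) (con 0ℤ) (:g N :+ :g N) :→ :⊥) (0≤+ N)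
  (h (0ℤ ∷ g ∷ g + g ∷ []) (g ∷ 0ℤ ∷ g + g ∷ []) exchange
    (linear (+ N ∷ []) (λ N → con 0ℤ :≤ N :→ :cycle (con 0ℤ) (:g N) (:g N :+ :g N)) (0≤+ N)))
  where
  :g : Term k → Term k
  :g N = con (+ 2) :+ N

  g : ℤ
  g = + suc (suc N)

  xs ys : Term k → Vec (Term k) 3
  xs N = con 0ℤ ∷ :g N ∷ :g N :+ :g N ∷ []
  ys N = :g N ∷ con 0ℤ ∷ :g N :+ :g N ∷ []

  f : Fin 3 → Fin 3 → N-ary 1 1
  f i j N = con 0ℤ :≤ N :→ :Local (con 1ℤ :+ N) (lookup (xs N) i) (lookup (xs N) j) (lookup (ys N) i)
      (lookup (ys N) j)

  exchange : Local (suc N) (0ℤ ∷ g ∷ g + g ∷ []) (g ∷ 0ℤ ∷ g + g ∷ [])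
  exchange 0F 0F = linear (+ N ∷ []) (f 0F 0F) (0≤+ N)
  exchange 0F 1F = linear (+ N ∷ []) (f 0F 1F) (0≤+ N)
  exchange 0F 2F = linear (+ N ∷ []) (f 0F 2F) (0≤+ N)
  exchange 1F 0F = linear (+ N ∷ []) (f 1F 0F) (0≤+ N)
  exchange 1F 1F = linear (+ N ∷ []) (f 1F 1F) (0≤+ N)
  exchange 1F 2F = linear (+ N ∷ []) (f 1F 2F) (0≤+ N)
  exchange 2F 0F = linear (+ N ∷ []) (f 2F 0F) (0≤+ N)
  exchange 2F 1F = linear (+ N ∷ []) (f 2F 1F) (0≤+ N)
  exchange 2F 2F = linear (+ N ∷ []) (f 2F 2F) (0≤+ N)

separation∉⟨+1⟩ : ¬ (relation S ∈ space +1)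
separation∉⟨+1⟩ d = cycle∉⟨+1⟩ (DefinableFrom-⊆
  (λ { zero → d ; (suc zero) → DefinableFrom-generator _ tt }) cycle∈⟨separation,+1⟩)

-- Moving the top point of 0, g, 2g below the other two is a rotation, and it takes the middle point
-- out of the middle.
between∉⟨cycle⟩ : ¬ (relation B ∈ space C)
between∉⟨cycle⟩ d with BackAndForth.definable-invariant cycle-game d
... | N , h = linear (+ N ∷ []) (λ N → con 0ℤ :≤ N :→ :between (:g N) (:g N :+ :g N) (con 0ℤ) :→ :⊥) (0≤+ N)
  (h (0ℤ ∷ g ∷ g + g ∷ []) (g ∷ g + g ∷ 0ℤ ∷ []) (false ∷ false ∷ true ∷ [] , rotate)
    (linear (+ N ∷ []) (λ N → con 0ℤ :≤ N :→ :between (con 0ℤ) (:g N) (:g N :+ :g N)) (0≤+ N)))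
  where
  :g : Term k → Term k
  :g N = con 1ℤ :+ N

  g : ℤ
  g = + suc N

  xs ys : Term k → Vec (Term k) 3
  xs N = con 0ℤ ∷ :g N ∷ :g N :+ :g N ∷ []
  ys N = :g N ∷ :g N :+ :g N ∷ con 0ℤ ∷ []

  c : Vec Bool 3
  c = false ∷ false ∷ true ∷ []

  f : Fin 3 → Fin 3 → N-ary 1 1
  f i j N = con 0ℤ :≤ N :→
    :Align (lookup c i) (lookup c j) N (lookup (xs N) i) (lookup (xs N) j) (lookup (ys N) i) (lookup (ys N) j)

  rotate : Aligned N c (0ℤ ∷ g ∷ g + g ∷ []) (g ∷ g + g ∷ 0ℤ ∷ [])
  rotate 0F 0F = linear (+ N ∷ []) (f 0F 0F) (0≤+ N)
  rotate 0F 1F = linear (+ N ∷ []) (f 0F 1F) (0≤+ N)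
  rotate 0F 2F = linear (+ N ∷ []) (f 0F 2F) (0≤+ N)
  rotate 1F 0F = linear (+ N ∷ []) (f 1F 0F) (0≤+ N)
  rotate 1F 1F = linear (+ N ∷ []) (f 1F 1F) (0≤+ N)
  rotate 1F 2F = linear (+ N ∷ []) (f 1F 2F) (0≤+ N)
  rotate 2F 0F = linear (+ N ∷ []) (f 2F 0F) (0≤+ N)
  rotate 2F 1F = linear (+ N ∷ []) (f 2F 1F) (0≤+ N)
  rotate 2F 2F = linear (+ N ∷ []) (f 2F 2F) (0≤+ N)

-- Boolean combinations

module Refinement (em : ∀ (A : Set) → Dec A) {ℓ} {V : RelationSet ℤ ℓ} (V-space : IsDefinabilitySpace V) where
  open Closure V-space

  -- Induction on the list, splitting along the first predicate. `Part Q` saturates R ∩ Q under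
  -- agreement on the remaining predicates, to which the induction applies. With no predicate left,
  -- R is empty or everything, and excluded middle tells which.
  boolean-combination : (is : List I) (P : I → Relation ℤ n) → (∀ i → (n , P i) ∈ V) → {R : Relation ℤ n} →
    (∀ x y → ListAll.All (λ i → P i x ⇔ P i y) is → R x → R y) → (n , R) ∈ V
  boolean-combination [] P P∈V {R} R-inv with em (∃ R)
  ... | yes (x , r) = resp-≐ ((λ _ → R-inv x _ [] r) , λ _ → tt) everything
  ... | no ¬r       = resp-≐ ((λ f → ⊥-elim (f tt)) , λ r _ → ¬r (_ , r)) (∁-closed everything)
  boolean-combination {I = I} {n} (i ∷ is) P P∈V {R} R-inv =
    resp-≐ (
      (λ { (inj₁ (p , y , q , r , a)) → R-inv y _ (mk⇔ (λ _ → p) (λ _ → q) ∷ a) r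
         ; (inj₂ (p , y , q , r , a)) → R-inv y _ (mk⇔ (⊥-elim ∘ q) (⊥-elim ∘ p) ∷ a) r }) ,
      λ {x} r → case em (P i x) of λ
        { (yes p) → inj₁ (p , x , p , r , ListAll.universal (λ _ → ⇔-id _) is)
        ; (no ¬p) → inj₂ (¬p , x , ¬p , r , ListAll.universal (λ _ → ⇔-id _) is) })
      (∪-closed (∩-closed (P∈V i) (part (P i))) (∩-closed (∁-closed (P∈V i)) (part (∁ (P i)))))
    where
    Part : Relation ℤ n → Relation ℤ n
    Part Q x = ∃ λ y → Q y × R y × ListAll.All (λ i → P i y ⇔ P i x) is

    part : ∀ Q → (n , Part Q) ∈ V
    part Q = boolean-combination is P P∈V λ x y x~y (z , q , r , z~x) →
      z , q , r , ListAll.zipWith (λ (e , f) → f ⇔-∘ e) (z~x , x~y)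

-- Displaced tuples

Shift : ℤ → Relation ℤ 2
Shift k (z ∷ y ∷ []) = z ≡ y + k

Interval : ℕ → Relation ℤ 2
Interval k (y ∷ z ∷ []) = y ≤ z × z ≤ y + + k

-- The blocks of x given by b keep their shape and are moved independently by the entries of v,
-- which become the variables of the defined relation.
displaced : Vec ℤ n → (Fin n → Fin m) → Vec ℤ m → Vec ℤ n
displaced x b v = tabulate λ i → lookup v (b i) + lookup x i

lookup-displaced : ∀ (x : Vec ℤ n) (b : Fin n → Fin m) v i → lookup (displaced x b v) i ≡ lookup v (b i) + lookup x i
lookup-displaced x b v = lookup∘tabulate _

module Shifts {ℓ} {V : RelationSet ℤ ℓ} (V-space : IsDefinabilitySpace V) where
  open Closure V-space

  ⋂-closed : (Q : Fin k → Relation ℤ n) → (∀ i → (n , Q i) ∈ V) → (n , λ v → ∀ i → Q i v) ∈ V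
  ⋂-closed {k = zero} Q Q∈V = resp-≐ ((λ _ ()) , λ _ → tt) everything
  ⋂-closed {k = suc k} Q Q∈V = resp-≐
    ((λ { (q , qs) zero → q ; (q , qs) (suc i) → qs i }) , λ qs → qs zero , qs ∘ suc)
    (∩-closed (Q∈V zero) (⋂-closed (Q ∘ suc) (Q∈V ∘ suc)))

  ∃*-closed : ∀ k {P : Relation ℤ (k ℕ.+ n)} → (k ℕ.+ n , P) ∈ V → (n , λ v → ∃ λ (w : Vec ℤ k) → P (w ++ v)) ∈ V
  ∃*-closed zero    p = resp-≐ ((λ q → [] , q) , λ { ([] , q) → q }) p
  ∃*-closed (suc k) p = resp-≐ ((λ (w , u , q) → u ∷ w , q) , λ { (u ∷ w , q) → w , u , q })
    (∃*-closed k (∃-closed p))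

  -- Substitution into R of functions given by their graphs `G i`; terms such as y + k enter
  -- formulas in this way.
  compose-closed : {R : Relation ℤ n} (G : Fin n → Relation ℤ (suc m)) → (n , R) ∈ V → (∀ i → (suc m , G i) ∈ V) →
    (m , λ v → ∃ λ w → R w × ∀ i → G i (lookup w i ∷ v)) ∈ V
  compose-closed {n} {m} {R} G R∈V G∈V = resp-≐
    ((λ { {v} (w , r , g) → w , subst R (left w v) r , λ i → subst (G i) (right w v i) (g i) }) ,
     (λ { {v} (w , r , g) → w , subst R (sym (left w v)) r , λ i → subst (G i) (sym (right w v i)) (g i) }))
    (∃*-closed n (∩-closed (substitute ls R∈V) (⋂-closed _ λ i → substitute (rs i) (G∈V i))))
    where
    ls : Vec (Fin (n ℕ.+ m)) n
    ls = tabulate (_↑ˡ m)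

    rs : Fin n → Vec (Fin (n ℕ.+ m)) (suc m)
    rs i = (i ↑ˡ m) ∷ tabulate (n ↑ʳ_)

    left : ∀ w (v : Vec ℤ m) → map (lookup (w ++ v)) ls ≡ w
    left w v = trans (sym (tabulate-∘ _ _)) (trans (tabulate-cong (lookup-++ˡ w v)) (tabulate∘lookup w))

    right : ∀ w (v : Vec ℤ m) i → map (lookup (w ++ v)) (rs i) ≡ lookup w i ∷ v
    right w v i = cong₂ _∷_ (lookup-++ˡ w v i)
      (trans (sym (tabulate-∘ _ _)) (trans (tabulate-cong (lookup-++ʳ w v)) (tabulate∘lookup v)))

  module _ (+1∈V : relation +1 ∈ V) where

    shift-ℕ : ∀ k → (2 , Shift (+ k)) ∈ V
    shift-ℕ zero = closed [] [] ((zero ≈ᶠ suc zero) ,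
      (λ { {z ∷ y ∷ []} e → linear (z ∷ y ∷ []) (λ z y → z :≡ y :+ con 0ℤ :→ z :≡ y) e }) ,
      (λ { {z ∷ y ∷ []} e → linear (z ∷ y ∷ []) (λ z y → z :≡ y :→ z :≡ y :+ con 0ℤ) e }))
    shift-ℕ (suc k) = closed (_ ∷ _ ∷ []) (shift-ℕ k ∷ +1∈V ∷ [])
      (∃ᶠ (atom 0F (0F ∷ 2F ∷ []) ∧ᶠ atom 1F (0F ∷ 1F ∷ [])) ,
      (λ { {z ∷ y ∷ []} e → y + + k , refl ,
         linear (+ k ∷ z ∷ y ∷ []) (λ k z y → z :≡ y :+ (con 1ℤ :+ k) :→ z :≡ y :+ k :+ con 1ℤ) e }) ,
      (λ { {z ∷ y ∷ []} (w , e , f) → linear (+ k ∷ z ∷ y ∷ w ∷ [])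
         (λ k z y w → w :≡ y :+ k :→ z :≡ w :+ con 1ℤ :→ z :≡ y :+ (con 1ℤ :+ k)) e f }))

    shift∈ : ∀ k → (2 , Shift k) ∈ V
    shift∈ (+ k)    = shift-ℕ k
    shift∈ -[1+ k ] = closed (_ ∷ []) (shift-ℕ (suc k) ∷ []) (atom 0F (1F ∷ 0F ∷ []) ,
      (λ { {z ∷ y ∷ []} → linear (+ suc k ∷ z ∷ y ∷ []) (λ k z y → z :≡ y :+ :- k :→ y :≡ z :+ k) }) ,
      (λ { {z ∷ y ∷ []} → linear (+ suc k ∷ z ∷ y ∷ []) (λ k z y → y :≡ z :+ k :→ z :≡ y :+ :- k) }))

    interval∈ : ∀ k → (2 , Interval k) ∈ V
    interval∈ zero = closed [] [] ((0F ≈ᶠ 1F) ,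
      (λ { {y ∷ z ∷ []} (p , q) → linear (y ∷ z ∷ []) (λ y z → y :≤ z :→ z :≤ y :+ con 0ℤ :→ y :≡ z) p q }) ,
      (λ { {y ∷ z ∷ []} → linear (y ∷ z ∷ []) (λ y z → y :≡ z :→ y :≤ z :∧ z :≤ y :+ con 0ℤ) }))
    interval∈ (suc k) = closed (_ ∷ _ ∷ []) (interval∈ k ∷ shift-ℕ (suc k) ∷ [])
      (atom 0F (0F ∷ 1F ∷ []) ∨ᶠ atom 1F (1F ∷ 0F ∷ []) ,
      (λ { {y ∷ z ∷ []} → linear (+ k ∷ y ∷ z ∷ []) λ k y z →
         y :≤ z :∧ z :≤ y :+ (con 1ℤ :+ k) :→ (y :≤ z :∧ z :≤ y :+ k) :∨ z :≡ y :+ (con 1ℤ :+ k) }) ,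
      (λ { {y ∷ z ∷ []} → linear (+ k ∷ y ∷ z ∷ []) (λ k y z → con 0ℤ :≤ k :→
         (y :≤ z :∧ z :≤ y :+ k) :∨ z :≡ y :+ (con 1ℤ :+ k) :→ y :≤ z :∧ z :≤ y :+ (con 1ℤ :+ k)) (0≤+ k) }))

    displaced∈ : {R : Relation ℤ n} → (n , R) ∈ V → ∀ x (b : Fin n → Fin m) → (m , λ v → R (displaced x b v)) ∈ V
    displaced∈ {R = R} R∈V x b = resp-≐
      ((λ { {v} (w , r , e) → subst R (trans (sym (tabulate∘lookup w)) (tabulate-cong e)) r }) ,
       (λ { {v} r → displaced x b v , r , lookup-displaced x b v }))
      (compose-closed (λ i v → Shift (lookup x i) (map (lookup v) (zero ∷ suc (b i) ∷ []))) R∈V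
        (λ i → substitute (zero ∷ suc (b i) ∷ []) (shift∈ (lookup x i))))

-- Order from a relation that is not cyclic

module _ {ℓ} {V : RelationSet ℤ ℓ} (V-space : IsDefinabilitySpace V) (+1∈V : relation +1 ∈ V) where
  open Closure V-space
  open Shifts V-space

  -- Q is undetermined only for u < l < u + K, and this window can be cut out with `Interval K`.
  order∈ : ∀ K {Q : Relation ℤ 2} → (2 , Q) ∈ V → (∀ l u → l ≤ u → Q (l ∷ u ∷ [])) →
    (∀ l u → u + + K ≤ l → ¬ Q (l ∷ u ∷ [])) → relation Ord ∈ V
  order∈ K {Q} Q∈V above below = closed (_ ∷ _ ∷ []) (Q∈V ∷ interval∈ +1∈V K ∷ [])
    ((¬ᶠ (0F ≈ᶠ 1F)) ∧ᶠ (atom 0F (0F ∷ 1F ∷ []) ∧ᶠ (¬ᶠ atom 1F (1F ∷ 0F ∷ []))) ,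
    (λ { {l ∷ u ∷ []} l<u → (λ { refl → ℤ.<-irrefl refl l<u }) , above l u (ℤ.<⇒≤ l<u) , λ (u≤l , _) →
        ℤ.<⇒≱ l<u u≤l }) ,
    (λ { {l ∷ u ∷ []} (l≢u , q , far) → case l ℤ.<? u of λ
      { (yes l<u) → l<u
      ; (no l≮u) → ⊥-elim (below l u (linear (l ∷ u ∷ + K ∷ [])
          (λ l u K → :¬ l :≡ u :→ :¬ l :< u :→ :¬ (u :≤ l :∧ l :≤ u :+ K) :→ u :+ K :≤ l) l≢u l≮u far) q) } }))

  -- If the points of colour true are moved by u and the others by l, then R holds
  -- for l ≤ u and fails when u is far below l.
  order-from-noncyclic : {R : Relation ℤ n} → (n , R) ∈ V → Invariant (Ordered N) R →
    ∀ x y → Cyclic N x y → R x → ¬ R y → relation Ord ∈ V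
  order-from-noncyclic {n} {N} {R} R∈V R-inv x y (c , e) r ¬r with bounded x
  ... | M , x≤M = order∈ K (displaced∈ +1∈V R∈V x b)
    (λ l u l≤u → R-inv x (displaced x b (l ∷ u ∷ [])) (above l u l≤u) r)
    (λ l u u≪l → ¬r ∘ R-inv (displaced x b (l ∷ u ∷ [])) y (below l u u≪l))
    where
    K : ℕ
    -- All points of x lie between -M and M, so a displacement by K leaves more than N between the
    -- two parts.
    K = suc (N ℕ.+ (M ℕ.+ M))

    b : Fin n → Fin 2
    b i = if lookup c i then 1F else 0F

    :K : (N M : Term k) → Term k
    :K N M = con 1ℤ :+ (N :+ (M :+ M))

    above : ∀ l u → l ≤ u → Ordered N x (displaced x b (l ∷ u ∷ []))
    above l u l≤u i j rewrite lookup-displaced x b (l ∷ u ∷ []) i | lookup-displaced x b (l ∷ u ∷ []) j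
      with lookup c i | lookup c j | e i j
    ... | false | false | _ = linear (+ N ∷ l ∷ lookup x i ∷ lookup x j ∷ [])
      λ N l xᵢ xⱼ → :Same N (xᵢ :- xⱼ) (l :+ xᵢ :- (l :+ xⱼ))
    ... | true  | true  | _ = linear (+ N ∷ u ∷ lookup x i ∷ lookup x j ∷ [])
      λ N u xᵢ xⱼ → :Same N (xᵢ :- xⱼ) (u :+ xᵢ :- (u :+ xⱼ))
    ... | false | true  | p , _ = linear (+ N ∷ l ∷ u ∷ lookup x i ∷ lookup x j ∷ [])
      (λ N l u xᵢ xⱼ → l :≤ u :→ N :< xⱼ :- xᵢ :→ :Same N (xᵢ :- xⱼ) (l :+ xᵢ :- (u :+ xⱼ))) l≤u p
    ... | true  | false | p , _ = linear (+ N ∷ l ∷ u ∷ lookup x i ∷ lookup x j ∷ [])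
      (λ N l u xᵢ xⱼ → l :≤ u :→ N :< xᵢ :- xⱼ :→ :Same N (xᵢ :- xⱼ) (u :+ xᵢ :- (l :+ xⱼ))) l≤u p

    below : ∀ l u → u + + K ≤ l → Ordered N (displaced x b (l ∷ u ∷ [])) y
    below l u u≪l i j rewrite lookup-displaced x b (l ∷ u ∷ []) i | lookup-displaced x b (l ∷ u ∷ []) j
      with lookup c i | lookup c j | e i j
    ... | false | false | p = linear (+ N ∷ l ∷ lookup x i ∷ lookup x j ∷ lookup y i ∷ lookup y j ∷ [])
      (λ N l xᵢ xⱼ yᵢ yⱼ → :Same N (xᵢ :- xⱼ) (yᵢ :- yⱼ) :→ :Same N (l :+ xᵢ :- (l :+ xⱼ)) (yᵢ :- yⱼ)) p
    ... | true  | true  | p = linear (+ N ∷ u ∷ lookup x i ∷ lookup x j ∷ lookup y i ∷ lookup y j ∷ [])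
      (λ N u xᵢ xⱼ yᵢ yⱼ → :Same N (xᵢ :- xⱼ) (yᵢ :- yⱼ) :→ :Same N (u :+ xᵢ :- (u :+ xⱼ)) (yᵢ :- yⱼ)) p
    ... | false | true  | _ , q = linear (+ N ∷ + M ∷ l ∷ u ∷ lookup x i ∷ lookup x j ∷ lookup y i ∷ lookup y j ∷ [])
      (λ N M l u xᵢ xⱼ yᵢ yⱼ → u :+ :K N M :≤ l :→ :- M :≤ xᵢ :∧ xᵢ :≤ M :→ :- M :≤ xⱼ :∧ xⱼ :≤ M :→ N :< yᵢ :- yⱼ :→
        :Same N (l :+ xᵢ :- (u :+ xⱼ)) (yᵢ :- yⱼ)) u≪l (x≤M i) (x≤M j) q
    ... | true  | false | _ , q = linear (+ N ∷ + M ∷ l ∷ u ∷ lookup x i ∷ lookup x j ∷ lookup y i ∷ lookup y j ∷ [])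
      (λ N M l u xᵢ xⱼ yᵢ yⱼ → u :+ :K N M :≤ l :→ :- M :≤ xᵢ :∧ xᵢ :≤ M :→ :- M :≤ xⱼ :∧ xⱼ :≤ M :→ N :< yⱼ :- yᵢ :→
        :Same N (u :+ xᵢ :- (l :+ xⱼ)) (yᵢ :- yⱼ)) u≪l (x≤M i) (x≤M j) q

-- Cyclic order from a cyclic relation that is not local

:spaced : (K a b c : Term n) → Arith n
:spaced K a b c = (a :+ K :≤ b :∧ b :+ K :≤ c) :∨ (b :+ K :≤ c :∧ c :+ K :≤ a) :∨ (c :+ K :≤ a :∧ a :+ K :≤ b)

Spaced : ℕ → (a b c : ℤ) → Set
Spaced K a b c = (a + + K ≤ b × b + + K ≤ c) ⊎ (b + + K ≤ c × c + + K ≤ a) ⊎ (c + + K ≤ a × a + + K ≤ b)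

module _ {ℓ} {V : RelationSet ℤ ℓ} (V-space : IsDefinabilitySpace V) (+1∈V : relation +1 ∈ V) where
  open Closure V-space
  open Shifts V-space

  -- Q is trusted only when the three points are pairwise more than K apart. Otherwise some pair x,
  -- y is within K, and the cyclic order of x, y, z can be read off, as in `arcᶠ`: for x < y the
  -- point z lies outside the interval from x to y, and for y < x strictly inside.
  cycle∈ : ∀ K {Q : Relation ℤ 3} → (3 , Q) ∈ V →
    (∀ a b c → Spaced (suc K) a b c → Q (a ∷ b ∷ c ∷ [])) →
    (∀ a b c → Spaced (suc K) b a c → ¬ Q (a ∷ b ∷ c ∷ [])) → relation C ∈ V
  cycle∈ K {Q} Q∈V pos neg = closed Fs (Q∈V ∷ interval∈ +1∈V K ∷ [])
    (arcᶠ 0F 1F 2F ∨ᶠ (arcᶠ 1F 2F 0F ∨ᶠ (arcᶠ 2F 0F 1F ∨ᶠ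
      (atom 0F (0F ∷ 1F ∷ 2F ∷ []) ∧ᶠ (apartᶠ 0F 1F ∧ᶠ (apartᶠ 1F 2F ∧ᶠ apartᶠ 2F 0F))))) ,
    (λ { {a ∷ b ∷ c ∷ []} → complete a b c }) , (λ { {a ∷ b ∷ c ∷ []} → sound a b c }))
    where
    Fs : Vec (∃ (Relation ℤ)) 2
    Fs = (3 , Q) ∷ (2 , Interval K) ∷ []

    apartᶠ : Fin m → Fin m → Formula (proj₁ ∘ lookup Fs) m
    apartᶠ x y = (¬ᶠ atom 1F (x ∷ y ∷ [])) ∧ᶠ (¬ᶠ atom 1F (y ∷ x ∷ []))

    arcᶠ : (x y z : Fin m) → Formula (proj₁ ∘ lookup Fs) m
    arcᶠ x y z =
      ((¬ᶠ (x ≈ᶠ y)) ∧ᶠ (atom 1F (x ∷ y ∷ []) ∧ᶠ (¬ᶠ (atom 1F (x ∷ z ∷ []) ∧ᶠ atom 1F (z ∷ y ∷ []))))) ∨ᶠ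
      (atom 1F (y ∷ x ∷ []) ∧ᶠ (atom 1F (y ∷ z ∷ []) ∧ᶠ (atom 1F (z ∷ x ∷ []) ∧ᶠ
        ((¬ᶠ (y ≈ᶠ z)) ∧ᶠ (¬ᶠ (z ≈ᶠ x))))))

    :close :apart : (K x y : Term n) → Arith n
    :close K x y = x :≤ y :∧ y :≤ x :+ K
    :apart K x y = :¬ :close K x y :∧ :¬ :close K y x

    :arc : (K x y z : Term n) → Arith n
    :arc K x y z = (:¬ x :≡ y :∧ :close K x y :∧ :¬ (:close K x z :∧ :close K z y)) :∨
      (:close K y x :∧ :close K y z :∧ :close K z x :∧ :¬ y :≡ z :∧ :¬ z :≡ x)

    Close Apart : ℤ → ℤ → Set
    Close x y = x ≤ y × y ≤ x + + K
    Apart x y = ¬ Close x y × ¬ Close y x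

    Arc : ℤ → ℤ → ℤ → Set
    Arc x y z = (x ≢ y × Close x y × ¬ (Close x z × Close z y)) ⊎ (Close y x × Close y z × Close z x × y ≢ z × z ≢ x)

    rotate-cycle : ∀ a b c → cycle (a ∷ b ∷ c ∷ []) → cycle (b ∷ c ∷ a ∷ [])
    rotate-cycle a b c = linear (a ∷ b ∷ c ∷ []) λ a b c → :cycle a b c :→ :cycle b c a

    apart : ∀ x y → ¬ (Close x y ⊎ Close y x) → Apart x y
    apart x y p = p ∘ inj₁ , p ∘ inj₂

    near⇒arc : ∀ x y z → Close x y ⊎ Close y x → cycle (x ∷ y ∷ z ∷ []) → Arc x y z
    near⇒arc x y z = linear (+ K ∷ x ∷ y ∷ z ∷ []) (λ K x y z → con 0ℤ :≤ K :→ :close K x y :∨ :close K y x :→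
      :cycle x y z :→ :arc K x y z) (0≤+ K)

    close? : ∀ x y → Dec (Close x y ⊎ Close y x)
    close? x y = (x ℤ.≤? y ×-dec y ℤ.≤? x + + K) ⊎-dec (y ℤ.≤? x ×-dec x ℤ.≤? y + + K)

    complete : ∀ a b c → cycle (a ∷ b ∷ c ∷ []) →
      Arc a b c ⊎ Arc b c a ⊎ Arc c a b ⊎ (Q (a ∷ b ∷ c ∷ []) × Apart a b × Apart b c × Apart c a)
    complete a b c cyc with close? a b | close? b c | close? c a
    ... | yes p | _     | _     = inj₁ (near⇒arc a b c p cyc)
    ... | no  _ | yes p | _     = inj₂ (inj₁ (near⇒arc b c a p (rotate-cycle a b c cyc)))
    ... | no  _ | no  _ | yes p = inj₂ (inj₂ (inj₁ (near⇒arc c a b p (rotate-cycle b c a (rotate-cycle a b c cyc)))))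
    ... | no  p | no  q | no  r = inj₂ (inj₂ (inj₂
      (pos a b c (linear (+ K ∷ a ∷ b ∷ c ∷ []) (λ K a b c → con 0ℤ :≤ K :→ :cycle a b c :→ :apart K a b :→
          :apart K b c :→
          :apart K c a :→ :spaced (con 1ℤ :+ K) a b c) (0≤+ K) cyc (apart a b p) (apart b c q) (apart c a r)) ,
       apart a b p , apart b c q , apart c a r)))

    arc⇒cycle : ∀ a b c → Arc a b c → cycle (a ∷ b ∷ c ∷ [])
    arc⇒cycle a b c = linear (+ K ∷ a ∷ b ∷ c ∷ []) (λ K a b c → con 0ℤ :≤ K :→ :arc K a b c :→ :cycle a b c) (0≤+ K)

    sound : ∀ a b c → Arc a b c ⊎ Arc b c a ⊎ Arc c a b ⊎ (Q (a ∷ b ∷ c ∷ []) × Apart a b × Apart b c × Apart c a) →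
      cycle (a ∷ b ∷ c ∷ [])
    sound a b c (inj₁ p) = arc⇒cycle a b c p
    sound a b c (inj₂ (inj₁ p)) = rotate-cycle c a b (rotate-cycle b c a (arc⇒cycle b c a p))
    sound a b c (inj₂ (inj₂ (inj₁ p))) = rotate-cycle c a b (arc⇒cycle c a b p)
    sound a b c (inj₂ (inj₂ (inj₂ (q , f)))) =
      linear (+ K ∷ a ∷ b ∷ c ∷ []) (λ K a b c → con 0ℤ :≤ K :→ :apart K a b :∧ :apart K b c :∧ :apart K c a :→
        :¬ :spaced (con 1ℤ :+ K) b a c :→ :cycle a b c) (0≤+ K) f (λ s → neg a b c s q)

-- Rearranging blocks of a tuple

-- r holds the ranks of the blocks from the bottom up, so 1, 2, 3, 0 puts block 3 lowest. Blocks may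
-- be empty.
Separated : ℕ → (Fin n → Fin k) → Vec ℕ k → Vec ℤ n → Set
Separated N b r x = ∀ p q → lookup r (b p) ℕ.< lookup r (b q) → + N < lookup x q - lookup x p

Rigid : (Fin n → Fin k) → Vec ℤ n → Vec ℤ n → Set
Rigid b x y = ∀ p q → b p ≡ b q → lookup x p - lookup x q ≡ lookup y p - lookup y q

-- The blocks of colour true are moved from above to below the others.
Rotation : Bool → Bool → (r r′ s s′ : ℕ) → Set
Rotation false true  r r′ s s′ = r ℕ.< r′ × s′ ℕ.< s
Rotation true  false r r′ s s′ = r′ ℕ.< r × s ℕ.< s′
Rotation _     _     r r′ s s′ = (r ℕ.< r′ × s ℕ.< s′) ⊎ (r′ ℕ.< r × s′ ℕ.< s)

rotation? : ∀ c c′ r r′ s s′ → Dec (Rotation c c′ r r′ s s′)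
rotation? false true  r r′ s s′ = r ℕ.<? r′ ×-dec s′ ℕ.<? s
rotation? true  false r r′ s s′ = r′ ℕ.<? r ×-dec s ℕ.<? s′
rotation? false false r r′ s s′ = (r ℕ.<? r′ ×-dec s ℕ.<? s′) ⊎-dec (r′ ℕ.<? r ×-dec s′ ℕ.<? s)
rotation? true  true  r r′ s s′ = (r ℕ.<? r′ ×-dec s ℕ.<? s′) ⊎-dec (r′ ℕ.<? r ×-dec s′ ℕ.<? s)

Rotates : Vec Bool k → Vec ℕ k → Vec ℕ k → Set
Rotates χ r s = ∀ β γ → β ≡ γ ⊎
  Rotation (lookup χ β) (lookup χ γ) (lookup r β) (lookup r γ) (lookup s β) (lookup s γ)

rotates? : ∀ (χ : Vec Bool k) r s → Dec (Rotates χ r s)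
rotates? χ r s = all? λ β → all? λ γ → β Fin.≟ γ ⊎-dec
  rotation? (lookup χ β) (lookup χ γ) (lookup r β) (lookup r γ) (lookup s β) (lookup s γ)

-- Between different blocks only the ranks matter and inside a block only rigidity, so what remains
-- is a finite check on colours and ranks, settled by evaluation.
rotate-blocks : (b : Fin n → Fin k) (χ : Vec Bool k) (r s : Vec ℕ k) {_ : True (rotates? χ r s)} → ∀ x y →
  Separated N b r x → Separated N b s y → Rigid b x y → Cyclic N x y
rotate-blocks {N = N} b χ r s {χ-rotates} x y x-sep y-sep rigid = tabulate (lookup χ ∘ b) , aligned
  where
  below : ∀ p q → + N < lookup x q - lookup x p → + N < lookup y q - lookup y p →
    lookup x p - lookup x q < - + N × lookup y p - lookup y q < - + N
  below p q = linear (+ N ∷ lookup x p ∷ lookup x q ∷ lookup y p ∷ lookup y q ∷ []) λ N x x′ y y′ →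
    N :< x′ :- x :→ N :< y′ :- y :→ x :- x′ :< :- N :∧ y :- y′ :< :- N

  aligned : Aligned N (tabulate (lookup χ ∘ b)) x y
  aligned p q rewrite lookup∘tabulate (lookup χ ∘ b) p | lookup∘tabulate (lookup χ ∘ b) q
    with b p Fin.≟ b q
  ... | yes bp≡bq rewrite bp≡bq = go (lookup χ (b q))
    where
    go : ∀ c → Align N c c (lookup x p) (lookup x q) (lookup y p) (lookup y q)
    go false = inj₁ (rigid p q bp≡bq)
    go true  = inj₁ (rigid p q bp≡bq)
  ... | no bp≢bq with lookup χ (b p) | lookup χ (b q) | toWitness χ-rotates (b p) (b q)
  ...   | _     | _     | inj₁ bp≡bq = ⊥-elim (bp≢bq bp≡bq)
  ...   | false | true  | inj₂ (h , h′) = x-sep p q h , y-sep q p h′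
  ...   | true  | false | inj₂ (h , h′) = x-sep q p h , y-sep p q h′
  ...   | false | false | inj₂ (inj₁ (h , h′)) = inj₂ (inj₂ (below p q (x-sep p q h) (y-sep p q h′)))
  ...   | false | false | inj₂ (inj₂ (h , h′)) = inj₂ (inj₁ (x-sep q p h , y-sep q p h′))
  ...   | true  | true  | inj₂ (inj₁ (h , h′)) = inj₂ (inj₂ (below p q (x-sep p q h) (y-sep p q h′)))
  ...   | true  | true  | inj₂ (inj₂ (h , h′)) = inj₂ (inj₁ (x-sep q p h , y-sep q p h′))

-- A tuple bounded by M spans at most 2M, so steps of 1 + N + 2M leave more than N between blocks of
-- different rank.
offset : (N M j : ℕ) → ℤ
offset N M j = + (j ℕ.* suc (N ℕ.+ (M ℕ.+ M)))

spread : (N M : ℕ) → Vec ℤ n → (Fin n → Fin k) → Vec ℕ k → Vec ℤ n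
spread N M x b r = displaced x b (map (offset N M) r)

lookup-spread : ∀ N M (x : Vec ℤ n) (b : Fin n → Fin k) r p →
  lookup (spread N M x b r) p ≡ offset N M (lookup r (b p)) + lookup x p
lookup-spread N M x b r p = trans (lookup-displaced x b (map (offset N M) r) p)
  (cong (λ z → z + lookup x p) (lookup-map (b p) (offset N M) r))

spread-separated : ∀ N M (x : Vec ℤ n) (b : Fin n → Fin k) r → Bound M x → Separated N b r (spread N M x b r)
spread-separated N M x b r x≤M p q rp<rq rewrite lookup-spread N M x b r p | lookup-spread N M x b r q =
  linear (+ N ∷ + M ∷ offset N M (lookup r (b p)) ∷ offset N M (lookup r (b q)) ∷ lookup x p ∷ lookup x q ∷ [])
    (λ N M s s′ x x′ → con 1ℤ :+ (N :+ (M :+ M)) :+ s :≤ s′ :→ :- M :≤ x :∧ x :≤ M :→ :- M :≤ x′ :∧ x′ :≤ M :→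
      N :< s′ :+ x′ :- (s :+ x))
    (+≤+ (ℕ.*-monoˡ-≤ (suc (N ℕ.+ (M ℕ.+ M))) rp<rq)) (x≤M p) (x≤M q)

spread-rigid : ∀ N M (x : Vec ℤ n) (b : Fin n → Fin k) r s → Rigid b (spread N M x b r) (spread N M x b s)
spread-rigid N M x b r s p q e
  rewrite lookup-spread N M x b r p | lookup-spread N M x b r q | lookup-spread N M x b s p | lookup-spread N M x b s q | e =
  linear (offset N M (lookup r (b q)) ∷ offset N M (lookup s (b q)) ∷ lookup x p ∷ lookup x q ∷ [])
    (λ r s x x′ → r :+ x :- (r :+ x′) :≡ s :+ x :- (s :+ x′))

rigid-spread : ∀ N M (x : Vec ℤ n) (b : Fin n → Fin k) r → Rigid b x (spread N M x b r)
rigid-spread N M x b r p q e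
  rewrite lookup-spread N M x b r p | lookup-spread N M x b r q | e =
  linear (offset N M (lookup r (b q)) ∷ lookup x p ∷ lookup x q ∷ [])
    (λ r x x′ → x :- x′ :≡ r :+ x :- (r :+ x′))

-- Exchanging blocks 0 and 1 changes R. Of the rest, block 2 was above them from the start, and
-- block 3 was below them and has been rotated to the top.
record Swap (N : ℕ) (R : Relation ℤ n) : Set where
  field
    b     : Fin n → Fin 4
    x z   : Vec ℤ n
    x-sep : Separated N b (0 ∷ 1 ∷ 2 ∷ 3 ∷ []) x
    z-sep : Separated N b (1 ∷ 0 ∷ 2 ∷ 3 ∷ []) z
    rigid : Rigid b x z
    holds : R x
    fails : ¬ R z

module _ {ℓ} {V : RelationSet ℤ ℓ} (V-space : IsDefinabilitySpace V) (+1∈V : relation +1 ∈ V) where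
  open Shifts V-space

  -- If block 0 is moved by a, block 1 by b, and the blocks 2 and 3 by c, then for
  -- a, b, c far apart R tells the two cyclic orders of a, b, c from each other.
  cycle-from-swap : {R : Relation ℤ n} → (n , R) ∈ V → Invariant (Cyclic N) R → Swap N R → relation C ∈ V
  cycle-from-swap {n} {N} {R} R∈V R-inv swap with bounded (Swap.x swap)
  ... | M , x≤M = cycle∈ V-space +1∈V K (displaced∈ +1∈V R∈V x (sel ∘ b)) pos neg
    where
    open Swap swap

    K : ℕ
    K = N ℕ.+ (M ℕ.+ M)

    sel : Fin 4 → Fin 3
    sel = lookup (0F ∷ 1F ∷ 2F ∷ 2F ∷ [])

    moved : Vec ℤ 3 → Vec ℤ n
    moved = displaced x (sel ∘ b)

    moved-rigid : ∀ v → Rigid b x (moved v)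
    moved-rigid v p q e rewrite lookup-displaced x (sel ∘ b) v p | lookup-displaced x (sel ∘ b) v q | e =
      linear (lookup v (sel (b q)) ∷ lookup x p ∷ lookup x q ∷ []) λ v x x′ → x :- x′ :≡ v :+ x :- (v :+ x′)

    increasing : ∀ a b c → a + + suc K ≤ b → b + + suc K ≤ c →
      ∀ i j → Fin.toℕ i ℕ.< Fin.toℕ j → lookup (a ∷ b ∷ c ∷ []) i + + suc K ≤ lookup (a ∷ b ∷ c ∷ []) j
    increasing a b c h k 0F 1F _ = h
    increasing a b c h k 1F 2F _ = k
    increasing a b c h k 0F 2F _ = linear (+ K ∷ a ∷ b ∷ c ∷ []) (λ K a b c → con 0ℤ :≤ K :→
      a :+ (con 1ℤ :+ K) :≤ b :→ b :+ (con 1ℤ :+ K) :≤ c :→ a :+ (con 1ℤ :+ K) :≤ c) (0≤+ K) h k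
    increasing a b c h k 0F 0F ()
    increasing a b c h k 1F 0F ()
    increasing a b c h k 1F 1F (ℕ.s≤s ())
    increasing a b c h k 2F 0F ()
    increasing a b c h k 2F 1F (ℕ.s≤s ())
    increasing a b c h k 2F 2F (ℕ.s≤s (ℕ.s≤s ()))

    -- The points of v are sorted by s, and the resulting order of the blocks is r.
    Sorts : Vec (Fin 3) 3 → Vec ℕ 4 → Set
    Sorts s r = ∀ β γ → lookup r β ℕ.< lookup r γ →
      (sel β ≡ sel γ × Fin.toℕ β ℕ.< Fin.toℕ γ) ⊎
      (Fin.toℕ (lookup s (sel β)) ℕ.< Fin.toℕ (lookup s (sel γ)))

    sorts? : ∀ s r → Dec (Sorts s r)
    sorts? s r = all? λ β → all? λ γ → lookup r β ℕ.<? lookup r γ →-dec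
      ((sel β Fin.≟ sel γ ×-dec Fin.toℕ β ℕ.<? Fin.toℕ γ) ⊎-dec
       (Fin.toℕ (lookup s (sel β)) ℕ.<? Fin.toℕ (lookup s (sel γ))))

    lookup-ranks : ∀ β → lookup (0 ∷ 1 ∷ 2 ∷ 3 ∷ []) β ≡ Fin.toℕ β
    lookup-ranks 0F = refl
    lookup-ranks 1F = refl
    lookup-ranks 2F = refl
    lookup-ranks 3F = refl

    moved-separated : ∀ a₀ a₁ a₂ s r {_ : True (sorts? s r)} v →
        (∀ i → lookup v i ≡ lookup (a₀ ∷ a₁ ∷ a₂ ∷ []) (lookup s i)) →
      a₀ + + suc K ≤ a₁ × a₁ + + suc K ≤ a₂ → Separated N b r (moved v)
    moved-separated a₀ a₁ a₂ s r {sorts} v v≡a (h , k) p q rp<rq =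
      subst₂ (λ t t′ → + N < t′ - t) (sym (lookup-displaced x (sel ∘ b) v p))
          (sym (lookup-displaced x (sel ∘ b) v q)) gap
      where
      vₚ v_q : ℤ
      vₚ = lookup v (sel (b p))
      v_q = lookup v (sel (b q))

      gap : + N < v_q + lookup x q - (vₚ + lookup x p)
      gap with toWitness sorts (b p) (b q) rp<rq
      ... | inj₁ (selp≡selq , bp<bq) = linear (+ N ∷ vₚ ∷ v_q ∷ lookup x p ∷ lookup x q ∷ [])
        (λ N v v′ x x′ → v :≡ v′ :→ N :< x′ :- x :→ N :< v′ :+ x′ :- (v :+ x))
        (cong (lookup v) selp≡selq)
        (x-sep p q (subst₂ ℕ._<_ (sym (lookup-ranks (b p))) (sym (lookup-ranks (b q))) bp<bq))
      ... | inj₂ sp<sq = linear (+ N ∷ + M ∷ vₚ ∷ v_q ∷ lookup x p ∷ lookup x q ∷ [])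
        (λ N M v v′ x x′ → v :+ (con 1ℤ :+ (N :+ (M :+ M))) :≤ v′ :→ :- M :≤ x :∧ x :≤ M :→ :- M :≤ x′ :∧ x′ :≤ M :→
          N :< v′ :+ x′ :- (v :+ x))
        (subst₂ (λ a a′ → a + + suc K ≤ a′) (sym (v≡a (sel (b p)))) (sym (v≡a (sel (b q))))
          (increasing a₀ a₁ a₂ h k (lookup s (sel (b p))) (lookup s (sel (b q))) sp<sq))
        (x≤M p) (x≤M q)

    reach : ∀ χ a₀ a₁ a₂ s r {_ : True (rotates? χ (0 ∷ 1 ∷ 2 ∷ 3 ∷ []) r)} {_ : True (sorts? s r)} v →
      (∀ i → lookup v i ≡ lookup (a₀ ∷ a₁ ∷ a₂ ∷ []) (lookup s i)) →
      a₀ + + suc K ≤ a₁ × a₁ + + suc K ≤ a₂ → R (moved v)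
    reach χ a₀ a₁ a₂ s r {t} {t′} v v≡a h = R-inv x (moved v)
      (rotate-blocks b χ (0 ∷ 1 ∷ 2 ∷ 3 ∷ []) r {t} x (moved v) x-sep
        (moved-separated a₀ a₁ a₂ s r {t′} v v≡a h) (moved-rigid v)) holds

    leave : ∀ χ a₀ a₁ a₂ s r {_ : True (rotates? χ r (1 ∷ 0 ∷ 2 ∷ 3 ∷ []))} {_ : True (sorts? s r)} v →
      (∀ i → lookup v i ≡ lookup (a₀ ∷ a₁ ∷ a₂ ∷ []) (lookup s i)) →
      a₀ + + suc K ≤ a₁ × a₁ + + suc K ≤ a₂ → ¬ R (moved v)
    leave χ a₀ a₁ a₂ s r {t} {t′} v v≡a h = fails ∘ R-inv (moved v) z
      (rotate-blocks b χ r (1 ∷ 0 ∷ 2 ∷ 3 ∷ []) {t} (moved v) z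
        (moved-separated a₀ a₁ a₂ s r {t′} v v≡a h) z-sep
        (λ p q e → trans (sym (moved-rigid v p q e)) (rigid p q e)))

    -- In each case s gives the positions of a, b, c in increasing order, and χ colours the blocks
    -- that the rotation takes from above to below the others.
    pos : ∀ a b c → Spaced (suc K) a b c → R (moved (a ∷ b ∷ c ∷ []))
    pos a b c (inj₁ h) = reach (false ∷ false ∷ false ∷ false ∷ []) a b c
      (0F ∷ 1F ∷ 2F ∷ []) (0 ∷ 1 ∷ 2 ∷ 3 ∷ []) (a ∷ b ∷ c ∷ []) (λ { 0F → refl ; 1F → refl ; 2F → refl }) h
    pos a b c (inj₂ (inj₁ h)) = reach (false ∷ true ∷ true ∷ true ∷ []) b c a
      (2F ∷ 0F ∷ 1F ∷ []) (3 ∷ 0 ∷ 1 ∷ 2 ∷ []) (a ∷ b ∷ c ∷ []) (λ { 0F → refl ; 1F → refl ; 2F → refl }) h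
    pos a b c (inj₂ (inj₂ h)) = reach (false ∷ false ∷ true ∷ true ∷ []) c a b
      (1F ∷ 2F ∷ 0F ∷ []) (2 ∷ 3 ∷ 0 ∷ 1 ∷ []) (a ∷ b ∷ c ∷ []) (λ { 0F → refl ; 1F → refl ; 2F → refl }) h

    neg : ∀ a b c → Spaced (suc K) b a c → ¬ R (moved (a ∷ b ∷ c ∷ []))
    neg a b c (inj₁ h) = leave (false ∷ false ∷ false ∷ false ∷ []) b a c
      (1F ∷ 0F ∷ 2F ∷ []) (1 ∷ 0 ∷ 2 ∷ 3 ∷ []) (a ∷ b ∷ c ∷ []) (λ { 0F → refl ; 1F → refl ; 2F → refl }) h
    neg a b c (inj₂ (inj₁ h)) = leave (false ∷ true ∷ false ∷ false ∷ []) a c b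
      (0F ∷ 2F ∷ 1F ∷ []) (0 ∷ 3 ∷ 1 ∷ 2 ∷ []) (a ∷ b ∷ c ∷ []) (λ { 0F → refl ; 1F → refl ; 2F → refl }) h
    neg a b c (inj₂ (inj₂ h)) = leave (true ∷ true ∷ false ∷ false ∷ []) c b a
      (2F ∷ 1F ∷ 0F ∷ []) (3 ∷ 2 ∷ 0 ∷ 1 ∷ []) (a ∷ b ∷ c ∷ []) (λ { 0F → refl ; 1F → refl ; 2F → refl }) h

-- Sorting a tuple by exchanging adjacent blocks

-- A pair that is inverted between two locally similar tuples lies across a gap
-- of y: it cannot be joined by steps of length at most N.
gap : ∀ (x y : Vec ℤ n) i j → Local N x y → lookup x i < lookup x j → lookup y j < lookup y i →
  ∃ λ k → (lookup y j ≤ lookup y k × lookup y k < lookup y i) × ∀ m → lookup y k < lookup y m →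
      + N < lookup y m - lookup y k
gap {N = N} x y i j e xᵢ<xⱼ yⱼ<yᵢ with greatest reachable? (lookup y)
  where
  -- The points below i in y whose displacement from j is the same in both tuples. If a step of
  -- length at most N led on from the greatest one, it would reach either another such point or a
  -- point not below i. In the latter case i itself would keep its displacement from j, which has
  -- opposite signs in x and y.
  reachable? : ∀ k → Dec ((lookup y j ≤ lookup y k × lookup y k < lookup y i)
      × lookup x k - lookup x j ≡ lookup y k - lookup y j)
  reachable? k = (lookup y j ℤ.≤? lookup y k ×-dec lookup y k ℤ.<? lookup y i) ×-dec
      (lookup x k - lookup x j ℤ.≟ lookup y k - lookup y j)
... | inj₁ none = ⊥-elim (none j ((ℤ.≤-refl , yⱼ<yᵢ) , trans (ℤ.+-inverseʳ (lookup x j))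
    (sym (ℤ.+-inverseʳ (lookup y j)))))
... | inj₂ (k , (k-between , k-reachable) , max) = k , k-between , λ m yₖ<yₘ →
    case + N ℤ.<? lookup y m - lookup y k of λ
  { (yes far) → far
  ; (no near) → case lookup y m ℤ.<? lookup y i of λ
    { (yes yₘ<yᵢ) → ⊥-elim (ℤ.<⇒≱ yₖ<yₘ (max m
        (linear (lookup y i ∷ lookup y j ∷ lookup y k ∷ lookup y m ∷ [])
          (λ yᵢ yⱼ yₖ yₘ → yⱼ :≤ yₖ :→ yₖ :< yₘ :→ yₘ :< yᵢ :→ yⱼ :≤ yₘ :∧ yₘ :< yᵢ) (proj₁ k-between) yₖ<yₘ yₘ<yᵢ ,
         linear (+ N ∷ lookup x j ∷ lookup x k ∷ lookup x m ∷ lookup y j ∷ lookup y k ∷ lookup y m ∷ [])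
          (λ N xⱼ xₖ xₘ yⱼ yₖ yₘ → :Local N xₘ xₖ yₘ yₖ :→ yₖ :< yₘ :→ :¬ N :< yₘ :- yₖ :→ xₖ :- xⱼ :≡ yₖ :- yⱼ :→
              con 0ℤ :≤ N :→
            xₘ :- xⱼ :≡ yₘ :- yⱼ) (e m k) yₖ<yₘ near k-reachable (0≤+ N))))
    ; (no yₘ≮yᵢ) → ⊥-elim (linear (+ N ∷ lookup x i ∷ lookup x j ∷ lookup x k ∷ lookup y i ∷ lookup y j ∷ lookup y k ∷ lookup y m ∷ [])
          (λ N xᵢ xⱼ xₖ yᵢ yⱼ yₖ yₘ → :Local N xᵢ xₖ yᵢ yₖ :→ yₖ :< yᵢ :→ :¬ yₘ :< yᵢ :→ :¬ N :< yₘ :- yₖ :→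
              xₖ :- xⱼ :≡ yₖ :- yⱼ :→ con 0ℤ :≤ N :→
            yⱼ :< yᵢ :→ xᵢ :< xⱼ :→ :⊥) (e i k) (proj₂ k-between) yₘ≮yᵢ near k-reachable (0≤+ N) yⱼ<yᵢ xᵢ<xⱼ) } }

Inverted : Vec ℤ n → Vec ℤ n → Fin n → Fin n → Set
Inverted x y i j = lookup x i < lookup x j × lookup y j < lookup y i

inverted? : ∀ (x y : Vec ℤ n) i j → Dec (Inverted x y i j)
inverted? x y i j = lookup x i ℤ.<? lookup x j ×-dec lookup y j ℤ.<? lookup y i

-- The blocks of x come in the order 3, 0, 1, 2, and the order of the blocks 0
-- and 1 is wrong with respect to y.
record Exchange (N : ℕ) (x y : Vec ℤ n) : Set where
  field
    b       : Fin n → Fin 4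
    sep     : Separated N b (1 ∷ 2 ∷ 3 ∷ 0 ∷ []) x
    swapped : ∀ p q → b p ≡ 0F → b q ≡ 1F → lookup y q < lookup y p
    u l     : Fin n
    u∈0     : b u ≡ 0F
    l∈1     : b l ≡ 1F

-- The points u and l are consecutive in x, and a gap of y has l below and u above
-- it. Block 0 is the run of points above this gap that ends at u, and block 1 the
-- run of points below it that starts at l.
exchange : ∀ (x y : Vec ℤ n) i j → Local N x y → Inverted x y i j → Exchange N x y
exchange {n} {N} x y i j e (xᵢ<xⱼ , yⱼ<yᵢ) with gap x y i j e xᵢ<xⱼ yⱼ<yᵢ
... | k , (yⱼ≤yₖ , yₖ<yᵢ) , above-gap
  with greatest (λ m → lookup y k ℤ.<? lookup y m ×-dec lookup x m ℤ.<? lookup x j) (lookup x)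
...   | inj₁ none = ⊥-elim (none i (yₖ<yᵢ , xᵢ<xⱼ))
...   | inj₂ (u , (yₖ<yᵤ , xᵤ<xⱼ) , u-max)
  with least (λ m → lookup y m ℤ.≤? lookup y k ×-dec lookup x u ℤ.<? lookup x m) (lookup x)
...     | inj₁ none = ⊥-elim (none j (yⱼ≤yₖ , xᵤ<xⱼ))
...     | inj₂ (l , (yₗ≤yₖ , xᵤ<xₗ) , l-min) = record
  { b = b ; sep = sep ; swapped = swapped ; u = u ; l = l ; u∈0 = u∈0 ; l∈1 = l∈1 }
  where
  Upper Lower : Fin n → Set
  Upper m = lookup y k < lookup y m
  Lower m = lookup y m ≤ lookup y k

  -- `Before` reaches up to the last lower point under u, and `After` begins at the first upper
  -- point over l; these are the ends of the two runs.
  Before After : Fin n → Set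
  Before m = ∃ λ m′ → Lower m′ × lookup x m ≤ lookup x m′ × lookup x m′ < lookup x u
  After  m = ∃ λ m′ → Upper m′ × lookup x l < lookup x m′ × lookup x m′ ≤ lookup x m

  upper-or-lower : ∀ m → Upper m ⊎ Lower m
  upper-or-lower m with lookup y k ℤ.<? lookup y m
  ... | yes p = inj₁ p
  ... | no ¬p = inj₂ (ℤ.≮⇒≥ ¬p)

  -- The gap above k keeps the two kinds more than N apart in y, and `Local` carries this over to x,
  -- without the direction. So wherever the kind changes in x there is a gap.
  far : ∀ p q → Upper p → Lower q → Far N (lookup x p - lookup x q)
  far p q yₖ<yₚ y_q≤yₖ = linear (+ N ∷ lookup x p ∷ lookup x q ∷ lookup y p ∷ lookup y q ∷ lookup y k ∷ [])
    (λ N x x′ y y′ yₖ → :Local N x x′ y y′ :→ N :< y :- yₖ :→ y′ :≤ yₖ :→ :Far N (x :- x′))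
    (e p q) (above-gap p yₖ<yₚ) y_q≤yₖ

  Block : Fin 4 → Fin n → Set
  Block 0F m = Upper m × lookup x m ≤ lookup x u × ¬ Before m
  Block 1F m = Lower m × lookup x l ≤ lookup x m × ¬ After m
  Block 2F m = After m
  Block 3F m = Before m

  block : ∀ m → ∃ λ β → Block β m
  block m with any? (λ m′ → lookup y m′ ℤ.≤? lookup y k ×-dec lookup x m ℤ.≤? lookup x m′ ×-dec lookup x m′ ℤ.<? lookup x u)
             | any? (λ m′ → lookup y k ℤ.<? lookup y m′ ×-dec lookup x l ℤ.<? lookup x m′ ×-dec lookup x m′ ℤ.≤? lookup x m)
             | lookup x m ℤ.≤? lookup x u | upper-or-lower m
  ... | yes before | _ | _ | _ = 3F , before
  ... | no _ | yes after | _ | _ = 2F , after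
  ... | no ¬before | no _ | yes xₘ≤xᵤ | inj₁ upper = 0F , upper , xₘ≤xᵤ , ¬before
  ... | no ¬before | no _ | yes xₘ≤xᵤ | inj₂ lower = ⊥-elim (¬before (m , lower , ℤ.≤-refl ,
    linear (+ N ∷ lookup x u ∷ lookup x m ∷ []) (λ N xᵤ xₘ → con 0ℤ :≤ N :→ :Far N (xᵤ :- xₘ) :→ xₘ :≤ xᵤ :→ xₘ :< xᵤ)
      (0≤+ N) (far u m yₖ<yᵤ lower) xₘ≤xᵤ))
  ... | no _ | no ¬after | no xₘ≰xᵤ | inj₂ lower = 1F , lower , l-min m (lower , ℤ.≰⇒> xₘ≰xᵤ) , ¬after
  -- No upper point lies strictly between u and j, by the choice of u, and from j on it lies above
  -- l.
  ... | no _ | no ¬after | no xₘ≰xᵤ | inj₁ upper = ⊥-elim (case lookup x m ℤ.<? lookup x j of λ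
    { (yes xₘ<xⱼ) → xₘ≰xᵤ (u-max m (upper , xₘ<xⱼ))
    ; (no xₘ≮xⱼ) → ¬after (m , upper ,
        linear (+ N ∷ lookup x m ∷ lookup x l ∷ lookup x j ∷ [])
          (λ N xₘ xₗ xⱼ → con 0ℤ :≤ N :→ :Far N (xₘ :- xₗ) :→ :¬ xₘ :< xⱼ :→ xₗ :≤ xⱼ :→ xₗ :< xₘ)
          (0≤+ N) (far m l upper yₗ≤yₖ) xₘ≮xⱼ (l-min j (yⱼ≤yₖ , xᵤ<xⱼ)) , ℤ.≤-refl) })

  b : Fin n → Fin 4
  b m = proj₁ (block m)

  far-ul : Far N (lookup x u - lookup x l)
  far-ul = far u l yₖ<yᵤ yₗ≤yₖ

  separated : ∀ β γ p q → Block β p → Block γ q →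
    lookup (1 ∷ 2 ∷ 3 ∷ 0 ∷ []) β ℕ.< lookup (1 ∷ 2 ∷ 3 ∷ 0 ∷ []) γ → + N < lookup x q - lookup x p
  separated 3F 0F p q (m , lower , xₚ≤xₘ , xₘ<xᵤ) (upper , x_q≤xᵤ , ¬before) _ =
    linear (+ N ∷ lookup x u ∷ lookup x m ∷ lookup x p ∷ lookup x q ∷ [])
      (λ N xᵤ xₘ xₚ x_q → :Far N (x_q :- xₘ) :→ :¬ x_q :≤ xₘ :→ xₚ :≤ xₘ :→ con 0ℤ :≤ N :→ N :< x_q :- xₚ)
      (far q m upper lower) (λ x_q≤xₘ → ¬before (m , lower , x_q≤xₘ , xₘ<xᵤ)) xₚ≤xₘ (0≤+ N)
  separated 3F 1F p q (m , lower , xₚ≤xₘ , xₘ<xᵤ) (_ , xₗ≤x_q , _) _ =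
    linear (+ N ∷ lookup x u ∷ lookup x l ∷ lookup x m ∷ lookup x p ∷ lookup x q ∷ [])
      (λ N xᵤ xₗ xₘ xₚ x_q → :Far N (xᵤ :- xₗ) :→ con 0ℤ :≤ N :→ xᵤ :< xₗ :→ xₚ :≤ xₘ :→ xₘ :< xᵤ :→ xₗ :≤ x_q :→
          N :< x_q :- xₚ)
      far-ul (0≤+ N) xᵤ<xₗ xₚ≤xₘ xₘ<xᵤ xₗ≤x_q
  separated 3F 2F p q (m , lower , xₚ≤xₘ , xₘ<xᵤ) (m′ , upper , xₗ<xₘ′ , xₘ′≤x_q) _ =
    linear (+ N ∷ lookup x u ∷ lookup x l ∷ lookup x m ∷ lookup x m′ ∷ lookup x p ∷ lookup x q ∷ [])
      (λ N xᵤ xₗ xₘ xₘ′ xₚ x_q → :Far N (xᵤ :- xₗ) :→ con 0ℤ :≤ N :→ xᵤ :< xₗ :→ xₚ :≤ xₘ :→ xₘ :< xᵤ :→ xₗ :< xₘ′ :→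
          xₘ′ :≤ x_q :→
        N :< x_q :- xₚ)
      far-ul (0≤+ N) xᵤ<xₗ xₚ≤xₘ xₘ<xᵤ xₗ<xₘ′ xₘ′≤x_q
  separated 0F 1F p q (_ , xₚ≤xᵤ , _) (_ , xₗ≤x_q , _) _ =
    linear (+ N ∷ lookup x u ∷ lookup x l ∷ lookup x p ∷ lookup x q ∷ [])
      (λ N xᵤ xₗ xₚ x_q → :Far N (xᵤ :- xₗ) :→ con 0ℤ :≤ N :→ xᵤ :< xₗ :→ xₚ :≤ xᵤ :→ xₗ :≤ x_q :→ N :< x_q :- xₚ)
      far-ul (0≤+ N) xᵤ<xₗ xₚ≤xᵤ xₗ≤x_q
  separated 0F 2F p q (_ , xₚ≤xᵤ , _) (m , upper , xₗ<xₘ , xₘ≤x_q) _ =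
    linear (+ N ∷ lookup x u ∷ lookup x l ∷ lookup x m ∷ lookup x p ∷ lookup x q ∷ [])
      (λ N xᵤ xₗ xₘ xₚ x_q → :Far N (xᵤ :- xₗ) :→ con 0ℤ :≤ N :→ xᵤ :< xₗ :→ xₚ :≤ xᵤ :→ xₗ :< xₘ :→ xₘ :≤ x_q :→
          N :< x_q :- xₚ)
      far-ul (0≤+ N) xᵤ<xₗ xₚ≤xᵤ xₗ<xₘ xₘ≤x_q
  separated 1F 2F p q (lower , xₗ≤xₚ , ¬after) (m , upper , xₗ<xₘ , xₘ≤x_q) _ =
    linear (+ N ∷ lookup x l ∷ lookup x m ∷ lookup x p ∷ lookup x q ∷ [])
      (λ N xₗ xₘ xₚ x_q → :Far N (xₘ :- xₚ) :→ :¬ xₘ :≤ xₚ :→ con 0ℤ :≤ N :→ xₘ :≤ x_q :→ N :< x_q :- xₚ)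
      (far m p upper lower) (λ xₘ≤xₚ → ¬after (m , upper , xₗ<xₘ , xₘ≤xₚ)) (0≤+ N) xₘ≤x_q
  separated 0F 0F p q _ _ (ℕ.s≤s ())
  separated 0F 3F p q _ _ ()
  separated 1F 0F p q _ _ (ℕ.s≤s ())
  separated 1F 1F p q _ _ (ℕ.s≤s (ℕ.s≤s ()))
  separated 1F 3F p q _ _ ()
  separated 2F 0F p q _ _ (ℕ.s≤s ())
  separated 2F 1F p q _ _ (ℕ.s≤s (ℕ.s≤s ()))
  separated 2F 2F p q _ _ (ℕ.s≤s (ℕ.s≤s (ℕ.s≤s ())))
  separated 2F 3F p q _ _ ()
  separated 3F 3F p q _ _ ()

  sep : Separated N b (1 ∷ 2 ∷ 3 ∷ 0 ∷ []) x
  sep p q = separated (b p) (b q) p q (proj₂ (block p)) (proj₂ (block q))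

  block-of : ∀ m β → b m ≡ β → Block β m
  block-of m _ refl = proj₂ (block m)

  swapped : ∀ p q → b p ≡ 0F → b q ≡ 1F → lookup y q < lookup y p
  swapped p q p∈0 q∈1 = ℤ.≤-<-trans (proj₁ (block-of q 1F q∈1)) (proj₁ (block-of p 0F p∈0))

  u∈0 : b u ≡ 0F
  u∈0 with block u
  ... | 0F , _ = refl
  ... | 1F , lower , _ = ⊥-elim (ℤ.<⇒≱ yₖ<yᵤ lower)
  ... | 2F , m , _ , xₗ<xₘ , xₘ≤xᵤ = ⊥-elim (ℤ.<-asym xᵤ<xₗ (ℤ.<-≤-trans xₗ<xₘ xₘ≤xᵤ))
  ... | 3F , m , _ , xᵤ≤xₘ , xₘ<xᵤ = ⊥-elim (ℤ.<⇒≱ xₘ<xᵤ xᵤ≤xₘ)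

  l∈1 : b l ≡ 1F
  l∈1 with block l
  ... | 0F , upper , _ = ⊥-elim (ℤ.<⇒≱ upper yₗ≤yₖ)
  ... | 1F , _ = refl
  ... | 2F , m , _ , xₗ<xₘ , xₘ≤xₗ = ⊥-elim (ℤ.<⇒≱ xₗ<xₘ xₘ≤xₗ)
  ... | 3F , m , _ , xₗ≤xₘ , xₘ<xᵤ = ⊥-elim (ℤ.<-asym xᵤ<xₗ (ℤ.≤-<-trans xₗ≤xₘ xₘ<xᵤ))

Distinct : Vec ℕ k → Set
Distinct r = ∀ β γ → β ≡ γ ⊎ lookup r β ℕ.< lookup r γ ⊎ lookup r γ ℕ.< lookup r β

distinct? : (r : Vec ℕ k) → Dec (Distinct r)
distinct? r = all? λ β → all? λ γ → β Fin.≟ γ ⊎-dec lookup r β ℕ.<? lookup r γ ⊎-dec lookup r γ ℕ.<? lookup r β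

separated-far : ∀ (b : Fin n → Fin k) r {_ : True (distinct? r)} x → Separated N b r x →
  ∀ p q → b p ≢ b q → Far N (lookup x p - lookup x q)
separated-far {N = N} b r {r-distinct} x sep p q bp≢bq with toWitness r-distinct (b p) (b q)
... | inj₁ bp≡bq = ⊥-elim (bp≢bq bp≡bq)
... | inj₂ (inj₁ h) = linear (+ N ∷ lookup x p ∷ lookup x q ∷ []) (λ N x x′ → N :< x′ :- x :→ :Far N (x :- x′))
    (sep p q h)
... | inj₂ (inj₂ h) = inj₁ (sep q p h)

rigid-local : ∀ (b : Fin n → Fin k) r {_ : True (distinct? r)} s {_ : True (distinct? s)} x y z →
  Separated N b r x → Separated N b s z → Rigid b x z → Local N x y → Local N z y
rigid-local {N = N} b r {r-distinct} s {s-distinct} x y z x-sep z-sep rigid e p q with b p Fin.≟ b q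
... | yes bp≡bq = linear (+ N ∷ lookup x p ∷ lookup x q ∷ lookup y p ∷ lookup y q ∷ lookup z p ∷ lookup z q ∷ [])
  (λ N x x′ y y′ z z′ → x :- x′ :≡ z :- z′ :→ :Local N x x′ y y′ :→ :Local N z z′ y y′) (rigid p q bp≡bq) (e p q)
... | no bp≢bq = linear (+ N ∷ lookup x p ∷ lookup x q ∷ lookup y p ∷ lookup y q ∷ lookup z p ∷ lookup z q ∷ [])
  (λ N x x′ y y′ z z′ → :Far N (x :- x′) :→ :Far N (z :- z′) :→ :Local N x x′ y y′ :→ :Local N z z′ y y′)
  (separated-far b r {r-distinct} x x-sep p q bp≢bq) (separated-far b s {s-distinct} z z-sep p q bp≢bq) (e p q)

-- Pairs are coded as elements of `Fin (n * n)`, so that strict inclusion of finite subsets serves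
-- as the well-founded order.
inversions : Vec ℤ n → Vec ℤ n → Subset (n ℕ.* n)
inversions {n} x y = tabulate λ k → does (inverted? x y (proj₁ (remQuot {n} n k)) (proj₂ (remQuot {n} n k)))

∈-inversions⁻ : ∀ (x y : Vec ℤ n) {k} → k Subset.∈ inversions x y →
  Inverted x y (proj₁ (remQuot {n} n k)) (proj₂ (remQuot {n} n k))
∈-inversions⁻ {n} x y {k} k∈ = does⇒ (inverted? x y _ _) (trans (sym (lookup∘tabulate _ k)) ([]=⇒lookup k∈))
  where
  does⇒ : ∀ {A : Set} (A? : Dec A) → does A? ≡ true → A
  does⇒ (yes a) _ = a

∈-inversions⁺ : ∀ (x y : Vec ℤ n) {k} → Inverted x y (proj₁ (remQuot {n} n k)) (proj₂ (remQuot {n} n k)) →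
  k Subset.∈ inversions x y
∈-inversions⁺ {n} x y {k} inv = lookup⇒[]= k (inversions x y)
    (trans (lookup∘tabulate _ k) (dec-true (inverted? x y _ _) inv))

-- Apart from block 3, which stays lowest, and block 2, which stays highest, only points of block 0
-- and block 1 change their relative order. All these pairs were inverted, by `swapped`, and u, l is
-- one of them.
inversions-⊂ : ∀ (x y z : Vec ℤ n) (E : Exchange N x y) → let open Exchange E in
  Separated N b (2 ∷ 1 ∷ 3 ∷ 0 ∷ []) z → Rigid b x z → inversions z y Subset.⊂ inversions x y
inversions-⊂ {n} {N} x y z E z-sep rigid =
  (λ {k} k∈ → ∈-inversions⁺ x y (preserved _ _ (∈-inversions⁻ z y k∈))) ,
  combine u l , ∈-inversions⁺ x y (subst (λ (i , j) → Inverted x y i j) (sym (Fin.remQuot-combine u l)) inverted) ,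
  λ k∈ → destroyed (subst (λ (i , j) → Inverted z y i j) (Fin.remQuot-combine u l) (∈-inversions⁻ z y k∈))
  where
  open Exchange E

  positive : ∀ {a b} → + N < a - b → b < a
  positive {a} {b} = linear (+ N ∷ a ∷ b ∷ []) (λ N a b → con 0ℤ :≤ N :→ N :< a :- b :→ b :< a) (0≤+ N)

  inverted : Inverted x y u l
  inverted = positive (sep u l (subst₂ (λ β γ → lookup (1 ∷ 2 ∷ 3 ∷ 0 ∷ []) β ℕ.< lookup (1 ∷ 2 ∷ 3 ∷ 0 ∷ []) γ)
    (sym u∈0) (sym l∈1) (ℕ.s≤s (ℕ.s≤s z≤n)))) , swapped u l u∈0 l∈1

  destroyed : ¬ Inverted z y u l
  destroyed (zᵤ<zₗ , _) = ℤ.<-asym zᵤ<zₗ (positive (z-sep l u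
    (subst₂ (λ β γ → lookup (2 ∷ 1 ∷ 3 ∷ 0 ∷ []) β ℕ.< lookup (2 ∷ 1 ∷ 3 ∷ 0 ∷ []) γ)
      (sym l∈1) (sym u∈0) (ℕ.s≤s (ℕ.s≤s z≤n)))))

  compare : ∀ β γ → β ≡ γ ⊎ lookup (1 ∷ 2 ∷ 3 ∷ 0 ∷ []) β ℕ.< lookup (1 ∷ 2 ∷ 3 ∷ 0 ∷ []) γ ⊎
    lookup (2 ∷ 1 ∷ 3 ∷ 0 ∷ []) γ ℕ.< lookup (2 ∷ 1 ∷ 3 ∷ 0 ∷ []) β ⊎ (β ≡ 1F × γ ≡ 0F)
  compare = toWitness {a? = all? λ β → all? λ γ → β Fin.≟ γ ⊎-dec _ ℕ.<? _ ⊎-dec _ ℕ.<? _ ⊎-dec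
      (β Fin.≟ 1F ×-dec γ Fin.≟ 0F)} _

  preserved : ∀ p q → Inverted z y p q → Inverted x y p q
  preserved p q (zₚ<z_q , y_q<yₚ) with compare (b p) (b q)
  ... | inj₁ bp≡bq = linear (lookup x p ∷ lookup x q ∷ lookup z p ∷ lookup z q ∷ [])
    (λ x x′ z z′ → x :- x′ :≡ z :- z′ :→ z :< z′ :→ x :< x′) (rigid p q bp≡bq) zₚ<z_q , y_q<yₚ
  ... | inj₂ (inj₁ h) = positive (sep p q h) , y_q<yₚ
  ... | inj₂ (inj₂ (inj₁ h)) = ⊥-elim (ℤ.<-asym zₚ<z_q (positive (z-sep q p h)))
  ... | inj₂ (inj₂ (inj₂ (p∈1 , q∈0))) = ⊥-elim (ℤ.<-asym y_q<yₚ (swapped q p q∈0 p∈1))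

ordered⇒cyclic : ∀ (x y : Vec ℤ n) → Ordered N x y → Cyclic N x y
ordered⇒cyclic x y e = replicate _ false , ordered⇒aligned x y e

uninverted⇒ordered : ∀ (x y : Vec ℤ n) → Local N x y → (∀ i j → ¬ Inverted x y i j) → Ordered N x y
uninverted⇒ordered {N = N} x y e none i j = linear (+ N ∷ lookup x i ∷ lookup x j ∷ lookup y i ∷ lookup y j ∷ [])
  (λ N x x′ y y′ → con 0ℤ :≤ N :→ :Local N x x′ y y′ :→ :¬ (x :< x′ :∧ y′ :< y) :→ :¬ (x′ :< x :∧ y :< y′) :→ :Same N
      (x :- x′) (y :- y′))
  (0≤+ N) (e i j) (none i j) (none j i)

module Classical (em : ∀ (A : Set) → Dec A) where

  -- Without inversions x and y would be `Ordered`-equivalent, against R x and ¬ R y. Otherwise an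
  -- exchange is made; if R survives it, the search goes on from the new tuple, which has fewer
  -- inversions.
  find-swap : {R : Relation ℤ n} → Invariant (Cyclic N) R → ∀ x y → Local N x y → R x → ¬ R y → Swap N R
  find-swap {n} {N} {R} R-inv x y e r ¬Ry = search x e r (⊂-wellFounded (inversions x y))
    where
    search : ∀ x → Local N x y → R x → Acc Subset._⊂_ (inversions x y) → Swap N R
    search x e r (acc rec) with any? (λ i → any? (λ j → inverted? x y i j))
    ... | no none = ⊥-elim (¬Ry (R-inv x y (ordered⇒cyclic x y
      (uninverted⇒ordered x y e (λ i j p → none (i , j , p)))) r))
    ... | yes (i , j , inv) = decide (em (R z))
      where
      E : Exchange N x y
      E = exchange x y i j e inv

      open Exchange E

      K : ℕ
      K = proj₁ (bounded x)

      arrange : Vec ℕ 4 → Vec ℤ n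
      arrange = spread N K x b

      arranged : ∀ r → Separated N b r (arrange r)
      arranged r = spread-separated N K x b r (proj₂ (bounded x))

      -- `original` and `first`, and likewise `last` and `exchanged`, differ by a rotation that
      -- takes block 3 from the bottom to the top, as `Swap` requires; R does not notice it.
      original first exchanged last : Vec ℕ 4
      original  = 1 ∷ 2 ∷ 3 ∷ 0 ∷ []
      first     = 0 ∷ 1 ∷ 2 ∷ 3 ∷ []
      exchanged = 1 ∷ 0 ∷ 2 ∷ 3 ∷ []
      last      = 2 ∷ 1 ∷ 3 ∷ 0 ∷ []

      z : Vec ℤ n
      z = arrange last

      decide : Dec (R z) → Swap N R
      decide (yes Rz) = search z
        (rigid-local b original last x y z sep (arranged last) (rigid-spread N K x b last) e) Rz
        (rec (inversions-⊂ x y z E (arranged last) (rigid-spread N K x b last)))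
      decide (no ¬Rz) = record
        { b = b
        ; x = arrange first
        ; z = arrange exchanged
        ; x-sep = arranged first
        ; z-sep = arranged exchanged
        ; rigid = spread-rigid N K x b first exchanged
        ; holds = R-inv x (arrange first)
            (rotate-blocks b (true ∷ true ∷ true ∷ false ∷ []) original first x (arrange first)
              sep (arranged first) (rigid-spread N K x b first)) r
        ; fails = λ Rz′ → ¬Rz (R-inv (arrange exchanged) z
            (rotate-blocks b (false ∷ false ∷ false ∷ true ∷ []) exchanged last (arrange exchanged) z
              (arranged exchanged) (arranged last) (spread-rigid N K x b exchanged last)) Rz′)
        }

-- Similarity from agreement on finitely many atoms

near-difference : ∀ N (x y : Vec ℤ n) →
  (∀ i j k → k ℕ.≤ N → lookup x i ≡ lookup x j + + k → lookup y i ≡ lookup y j + + k) →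
  ∀ i j → Near N (lookup x i - lookup x j) → lookup x i - lookup x j ≡ lookup y i - lookup y j
near-difference N x y h i j (p , q) = go (lookup x i - lookup x j) refl p q
  where
  go : ∀ d → lookup x i - lookup x j ≡ d → - + N ≤ d → d ≤ + N → lookup x i - lookup x j ≡ lookup y i - lookup y j
  go (+ k) e _ k≤N = linear (+ k ∷ lookup x i ∷ lookup x j ∷ lookup y i ∷ lookup y j ∷ [])
    (λ k x x′ y y′ → x :- x′ :≡ k :→ y :≡ y′ :+ k :→ x :- x′ :≡ y :- y′) e
    (h i j k (ℤ.drop‿+≤+ k≤N) (linear (+ k ∷ lookup x i ∷ lookup x j ∷ []) (λ k x x′ → x :- x′ :≡ k :→ x :≡ x′ :+ k)
        e))
  go -[1+ k ] e -N≤d _ = linear (+ suc k ∷ lookup x i ∷ lookup x j ∷ lookup y i ∷ lookup y j ∷ [])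
    (λ k x x′ y y′ → x :- x′ :≡ :- k :→ y′ :≡ y :+ k :→ x :- x′ :≡ y :- y′) e
    (h j i (suc k) (ℤ.drop‿+≤+ (linear (+ N ∷ + suc k ∷ []) (λ N k → :- N :≤ :- k :→ k :≤ N) -N≤d))
      (linear (+ suc k ∷ lookup x i ∷ lookup x j ∷ []) (λ k x x′ → x :- x′ :≡ :- k :→ x′ :≡ x :+ k) e))

local-from-differences : ∀ N (x y : Vec ℤ n) →
  (∀ i j k → k ℕ.≤ N → (lookup x i ≡ lookup x j + + k) ⇔ (lookup y i ≡ lookup y j + + k)) → Local N x y
local-from-differences {n} N x y h i j with near? N (lookup x i - lookup x j) | near? N (lookup y i - lookup y j)
... | yes p | _     = inj₁ (near-difference N x y (λ i j k k≤N → to (h i j k k≤N)) i j p)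
... | no _  | yes q = inj₁ (sym (near-difference N y x (λ i j k k≤N → from (h i j k k≤N)) i j q))
... | no ¬p | no ¬q = inj₂ (not-near ¬p , not-near ¬q)
  where
  not-near : ∀ {a} → ¬ Near N a → Far N a
  not-near {a} = linear (+ N ∷ a ∷ []) λ N a → :¬ :Near N a :→ :Far N a

-- Cutting y just below the image of a least point of x turns its order into that of x.
cyclic-from-cycles : ∀ N (x y : Vec ℤ n) → Local N x y →
  (∀ i j k → cycle (lookup y i ∷ lookup y j ∷ lookup y k ∷ []) → cycle (lookup x i ∷ lookup x j ∷ lookup x k ∷ [])) →
  Cyclic N x y
cyclic-from-cycles {n} N x y e h with least (λ i → yes tt) (lookup x)
... | inj₁ empty = replicate n false , λ i → ⊥-elim (empty i tt)
... | inj₂ (o , _ , min) = tabulate low , aligned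
  where
  low? : ∀ i → Dec (lookup y i < lookup y o)
  low? i = lookup y i ℤ.<? lookup y o

  low : Fin n → Bool
  low i = does (low? i)

  ρ : ∀ p q → Vec ℤ 7
  ρ p q = + N ∷ lookup x o ∷ lookup x p ∷ lookup x q ∷ lookup y o ∷ lookup y p ∷ lookup y q ∷ []

  f : Bool → Bool → N-ary 7 7
  f b b′ N xₒ xₚ x_q yₒ yₚ y_q = con 0ℤ :≤ N :→ xₒ :≤ xₚ :→ xₒ :≤ x_q :→
    :Local N xₒ xₚ yₒ yₚ :→ :Local N xₒ x_q yₒ y_q :→ :Local N xₚ x_q yₚ y_q :→
    side b yₚ :→ side b′ y_q :→
    (:cycle yₒ yₚ y_q :→ :cycle xₒ xₚ x_q) :→ (:cycle yₒ y_q yₚ :→ :cycle xₒ x_q xₚ) :→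
    :Align b b′ N xₚ x_q yₚ y_q
    where
    side : Bool → Term 7 → Arith 7
    side true  y = y :< yₒ
    side false y = :¬ y :< yₒ

  aligned : Aligned N (tabulate low) x y
  aligned p q rewrite lookup∘tabulate low p | lookup∘tabulate low q with low? p | low? q
  ... | yes a | yes b = linear (ρ p q) (f true true) (0≤+ N) (min p tt) (min q tt) (e o p) (e o q) (e p q) a b
      (h o p q) (h o q p)
  ... | yes a | no  b = linear (ρ p q) (f true false) (0≤+ N) (min p tt) (min q tt) (e o p) (e o q) (e p q) a b
      (h o p q) (h o q p)
  ... | no  a | yes b = linear (ρ p q) (f false true) (0≤+ N) (min p tt) (min q tt) (e o p) (e o q) (e p q) a b
      (h o p q) (h o q p)
  ... | no  a | no  b = linear (ρ p q) (f false false) (0≤+ N) (min p tt) (min q tt) (e o p) (e o q) (e p q) a b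
      (h o p q) (h o q p)

module Definability (em : ∀ (A : Set) → Dec A) {ℓ} {V : RelationSet ℤ ℓ} (V-space : IsDefinabilitySpace V)
                    (+1∈V : relation +1 ∈ V) where
  open Closure V-space
  open Shifts V-space
  open Refinement em V-space
  open Classical em

  module Atoms (n N : ℕ) where

    differences : List (Fin n × Fin n × ℕ)
    differences = List.cartesianProduct (List.allFin n) (List.cartesianProduct (List.allFin n) (List.upTo (suc N)))

    ∈-differences : ∀ i j {k} → k ℕ.≤ N → (i , j , k) List.∈ differences
    ∈-differences i j k≤N = List.∈-cartesianProduct⁺ (List.∈-allFin i)
      (List.∈-cartesianProduct⁺ (List.∈-allFin j) (List.∈-upTo⁺ (ℕ.s≤s k≤N)))

    triples : List (Fin n × Fin n × Fin n)
    triples = List.cartesianProduct (List.allFin n) (List.cartesianProduct (List.allFin n) (List.allFin n))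

    ∈-triples : ∀ i j k → (i , j , k) List.∈ triples
    ∈-triples i j k = List.∈-cartesianProduct⁺ (List.∈-allFin i)
      (List.∈-cartesianProduct⁺ (List.∈-allFin j) (List.∈-allFin k))

    Difference : Fin n × Fin n × ℕ → Relation ℤ n
    Difference (i , j , k) v = lookup v i ≡ lookup v j + + k

    difference∈ : ∀ a → (n , Difference a) ∈ V
    difference∈ (i , j , k) = substitute (i ∷ j ∷ []) (shift-ℕ +1∈V k)

    Cycle : Fin n × Fin n × Fin n → Relation ℤ n
    Cycle (i , j , k) v = cycle (lookup v i ∷ lookup v j ∷ lookup v k ∷ [])

  local-definable : {R : Relation ℤ n} → Invariant (Local N) R → (n , R) ∈ V
  local-definable {n} {N} R-inv = boolean-combination differences Difference difference∈ λ x y x~y →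
    R-inv x y (local-from-differences N x y λ i j k k≤N → ListAll.lookup x~y (∈-differences i j k≤N))
    where open Atoms n N

  cyclic-definable : relation C ∈ V → {R : Relation ℤ n} → Invariant (Cyclic N) R → (n , R) ∈ V
  cyclic-definable {n} {N} C∈V R-inv = boolean-combination
    (List.map inj₁ differences List.++ List.map inj₂ triples) [ Difference , Cycle ]′
    [ difference∈ , (λ (i , j , k) → substitute (i ∷ j ∷ k ∷ []) C∈V) ] λ x y x~y →
    R-inv x y (cyclic-from-cycles N x y
      (local-from-differences N x y λ i j k k≤N →
        ListAll.lookup x~y (List.∈-++⁺ˡ (List.∈-map⁺ inj₁ (∈-differences i j k≤N))))
      λ i j k → from (ListAll.lookup x~y (List.∈-++⁺ʳ (List.map inj₁ differences)
          (List.∈-map⁺ inj₂ (∈-triples i j k)))))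
    where open Atoms n N

  order-or-cyclic : {R : Relation ℤ n} → (n , R) ∈ V → Invariant (Ordered N) R →
    relation Ord ∈ V ⊎ Invariant (Cyclic N) R
  order-or-cyclic {n} {N} {R} R∈V R-inv with em (∃ λ x → ∃ λ y → Cyclic N x y × R x × ¬ R y)
  ... | yes (x , y , e , r , ¬r) = inj₁ (order-from-noncyclic V-space +1∈V R∈V R-inv x y e r ¬r)
  ... | no none = inj₂ λ x y e r → decidable-stable (em (R y)) λ ¬r → none (x , y , e , r , ¬r)

  cycle-or-local : {R : Relation ℤ n} → (n , R) ∈ V → Invariant (Cyclic N) R →
    relation C ∈ V ⊎ Invariant (Local N) R
  cycle-or-local {n} {N} {R} R∈V R-inv with em (∃ λ x → ∃ λ y → Local N x y × R x × ¬ R y)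
  ... | yes (x , y , e , r , ¬r) = inj₁ (cycle-from-swap V-space +1∈V R∈V R-inv (find-swap R-inv x y e r ¬r))
  ... | no none = inj₂ λ x y e r → decidable-stable (em (R y)) λ ¬r → none (x , y , e , r , ¬r)

-- A relation that is not flip-invariant orients the adjacent pairs

-- For adjacent a and b this is z = a + k (b - a), that is, k steps from a towards b.
Directed : ℤ → Relation ℤ 3
Directed k (z ∷ a ∷ b ∷ []) = (b ≡ a + 1ℤ × z ≡ a + k) ⊎ (a ≡ b + 1ℤ × z ≡ a - k)

:directed : Term n → (z a b : Term n) → Arith n
:directed k z a b = (:successor a b :∧ z :≡ a :+ k) :∨ (:successor b a :∧ z :≡ a :- k)

module _ {ℓ} {V : RelationSet ℤ ℓ} (V-space : IsDefinabilitySpace V) (A₁₁∈V : relation A₁₁ ∈ V) where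
  open Closure V-space
  open Shifts V-space

  directed-ℕ : ∀ k → (3 , Directed (+ k)) ∈ V × (3 , Directed (- + k)) ∈ V
  directed-ℕ zero = both , both
    where
    both : (3 , Directed 0ℤ) ∈ V
    both = closed (_ ∷ []) (A₁₁∈V ∷ []) ((0F ≈ᶠ 1F) ∧ᶠ atom 0F (1F ∷ 2F ∷ 1F ∷ 2F ∷ []) ,
      (λ { {z ∷ a ∷ b ∷ []} d →
        linear (z ∷ a ∷ b ∷ []) (λ z a b → :directed (con 0ℤ) z a b :→ z :≡ a) d ,
        from (codirection₁-⇔ a b a b) (linear (z ∷ a ∷ b ∷ [])
            (λ z a b → :directed (con 0ℤ) z a b :→ :codirected a b a b) d) }) ,
      (λ { {z ∷ a ∷ b ∷ []} (e , c) → linear (z ∷ a ∷ b ∷ [])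
        (λ z a b → z :≡ a :→ :codirected a b a b :→ :directed (con 0ℤ) z a b) e (to (codirection₁-⇔ a b a b) c) }))
  directed-ℕ (suc k) =
    closed (_ ∷ _ ∷ []) (proj₁ (directed-ℕ k) ∷ A₁₁∈V ∷ [])
      (∃ᶠ (atom 0F (0F ∷ 2F ∷ 3F ∷ []) ∧ᶠ atom 1F (0F ∷ 1F ∷ 2F ∷ 3F ∷ [])) ,
      (λ { {z ∷ a ∷ b ∷ []} (inj₁ (p , q)) → z - 1ℤ ,
             linear (ρ z a b) (λ k z a b → :successor a b :→ z :≡ a :+ (con 1ℤ :+ k) :→ :directed k (z :- con 1ℤ)
                 a b) p q ,
             from (codirection₁-⇔ (z - 1ℤ) z a b) (linear (ρ z a b)
                 (λ k z a b → :successor a b :→ :codirected (z :- con 1ℤ) z a b) p)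
         ; {z ∷ a ∷ b ∷ []} (inj₂ (p , q)) → z + 1ℤ ,
             linear (ρ z a b) (λ k z a b → :successor b a :→ z :≡ a :- (con 1ℤ :+ k) :→ :directed k (z :+ con 1ℤ)
                 a b) p q ,
             from (codirection₁-⇔ (z + 1ℤ) z a b) (linear (ρ z a b)
                 (λ k z a b → :successor b a :→ :codirected (z :+ con 1ℤ) z a b) p) }) ,
      (λ { {z ∷ a ∷ b ∷ []} (w , d , c) → linear (+ k ∷ z ∷ a ∷ b ∷ w ∷ [])
             (λ k z a b w → :directed k w a b :→ :codirected w z a b :→ :directed (con 1ℤ :+ k) z a b) d
                 (to (codirection₁-⇔ w z a b) c) })) ,
    closed (_ ∷ _ ∷ []) (proj₂ (directed-ℕ k) ∷ A₁₁∈V ∷ [])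
      (∃ᶠ (atom 0F (0F ∷ 2F ∷ 3F ∷ []) ∧ᶠ atom 1F (1F ∷ 0F ∷ 2F ∷ 3F ∷ [])) ,
      (λ { {z ∷ a ∷ b ∷ []} (inj₁ (p , q)) → z + 1ℤ ,
             linear (ρ z a b) (λ k z a b → :successor a b :→ z :≡ a :+ :- (con 1ℤ :+ k) :→ :directed (:- k)
                 (z :+ con 1ℤ) a b) p q ,
             from (codirection₁-⇔ z (z + 1ℤ) a b) (linear (ρ z a b)
                 (λ k z a b → :successor a b :→ :codirected z (z :+ con 1ℤ) a b) p)
         ; {z ∷ a ∷ b ∷ []} (inj₂ (p , q)) → z - 1ℤ ,
             linear (ρ z a b) (λ k z a b → :successor b a :→ z :≡ a :- :- (con 1ℤ :+ k) :→ :directed (:- k)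
                 (z :- con 1ℤ) a b) p q ,
             from (codirection₁-⇔ z (z - 1ℤ) a b) (linear (ρ z a b)
                 (λ k z a b → :successor b a :→ :codirected z (z :- con 1ℤ) a b) p) }) ,
      (λ { {z ∷ a ∷ b ∷ []} (w , d , c) → linear (+ k ∷ z ∷ a ∷ b ∷ w ∷ [])
             (λ k z a b w → :directed (:- k) w a b :→ :codirected z w a b :→ :directed (:- (con 1ℤ :+ k)) z a b) d
                 (to (codirection₁-⇔ z w a b) c) }))
    where
    ρ : ∀ z a b → Vec ℤ 4
    ρ z a b = + k ∷ z ∷ a ∷ b ∷ []

  directed∈ : ∀ k → (3 , Directed k) ∈ V
  directed∈ (+ k)    = proj₁ (directed-ℕ k)
  directed∈ -[1+ k ] = proj₂ (directed-ℕ (suc k))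

  -- A copy of x is laid out from a in the direction of the adjacent point b.
  successor-from-flip : {R : Relation ℤ n} → (n , R) ∈ V → Invariant (Ordered N) R →
    ∀ x → R x → ¬ R (map -_ x) → relation +1 ∈ V
  successor-from-flip {n} {N} {R} R∈V R-inv x r ¬r =
    closed (_ ∷ _ ∷ []) (A₁₁∈V ∷ compose-closed (λ i → Directed (lookup x i)) R∈V (directed∈ ∘ lookup x) ∷ [])
      (atom 0F (0F ∷ 1F ∷ 0F ∷ 1F ∷ []) ∧ᶠ atom 1F (0F ∷ 1F ∷ []) ,
      (λ { {a ∷ b ∷ []} b≡a+1 → from (codirection₁-⇔ a b a b) (inj₁ (b≡a+1 , b≡a+1)) ,
           map (λ z → a + z) x , R-inv x _ (translated a) r ,
           λ i → inj₁ (b≡a+1 , lookup-map i (λ z → a + z) x) }) ,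
      (λ { {a ∷ b ∷ []} (c , w , Rw , d) → case to (codirection₁-⇔ a b a b) c of λ
           { (inj₁ (b≡a+1 , _)) → b≡a+1
           ; (inj₂ (a≡b+1 , _)) → ⊥-elim (¬r (R-inv w _ (reflected a b w a≡b+1 d) Rw)) } }))
    where
    translated : ∀ a → Ordered N x (map (λ z → a + z) x)
    translated a i j rewrite lookup-map i (λ z → a + z) x | lookup-map j (λ z → a + z) x =
      linear (+ N ∷ a ∷ lookup x i ∷ lookup x j ∷ []) λ N a x x′ → :Same N (x :- x′) (a :+ x :- (a :+ x′))

    reflected : ∀ a b w → a ≡ b + 1ℤ → (∀ i → Directed (lookup x i) (lookup w i ∷ a ∷ b ∷ [])) → Ordered N w
        (map -_ x)
    reflected a b w a≡b+1 d i j rewrite lookup-map i -_ x | lookup-map j -_ x =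
      linear (+ N ∷ a ∷ b ∷ lookup x i ∷ lookup x j ∷ lookup w i ∷ lookup w j ∷ [])
        (λ N a b x x′ w w′ → :successor b a :→ :directed x w a b :→ :directed x′ w′ a b :→ :Same N (w :- w′)
            (:- x :- :- x′))
        a≡b+1 (d i) (d j)

-- Inclusions between the six spaces

generated-⊆ : ∀ {ℓ} {V : RelationSet ℤ ℓ} → IsDefinabilitySpace V → {G : ∃ (Relation ℤ)} → G ∈ V → ⟨ G ⟩ ⊆ V
generated-⊆ {V = V} V-space {G} G∈V = V-space (λ _ → G) (λ _ → G∈V) ∘
  DefinableFrom-⊆ {G = λ (_ : Fin 1) → G} (λ _ → DefinableFrom-generator (λ (_ : Fin 1) → G) 0F)

space-isDefinabilitySpace : ∀ s → IsDefinabilitySpace (space s)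
space-isDefinabilitySpace s = DefinableFrom-isDefinabilitySpace (λ _ → relation s)

generator∈ : ∀ s → relation s ∈ space s
generator∈ s = DefinableFrom-generator (λ _ → relation s) tt

edge∈ : ∀ {s t} → s ⟶ t → relation s ∈ space t
edge∈ A₁₁⟶+1 = codirection₁∈⟨+1⟩
edge∈ A₁₁⟶S  = codirection₁∈⟨separation⟩
edge∈ S⟶B    = separation∈⟨between⟩
edge∈ S⟶C    = separation∈⟨cycle⟩
edge∈ +1⟶C   = successor∈⟨cycle⟩
edge∈ B⟶Ord  = between∈⟨<⟩
edge∈ C⟶Ord  = cycle∈⟨<⟩

star∈ : ∀ {s t} → Star _⟶_ s t → relation s ∈ space t
star∈ {s} ε = generator∈ s
star∈ {t = t} (e ◅ es) = generated-⊆ (space-isDefinabilitySpace t) (star∈ es) (edge∈ e)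

star-⊆ : ∀ {s t} → Star _⟶_ s t → space s ⊆ space t
star-⊆ {t = t} es = generated-⊆ (space-isDefinabilitySpace t) (star∈ es)

bottom : ∀ s → Star _⟶_ A₁₁ s
bottom A₁₁ = ε
bottom +1  = A₁₁⟶+1 ◅ ε
bottom S   = A₁₁⟶S ◅ ε
bottom B   = A₁₁⟶S ◅ S⟶B ◅ ε
bottom C   = A₁₁⟶S ◅ S⟶C ◅ ε
bottom Ord = A₁₁⟶S ◅ S⟶B ◅ B⟶Ord ◅ ε

top : ∀ s → Star _⟶_ s Ord
top A₁₁ = bottom Ord
top +1  = +1⟶C ◅ C⟶Ord ◅ ε
top S   = S⟶B ◅ B⟶Ord ◅ ε
top B   = B⟶Ord ◅ ε
top C   = C⟶Ord ◅ ε
top Ord = ε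

-- All non-inclusions follow from these three.
data _∤_ : Name → Name → Set where
  +1∤B : +1 ∤ B
  S∤+1 : S ∤ +1
  B∤C  : B ∤ C

∤⇒∉ : ∀ {p q} → p ∤ q → ¬ (relation p ∈ space q)
∤⇒∉ +1∤B = successor∉⟨between⟩
∤⇒∉ S∤+1 = separation∉⟨+1⟩
∤⇒∉ B∤C  = between∉⟨cycle⟩

⊈-between : ∀ {p q s t} → p ∤ q → Star _⟶_ p s → Star _⟶_ t q → ¬ (space s ⊆ space t)
⊈-between p∤q p⟶s t⟶q s⊆t = ∤⇒∉ p∤q (star-⊆ t⟶q (s⊆t (star∈ p⟶s)))

inclusion? : ∀ s t → Star _⟶_ s t ⊎ ¬ (space s ⊆ space t)
inclusion? A₁₁ t   = inj₁ (bottom t)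
inclusion? s   Ord = inj₁ (top s)
inclusion? +1  A₁₁ = inj₂ (⊈-between +1∤B ε (bottom B))
inclusion? +1  +1  = inj₁ ε
inclusion? +1  S   = inj₂ (⊈-between +1∤B ε (S⟶B ◅ ε))
inclusion? +1  B   = inj₂ (⊈-between +1∤B ε ε)
inclusion? +1  C   = inj₁ (+1⟶C ◅ ε)
inclusion? S   A₁₁ = inj₂ (⊈-between S∤+1 ε (bottom +1))
inclusion? S   +1  = inj₂ (⊈-between S∤+1 ε ε)
inclusion? S   S   = inj₁ ε
inclusion? S   B   = inj₁ (S⟶B ◅ ε)
inclusion? S   C   = inj₁ (S⟶C ◅ ε)
inclusion? B   A₁₁ = inj₂ (⊈-between B∤C ε (bottom C))
inclusion? B   +1  = inj₂ (⊈-between B∤C ε (+1⟶C ◅ ε))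
inclusion? B   S   = inj₂ (⊈-between B∤C ε (S⟶C ◅ ε))
inclusion? B   B   = inj₁ ε
inclusion? B   C   = inj₂ (⊈-between B∤C ε ε)
inclusion? C   A₁₁ = inj₂ (⊈-between +1∤B (+1⟶C ◅ ε) (bottom B))
inclusion? C   +1  = inj₂ (⊈-between S∤+1 (S⟶C ◅ ε) ε)
inclusion? C   S   = inj₂ (⊈-between +1∤B (+1⟶C ◅ ε) (S⟶B ◅ ε))
inclusion? C   B   = inj₂ (⊈-between +1∤B (+1⟶C ◅ ε) ε)
inclusion? C   C   = inj₁ ε
inclusion? Ord A₁₁ = inj₂ (⊈-between +1∤B (top +1) (bottom B))
inclusion? Ord +1  = inj₂ (⊈-between S∤+1 (top S) ε)
inclusion? Ord S   = inj₂ (⊈-between B∤C (top B) (S⟶C ◅ ε))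
inclusion? Ord B   = inj₂ (⊈-between +1∤B (top +1) ε)
inclusion? Ord C   = inj₂ (⊈-between B∤C (top B) ε)

inclusion⇒star : ∀ s t → space s ⊆ space t → Star _⟶_ s t
inclusion⇒star s t s⊆t with inclusion? s t
... | inj₁ es  = es
... | inj₂ s⊈t = ⊥-elim (s⊈t s⊆t)

-- The height in the diagram of inclusions; paths in both directions are possible only between equal
-- names.
rank : Name → ℕ
rank A₁₁ = 0
rank +1  = 1
rank S   = 1
rank B   = 2
rank C   = 2
rank Ord = 3

edge-rank : ∀ {s t} → s ⟶ t → rank s ℕ.< rank t
edge-rank A₁₁⟶+1 = ℕ.≤-refl
edge-rank A₁₁⟶S  = ℕ.≤-refl
edge-rank S⟶B    = ℕ.≤-refl
edge-rank S⟶C    = ℕ.≤-refl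
edge-rank +1⟶C   = ℕ.≤-refl
edge-rank B⟶Ord  = ℕ.≤-refl
edge-rank C⟶Ord  = ℕ.≤-refl

star-rank : ∀ {s t} → Star _⟶_ s t → s ≡ t ⊎ rank s ℕ.< rank t
star-rank ε = inj₁ refl
star-rank (e ◅ es) with star-rank es
... | inj₁ refl = inj₂ (edge-rank e)
... | inj₂ t<u  = inj₂ (ℕ.<-trans (edge-rank e) t<u)

edge-⊂ : ∀ {s t} → s ⟶ t → space s ⊂ space t
edge-⊂ {s} {t} e = star-⊆ (e ◅ ε) , λ t⊆s → case star-rank (inclusion⇒star t s t⊆s) of λ
  { (inj₁ refl) → ℕ.<-irrefl refl (edge-rank e)
  ; (inj₂ t<s)  → ℕ.<-asym t<s (edge-rank e) }

spaces-distinct : ∀ s t → s ≢ t → ¬ (space s ≐ space t)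
spaces-distinct s t s≢t (s⊆t , t⊆s) with star-rank (inclusion⇒star s t s⊆t) | star-rank (inclusion⇒star t s t⊆s)
... | inj₁ s≡t | _        = s≢t s≡t
... | inj₂ _   | inj₁ t≡s = s≢t (sym t≡s)
... | inj₂ s<t | inj₂ t<s = ℕ.<-asym s<t t<s

-- Classification

codirection₁-flipInvariant : FlipInvariant codirection₁
codirection₁-flipInvariant = ⟨between⟩-flipInvariant (star∈ (bottom B))

separation-flipInvariant : FlipInvariant separation
separation-flipInvariant = ⟨between⟩-flipInvariant separation∈⟨between⟩

module Classification {ℓ} (em : ExcludedMiddle (Level.suc ℓ)) {V : RelationSet ℤ ℓ} (V-space : IsDefinabilitySpace V)
                      (A₁₁⊆V : space A₁₁ ⊆ V) (V⊆Ord : V ⊆ space Ord) where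

  em₁ : (A : Set (Level.suc 0ℓ ⊔ ℓ)) → Dec A
  em₁ A = map′ Level.lower Level.lift (em {Lift (Level.suc ℓ) A})

  em₀ : (A : Set) → Dec A
  em₀ A = map′ Level.lower Level.lift (em₁ (Lift _ A))

  emℓ : (A : Set ℓ) → Dec A
  emℓ A = map′ Level.lower Level.lift (em₁ (Lift (Level.suc 0ℓ) A))

  -- W is V itself if V contains the successor, and otherwise the space generated by the successor
  -- and a single R ∈ V.
  trichotomy : ∀ {ℓ′} {W : RelationSet ℤ ℓ′} → IsDefinabilitySpace W → relation +1 ∈ W →
    ∀ {R : ∃ (Relation ℤ)} → R ∈ W → R ∈ space Ord → relation Ord ∈ W ⊎ (R ∈ space C × relation C ∈ W) ⊎ R ∈ space +1
  trichotomy W-space +1∈W R∈W R∈Ord =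
    let N , R-ordered = BackAndForth.definable-invariant order-game R∈Ord
        open Definability em₀ W-space +1∈W in
    case order-or-cyclic R∈W R-ordered of λ
      { (inj₁ Ord∈W)   → inj₁ Ord∈W
      ; (inj₂ R-cyclic) → inj₂ (case cycle-or-local R∈W R-cyclic of λ
          { (inj₁ C∈W)     → inj₁ (Definability.cyclic-definable em₀ (space-isDefinabilitySpace C) successor∈⟨cycle⟩
              (generator∈ C) R-cyclic , C∈W)
          ; (inj₂ R-local) → inj₂ (Definability.local-definable em₀ (space-isDefinabilitySpace +1) (generator∈ +1)
              R-local) }) }

  between-spaces : ∀ s → relation s ∈ V → (∀ {R} → R ∈ V → R ∈ space s) → V ≐ space s
  between-spaces s s∈V V⊆s = V⊆s , generated-⊆ V-space s∈V

  with-successor : relation +1 ∈ V → ∃ λ s → V ≐ space s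
  with-successor +1∈V with emℓ (relation Ord ∈ V) | emℓ (relation C ∈ V)
  ... | yes Ord∈V | _       = Ord , between-spaces Ord Ord∈V V⊆Ord
  ... | no Ord∉V  | yes C∈V = C , between-spaces C C∈V λ R∈V → case trichotomy V-space +1∈V R∈V (V⊆Ord R∈V) of λ
    { (inj₁ Ord∈V)             → ⊥-elim (Ord∉V Ord∈V)
    ; (inj₂ (inj₁ (R∈C , _))) → R∈C
    ; (inj₂ (inj₂ R∈+1))      → star-⊆ (+1⟶C ◅ ε) R∈+1 }
  ... | no Ord∉V  | no C∉V  = +1 , between-spaces +1 +1∈V λ R∈V → case trichotomy V-space +1∈V R∈V (V⊆Ord R∈V) of λ
    { (inj₁ Ord∈V)             → ⊥-elim (Ord∉V Ord∈V)
    ; (inj₂ (inj₁ (_ , C∈V))) → ⊥-elim (C∉V C∈V)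
    ; (inj₂ (inj₂ R∈+1))      → R∈+1 }

  A₁₁∈V : relation A₁₁ ∈ V
  A₁₁∈V = A₁₁⊆V (generator∈ A₁₁)

  module _ (+1∉V : ¬ (relation +1 ∈ V)) where

    V-flipInvariant : ∀ {R : ∃ (Relation ℤ)} → R ∈ V → FlipInvariant (proj₂ R)
    V-flipInvariant {R} R∈V x r = decidable-stable (em₀ _) λ ¬r →
      let N , R-ordered = BackAndForth.definable-invariant order-game (V⊆Ord R∈V) in
      +1∉V (successor-from-flip V-space A₁₁∈V R∈V R-ordered x r ¬r)

    Oriented : ∃ (Relation ℤ) → RelationSet ℤ 0ℓ
    Oriented R = DefinableFrom (lookup (R ∷ relation +1 ∷ []))

    -- V consists of the flip-invariant relations definable from V and the
    -- successor, so that it is determined by a space that contains the successor.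
    unoriented : ∀ {R Q : ∃ (Relation ℤ)} → R ∈ V → FlipInvariant (proj₂ Q) → Q ∈ Oriented R → Q ∈ V
    unoriented {R} R∈V Q-flip Q∈ = V-space (lookup (R ∷ relation A₁₁ ∷ [])) (λ { 0F → R∈V ; 1F → A₁₁∈V })
      (unflip R (V-flipInvariant R∈V) Q-flip Q∈)

    -- A definition of R from t becomes one from s and the successor, and `unflip` trades the
    -- successor for A₁₁, which s defines.
    flip-part : ∀ s t → relation t ∈ Oriented (relation s) → FlipInvariant (proj₂ (relation s)) →
      ∀ {R} → R ∈ V → R ∈ space t → R ∈ space s
    flip-part s t t∈ s-flip {R} R∈V R∈t = DefinableFrom-⊆ {F = lookup (relation s ∷ relation A₁₁ ∷ [])}
      (λ { 0F → generator∈ s ; 1F → star∈ (bottom s) })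
      (unflip (relation s) s-flip (V-flipInvariant R∈V) (DefinableFrom-⊆ (λ _ → t∈) R∈t))

    trichotomy′ : ∀ {R : ∃ (Relation ℤ)} → R ∈ V →
      relation Ord ∈ Oriented R ⊎ (R ∈ space C × relation C ∈ Oriented R) ⊎ R ∈ space +1
    trichotomy′ {R} R∈V = trichotomy (DefinableFrom-isDefinabilitySpace F) (DefinableFrom-generator F 1F)
      (DefinableFrom-generator F 0F) (V⊆Ord R∈V)
      where
      F : Fin 2 → ∃ (Relation ℤ)
      F = lookup (R ∷ relation +1 ∷ [])

    without-successor : ∃ λ s → V ≐ space s
    without-successor with em₁ (∃ λ R → R ∈ V × relation Ord ∈ Oriented R) | em₁
        (∃ λ R → R ∈ V × relation C ∈ Oriented R)
    -- Betweenness is definable from <, hence from R and the successor, and being flip-invariant it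
    -- already belongs to V.
    ... | yes (R , R∈V , Ord∈) | _ = B , between-spaces B
      (unoriented R∈V between-flipInvariant (DefinableFrom-⊆ (λ _ → Ord∈) between∈⟨<⟩))
      (λ R∈V → flip-part B Ord less∈⟨between,+1⟩ between-flipInvariant R∈V (V⊆Ord R∈V))
    ... | no noOrd | yes (R , R∈V , C∈) = S , between-spaces S
      (unoriented R∈V separation-flipInvariant (DefinableFrom-⊆ (λ _ → C∈) separation∈⟨cycle⟩))
      (λ R∈V → flip-part S C cycle∈⟨separation,+1⟩ separation-flipInvariant R∈V (case trichotomy′ R∈V of λ
        { (inj₁ Ord∈)              → ⊥-elim (noOrd (_ , R∈V , Ord∈))
        ; (inj₂ (inj₁ (R∈C , _))) → R∈C
        ; (inj₂ (inj₂ R∈+1))      → star-⊆ (+1⟶C ◅ ε) R∈+1 }))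
    ... | no noOrd | no noC = A₁₁ , between-spaces A₁₁ A₁₁∈V
      (λ R∈V → flip-part A₁₁ +1 (DefinableFrom-generator (lookup (relation A₁₁ ∷ relation +1 ∷ [])) 1F)
        codirection₁-flipInvariant R∈V (case trichotomy′ R∈V of λ
        { (inj₁ Ord∈)             → ⊥-elim (noOrd (_ , R∈V , Ord∈))
        ; (inj₂ (inj₁ (_ , C∈))) → ⊥-elim (noC (_ , R∈V , C∈))
        ; (inj₂ (inj₂ R∈+1))     → R∈+1 }))

  classification : ∃ λ s → V ≐ space s
  classification with emℓ (relation +1 ∈ V)
  ... | yes +1∈V = with-successor +1∈V
  ... | no +1∉V  = without-successor +1∉V

isDefinabilitySpace-resp-≐ : ∀ {ℓ} {V : RelationSet ℤ ℓ} {W : RelationSet ℤ 0ℓ} → V ≐ W → IsDefinabilitySpace W →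
    IsDefinabilitySpace V
isDefinabilitySpace-resp-≐ (V⊆W , W⊆V) W-space F F∈V = W⊆V ∘ W-space F (V⊆W ∘ F∈V)

mainTheorem1 : ∀ {ℓ} → ExcludedMiddle (Level.suc ℓ) →
    ((V : RelationSet ℤ ℓ) →
    (IsDefinabilitySpace V × space A₁₁ ⊆ V × V ⊆ space Ord) ⇔ (∃ λ s → V ≐ space s))
    × (∀ s t → s ≢ t → ¬ (space s ≐ space t))
    × (∀ {s t} → s ⟶ t → space s ⊂ space t)
    × (∀ s t → space s ⊆ space t → Star _⟶_ s t)
    × Incomparable +1 S × Incomparable +1 B × Incomparable B C
mainTheorem1 em =
  (λ V → mk⇔
    (λ (V-space , A₁₁⊆V , V⊆Ord) → Classification.classification em V-space A₁₁⊆V V⊆Ord)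
    (λ (s , V≐s@(V⊆s , s⊆V)) → isDefinabilitySpace-resp-≐ V≐s (space-isDefinabilitySpace s) ,
      s⊆V ∘ star-⊆ (bottom s) , star-⊆ (top s) ∘ V⊆s)) ,
  spaces-distinct , edge-⊂ , inclusion⇒star ,
  (⊈-between +1∤B ε (S⟶B ◅ ε) , ⊈-between S∤+1 ε ε) ,
  (⊈-between +1∤B ε ε , ⊈-between S∤+1 (S⟶B ◅ ε) ε) ,
  (⊈-between B∤C ε ε , ⊈-between +1∤B (+1⟶C ◅ ε) ε)
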